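{- Let $H$ and $H'$ be cubic graphs, each on at least $6$ vertices, with $H$ non-hamiltonian and $H'$ hypohamiltonian. Let $ab, cd \in E(H)$ be independent edges, let $x,y$ be adjacent vertices of $H'$, let $a',b'$ be the neighbours of $x$ other than $y$, and $c',d'$ the neighbours of $y$ other than $x$. Suppose that each of the pairs $(a,c)$, $(a,d)$, $(b,c)$, $(b,d)$ is good in $H - \{ab, cd\}$, that the two pairs $((a,b),(c,d))$ are good in $H - \{ab, cd\}$, and that for each vertex $t \in V(H)$, at least one of $(a,b)$ or $(c,d)$ is good in $H - \{t, ab, cd\}$. Then the dot product $H \cdot H'$ is a cubic hypohamiltonian graph. If moreover $H$ and $H'$ are planar and $ab$ and $cd$ lie on the same facial cycle of $H$, then the dot product can be applied (i.e. the labelling of $a',b',c',d'$ can be chosen) such that $H \cdot H'$ is planar. Finally, if $g$ and $g'$ are the girths of $H$ and $H'$ respectively, then the girth of $H \cdot H'$ is at least $\min\{g, g'\}$.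
   Context: Graphs are finite, simple, undirected. A graph is hamiltonian if it has a cycle through all vertices; it is hypohamiltonian if it is non-hamiltonian but $G - v$ is hamiltonian for every vertex $v$. Two edges are independent if they share no vertex. For vertices $v,w$ of a graph $G$, the pair $(v,w)$ is good in $G$ if $G$ has a hamiltonian path with end-vertices $v$ and $w$. Two pairs $((v,w),(x,y))$ are good in $G$ if there exist two disjoint paths which together span (cover all vertices of) $G$, one with end-vertices $v,w$ and the other with end-vertices $x,y$. Dot product: with $H,H',ab,cd,x,y,a',b',c',d'$ as in the claim, let $J = H - \{ab, cd\}$ (edges removed) and $J' = H' - \{x,y\}$ (vertices removed); then $H \cdot H'$ is the graph with vertex set $V(H) \cup V(J')$ and edge set $E(J) \cup E(J') \cup \{aa', bb', cc', dd'\}$. The girth is the length of a shortest cycle. -}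

module Defs where

open import Data.Bool using (Bool; true; false; _∧_; _∨_; not; T)
open import Data.Bool.Properties using (∧-comm; ∨-comm)
open import Data.Nat using (ℕ; zero; suc; _+_; _*_; _≤_; _≡ᵇ_)
open import Data.Fin using (Fin; zero; suc; punchIn; punchOut; splitAt; _≟_)
open import Data.Sum using (_⊎_; inj₁; inj₂)
open import Data.Product using (Σ; ∃; ∃₂; _×_; _,_; proj₁; proj₂)
open import Data.Maybe using (just)
open import Data.List using (List; []; _∷_; length; filterᵇ; allFin; head; last; _++_; map)
open import Data.Nat.ListAction using (sum)
open import Data.List.Membership.Propositional using (_∈_)
open import Data.List.Relation.Unary.Linked using (Linked)
open import Data.List.Relation.Unary.Unique.Propositional using (Unique)
open import Data.Empty using (⊥)
open import Relation.Nullary using (¬_; does; yes; no)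
open import Relation.Binary.PropositionalEquality using (_≡_; _≢_; refl; sym; cong; cong₂; subst)

record Graph (n : ℕ) : Set where
  field
    adj    : Fin n → Fin n → Bool
    adj-sym : ∀ i j → adj i j ≡ adj j i
    adj-irrefl : ∀ i → adj i i ≡ false
open Graph public

Adj : ∀ {n} → Graph n → Fin n → Fin n → Set
Adj G u v = T (adj G u v)

_==_ : ∀ {n} → Fin n → Fin n → Bool
i == j = does (i ≟ j)

==-sym : ∀ {n} (i j : Fin n) → (i == j) ≡ (j == i)
==-sym i j with i ≟ j | j ≟ i
... | yes _ | yes _ = refl
... | no _  | no _  = refl
... | yes p | no q  = Data.Empty.⊥-elim (q (sym p))
  where import Data.Empty
... | no p  | yes q = Data.Empty.⊥-elim (p (sym q))
  where import Data.Empty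

==-refl : ∀ {n} (i : Fin n) → (i == i) ≡ true
==-refl i with i ≟ i
... | yes _ = refl
... | no p  = Data.Empty.⊥-elim (p refl)
  where import Data.Empty

adj⇒≢ : ∀ {n} (G : Graph n) {u v : Fin n} → Adj G u v → u ≢ v
adj⇒≢ G {u} p refl = subst T (adj-irrefl G u) p

deg : ∀ {n} → Graph n → Fin n → ℕ
deg {n} G v = length (filterᵇ (adj G v) (allFin n))

Cubic : ∀ {n} → Graph n → Set
Cubic {n} G = ∀ (v : Fin n) → deg G v ≡ 3

isEdge : ∀ {n} → Fin n → Fin n → Fin n → Fin n → Bool
isEdge a b i j = ((i == a) ∧ (j == b)) ∨ ((i == b) ∧ (j == a))

isEdge-sym : ∀ {n} (a b i j : Fin n) → isEdge a b i j ≡ isEdge a b j i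
isEdge-sym a b i j
  rewrite ∧-comm (i == a) (j == b) | ∧-comm (i == b) (j == a)
  = ∨-comm (j == b ∧ i == a) (j == a ∧ i == b)

delEdge : ∀ {n} → Graph n → Fin n → Fin n → Graph n
delEdge G a b = record
  { adj = λ i j → adj G i j ∧ not (isEdge a b i j)
  ; adj-sym = λ i j → cong₂ _∧_ (adj-sym G i j) (cong not (isEdge-sym a b i j))
  ; adj-irrefl = λ i → cong (_∧ not (isEdge a b i i)) (adj-irrefl G i)
  }

_─_ : ∀ {k} → Graph (suc k) → Fin (suc k) → Graph k
G ─ v = record
  { adj = λ i j → adj G (punchIn v i) (punchIn v j)
  ; adj-sym = λ i j → adj-sym G (punchIn v i) (punchIn v j)
  ; adj-irrefl = λ i → adj-irrefl G (punchIn v i)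
  }

IsPath : ∀ {n} → Graph n → List (Fin n) → Fin n → Fin n → Set
IsPath G p v w = Linked (Adj G) p × head p ≡ just v × last p ≡ just w

IsCycle : ∀ {n} → Graph n → List (Fin n) → Set
IsCycle G p = Unique p × 3 ≤ length p × Linked (Adj G) p
            × ∃₂ λ u w → head p ≡ just u × last p ≡ just w × Adj G w u

Hamiltonian : ∀ {n} → Graph n → Set
Hamiltonian {n} G = ∃ λ p → IsCycle G p × (∀ (v : Fin n) → v ∈ p)

Hypohamiltonian : ∀ {k} → Graph (suc k) → Set
Hypohamiltonian G = ¬ Hamiltonian G × (∀ v → Hamiltonian (G ─ v))

GoodPair : ∀ {n} → Graph n → Fin n → Fin n → Set
GoodPair {n} G v w = ∃ λ p → Unique p × (∀ (u : Fin n) → u ∈ p) × IsPath G p v w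

GoodTwoPairs : ∀ {n} → Graph n → Fin n → Fin n → Fin n → Fin n → Set
GoodTwoPairs {n} G v w x y =
  ∃₂ λ p q → Unique (p ++ q) × (∀ (u : Fin n) → u ∈ p ++ q)
           × IsPath G p v w × IsPath G q x y

GoodPairDel : ∀ {k} → Graph (suc k) → Fin (suc k) → Fin (suc k) → Fin (suc k) → Set
GoodPairDel G t v w =
  ∃₂ λ v₀ w₀ → punchIn t v₀ ≡ v × punchIn t w₀ ≡ w × GoodPair (G ─ t) v₀ w₀

IsGirth : ∀ {n} → Graph n → ℕ → Set
IsGirth G g = (∃ λ p → IsCycle G p × length p ≡ g)
            × (∀ p → IsCycle G p → g ≤ length p)

-- Dot product.  H on Fin n₁; H' on Fin (suc (suc m)); J' = H' - {x, y}
-- has vertex set Fin m (embedded via emb); H · H' has vertex set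
-- Fin (n₁ + m), first the vertices of H, then those of J'.

emb : ∀ {m} (x y : Fin (suc (suc m))) → x ≢ y → Fin m → Fin (suc (suc m))
emb x y x≢y k = punchIn x (punchIn (punchOut x≢y) k)

cross : ∀ {n₁ m} (a b c d : Fin n₁) (a' b' c' d' : Fin m) → Fin n₁ → Fin m → Bool
cross a b c d a' b' c' d' h v =
  ((h == a) ∧ (v == a')) ∨ ((h == b) ∧ (v == b')) ∨ ((h == c) ∧ (v == c')) ∨ ((h == d) ∧ (v == d'))

dot : ∀ {n₁ m} (H : Graph n₁) (H' : Graph (suc (suc m)))
      (a b c d : Fin n₁) (x y : Fin (suc (suc m))) → Adj H' x y →
      (a' b' c' d' : Fin (suc (suc m))) → Graph (n₁ + m)
dot {n₁} {m} H H' a b c d x y xy a' b' c' d' = record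
  { adj = dadj ; adj-sym = dsym ; adj-irrefl = dirr }
  where
  J : Graph n₁
  J = delEdge (delEdge H a b) c d
  e : Fin m → Fin (suc (suc m))
  e = emb x y (adj⇒≢ H' xy)
  cr : Fin n₁ → Fin m → Bool
  cr h k = cross a b c d a' b' c' d' h (e k)
  dadj : Fin (n₁ + m) → Fin (n₁ + m) → Bool
  dadj i j with splitAt n₁ i | splitAt n₁ j
  ... | inj₁ h | inj₁ h' = adj J h h'
  ... | inj₂ k | inj₂ k' = adj H' (e k) (e k')
  ... | inj₁ h | inj₂ k  = cr h k
  ... | inj₂ k | inj₁ h  = cr h k
  dsym : ∀ i j → dadj i j ≡ dadj j i
  dsym i j with splitAt n₁ i | splitAt n₁ j
  ... | inj₁ h | inj₁ h' = adj-sym J h h'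
  ... | inj₂ k | inj₂ k' = adj-sym H' (e k) (e k')
  ... | inj₁ h | inj₂ k  = refl
  ... | inj₂ k | inj₁ h  = refl
  dirr : ∀ i → dadj i i ≡ false
  dirr i with splitAt n₁ i
  ... | inj₁ h = adj-irrefl J h
  ... | inj₂ k = adj-irrefl H' (e k)

OtherNeighbours : ∀ {n} → Graph n → Fin n → Fin n → Fin n → Fin n → Set
OtherNeighbours G x y a' b' =
  Adj G x a' × Adj G x b' × a' ≢ b' × a' ≢ y × b' ≢ y

iter : ∀ {A : Set} → (A → A) → ℕ → A → A
iter f zero    a = a
iter f (suc k) a = f (iter f k a)

record RotationSystem {n} (G : Graph n) : Set where
  field
    rot     : Fin n → Fin n → Fin n
    rot-adj : ∀ v u → Adj G v u → Adj G v (rot v u)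
    rot-inj : ∀ v u w → Adj G v u → Adj G v w → rot v u ≡ rot v w → u ≡ w
    rot-cyc : ∀ v u w → Adj G v u → Adj G v w → ∃ λ k → iter (rot v) k u ≡ w
open RotationSystem public

Dart : ℕ → Set
Dart n = Fin n × Fin n

IsDart : ∀ {n} → Graph n → Dart n → Set
IsDart G (u , v) = Adj G u v

faceStep : ∀ {n} {G : Graph n} → RotationSystem G → Dart n → Dart n
faceStep R (u , v) = (v , rot R v u)

SameFace : ∀ {n} {G : Graph n} → RotationSystem G → Dart n → Dart n → Set
SameFace R d d' = ∃ λ k → iter (faceStep R) k d ≡ d'

HasFaces : ∀ {n} {G : Graph n} → RotationSystem G → ℕ → Set
HasFaces {n} {G} R F =
  ∃ λ (lab : Dart n → Fin F) →
      (∀ i → ∃ λ d → IsDart G d × lab d ≡ i)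
    × (∀ d d' → IsDart G d → IsDart G d' →
         (lab d ≡ lab d' → SameFace R d d') × (SameFace R d d' → lab d ≡ lab d'))

Connected : ∀ {n} → Graph n → Fin n → Fin n → Set
Connected G u v = ∃ λ p → IsPath G p u v

HasComponents : ∀ {n} → Graph n → ℕ → Set
HasComponents {n} G C =
  ∃ λ (lab : Fin n → Fin C) →
      (∀ i → ∃ λ v → lab v ≡ i)
    × (∀ u v → (lab u ≡ lab v → Connected G u v) × (Connected G u v → lab u ≡ lab v))

numIsolated : ∀ {n} → Graph n → ℕ
numIsolated {n} G = length (filterᵇ (λ v → deg G v ≡ᵇ 0) (allFin n))

sumDeg : ∀ {n} → Graph n → ℕ
sumDeg {n} G = sum (map (deg G) (allFin n))

-- R has genus 0 on every component: Euler's formula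
--   V - E + F = 2C - I   (I = isolated vertices), multiplied by 2
--   with 2E = sum of degrees.
IsPlanarEmbedding : ∀ {n} {G : Graph n} → RotationSystem G → Set
IsPlanarEmbedding {n} {G} R =
  ∃₂ λ F C → HasFaces R F × HasComponents G C
           × 2 * n + 2 * F + 2 * numIsolated G ≡ sumDeg G + 4 * C

Planar : ∀ {n} → Graph n → Set
Planar G = ∃ λ (R : RotationSystem G) → IsPlanarEmbedding R

EdgeOnFace : ∀ {n} {G : Graph n} → RotationSystem G → Fin n → Fin n → Dart n → Set
EdgeOnFace R u v d = SameFace R d (u , v) ⊎ SameFace R d (v , u)

PlanarWithCommonFace : ∀ {n} → Graph n → Fin n → Fin n → Fin n → Fin n → Set
PlanarWithCommonFace G a b c d =
  ∃ λ (R : RotationSystem G) → IsPlanarEmbedding R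
    × ∃ λ dt → IsDart G dt × EdgeOnFace R a b dt × EdgeOnFace R c d dt

{-# OPTIONS --safe #-}

-- A cycle of H · H' meets the cut {aa', bb', cc', dd'} in 0, 2 or 4 edges.  Its
-- segments on one side of the cut, closed up by ab and cd in H or through x and
-- y in H', form a cycle of H or of H' which is no longer, and which is
-- hamiltonian if the given one is: this yields both the non-hamiltonicity and
-- the girth bound.  Conversely, hamiltonian cycles of the graphs (H · H') - v
-- are glued from the good paths of H and pieces of hamiltonian cycles of
-- vertex-deleted subgraphs of H'.
--
-- For planarity, the face permutation of H · H' is obtained from those of H and
-- H' - xy by exchanging the images of two darts, four times.  An exchange
-- either joins two orbits or splits one.  Euler's inequality V - E + F ≤ 2 for
-- the connected graphs H - ab, H - {ab, cd} and H' - xy forces the deletions of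
-- ab, cd and xy to join faces; hence the first three exchanges join and the last
-- one splits, so that the number of faces is the one Euler's formula demands.
module Submission where

open import Defs
open import Data.Nat using (ℕ; suc; _≤_; _⊓_)
open import Data.Fin using (Fin)
open import Data.Sum using (_⊎_)
open import Data.Product using (_×_; ∃; ∃₂)
open import Data.List using (length)
open import Relation.Nullary using (¬_)
open import Relation.Binary.PropositionalEquality using (_≢_)

open import Data.Bool using (Bool; true; false; T; _∧_; _∨_; not; if_then_else_; _xor_)
open import Data.Bool.Properties using (T?; T-∧; T-∨; not-involutive) renaming (_≟_ to _≟ᵇ_)
open import Data.Empty using (⊥; ⊥-elim)
open import Data.Fin using (zero; suc; punchIn; punchOut; _≟_; splitAt; join)
open import Data.Fin.Properties
  using (any?; splitAt-join; join-splitAt; injective⇒≤; suc-injective; punchIn-injective; punchInᵢ≢i;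
         punchIn-punchOut; punchOut-injective; punchOut-punchIn; punchOut-cong)
open import Data.List using (List; []; _∷_; _++_; map; concatMap; filterᵇ; allFin; head; last; reverse)
open import Data.List.Membership.Propositional using (_∈_; _∉_)
open import Data.List.Membership.Propositional.Properties
  using (∈-∃++; ∈-++⁺ˡ; ∈-++⁺ʳ; ∈-++⁻; ∈-allFin; ∈-filter⁺; ∈-filter⁻; ∈-map⁺; ∈-map⁻)
open import Data.List.Properties
  using (length-++; length-map; length-tabulate; map-++; map-id; ++-assoc; ++-identityʳ; unfold-reverse; ∷-injectiveˡ)
open import Data.List.Relation.Binary.Permutation.Propositional
  using (_↭_; ↭-refl; ↭-reflexive; ↭-sym; ↭-trans; prep; swap; ↭⇒↭ₛ)
open import Data.List.Relation.Binary.Permutation.Propositional.Properties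
  using (∈-resp-↭; ↭-length; ++⁺; ++⁺ˡ; ++⁺ʳ; ++-comm; shifts; map⁺; ↭-reverse)
import Data.List.Relation.Binary.Permutation.Setoid.Properties as ↭ₛ
open import Data.List.Relation.Unary.All as All using (All; []; _∷_)
open import Data.List.Relation.Unary.All.Properties as Allₚ using ()
open import Data.List.Relation.Unary.AllPairs using ([]; _∷_)
open import Data.List.Relation.Unary.Any using (here; there)
open import Data.List.Relation.Unary.Linked using (Linked; [-]; _∷_)
open import Data.List.Relation.Unary.Unique.Propositional using (Unique)
open import Data.List.Relation.Unary.Unique.Propositional.Properties as Uniqueₚ
  using (allFin⁺; filter⁺; Unique[x∷xs]⇒x∉xs)
open import Data.Maybe using (just)
open import Data.Nat using (zero; _+_; _*_; _≡ᵇ_; z≤n; s≤s)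
open import Data.Nat.ListAction using (sum)
open import Data.Nat.Properties as ℕₚ using (≤-trans; ≤-refl; ≤-antisym)
open import Data.Nat.Tactic.RingSolver using (solve-∀)
open import Data.Product using (_,_; proj₁; proj₂)
open import Data.Product.Properties using () renaming (≡-dec to ×-≡-dec)
open import Data.Sum as Sum using (inj₁; inj₂)
open import Data.Sum.Properties using (inj₁-injective; inj₂-injective) renaming (≡-dec to ⊎-≡-dec)
open import Function using (_∘_; id)
open import Function.Bundles using (Equivalence)
open import Relation.Binary using (DecidableEquality)
open import Relation.Binary.Construct.Closure.ReflexiveTransitive as Star using (Star; ε; _◅_; _◅◅_)
open import Relation.Binary.PropositionalEquality
  using (_≡_; refl; sym; trans; cong; cong₂; subst; subst₂; setoid; module ≡-Reasoning)
open import Relation.Nullary using (yes; no; Dec)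
open import Relation.Nullary.Decidable using (_×-dec_)

-- Faces are counted on a fixed set: all darts of `H` and of `H'`. A dart outside the current
-- subgraph remains as a half-edge, which the face permutation turns around on the spot, so deleting
-- an edge merely exchanges two images. The vertices `x` and `y` stay too: two exchanges replace the
-- edges `ab` and `xb'` by `ax` and `bb'`, and `x` becomes an inner point of `aa'`; likewise `y` of
-- `cc'`. The faces of the dot product are the orbits obtained, with the darts at `x` and `y`
-- skipped.
--
-- On `H`, the common face and the faces across `ab` and across `cd` are pairwise distinct, for
-- otherwise deleting `ab` and then `cd` would split a face. Hence the exchanges at `a`, `b`, `d`
-- meet new orbits, while the one at `c` finds its two darts already joined by way of `a`.
--
-- The connectedness that Euler's inequality asks for comes from the paths: a good path spans `J`,
-- and a hamiltonian cycle of `H' - y`, with `x` taken out, spans `J'`.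

join-injective : ∀ m n {u v} → join m n u ≡ join m n v → u ≡ v
join-injective m n {u} {v} p = trans (sym (splitAt-join m n u)) (trans (cong (splitAt m) p) (splitAt-join m n v))

splitAt-injective : ∀ m {n} {i j : Fin (m + n)} → splitAt m i ≡ splitAt m j → i ≡ j
splitAt-injective m {n} {i} {j} p = trans (sym (join-splitAt m n i)) (trans (cong (join m n) p) (join-splitAt m n j))

-- Neighbours and darts

-- Pigeonhole along a relation, since neighbours in different graphs will be matched by the relation
-- `Θ`. The partner of the first element is cut out of `ys`; injectivity of `R` keeps it from being
-- asked for again.
length-⊆-rel : ∀ {A B : Set} (R : A → B → Set)
  → (∀ {x x' y} → R x y → R x' y → x ≡ x')
  → ∀ {xs ys} → Unique xs → (∀ {x} → x ∈ xs → ∃ λ y → y ∈ ys × R x y)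
  → length xs ≤ length ys
length-⊆-rel R inj {[]} _ _ = z≤n
length-⊆-rel R inj {x ∷ xs} {ys} u@(_ ∷ uxs) sub with sub (here refl)
... | y , y∈ , r with ∈-∃++ y∈
... | as , bs , refl = subst (suc (length xs) ≤_) eq (s≤s (length-⊆-rel R inj uxs sub'))
  where
  eq : suc (length (as ++ bs)) ≡ length (as ++ y ∷ bs)
  eq rewrite length-++ as {bs} | length-++ as {y ∷ bs} = sym (ℕₚ.+-suc _ _)
  sub' : ∀ {x'} → x' ∈ xs → ∃ λ y' → y' ∈ as ++ bs × R x' y'
  sub' x'∈ with sub (there x'∈)
  ... | y' , y'∈ , r' with ∈-++⁻ as y'∈
  ... | inj₁ p = y' , ∈-++⁺ˡ p , r'
  ... | inj₂ (there p) = y' , ∈-++⁺ʳ as p , r'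
  ... | inj₂ (here refl) = ⊥-elim (Unique[x∷xs]⇒x∉xs u (subst (_∈ xs) (inj r' r) x'∈))

length-⊆ : ∀ {A : Set} {xs ys : List A} → Unique xs → (∀ {x} → x ∈ xs → x ∈ ys)
  → length xs ≤ length ys
length-⊆ u sub = length-⊆-rel _≡_ (λ p q → trans p (sym q)) u (λ x∈ → _ , sub x∈ , refl)

nbrs : ∀ {n} → Graph n → Fin n → List (Fin n)
nbrs {n} G v = filterᵇ (adj G v) (allFin n)

∈-nbrs⁺ : ∀ {n} (G : Graph n) {v u} → Adj G v u → u ∈ nbrs G v
∈-nbrs⁺ G {v} {u} p = ∈-filter⁺ (T? ∘ adj G v) (∈-allFin u) p

∈-nbrs⁻ : ∀ {n} (G : Graph n) {v u} → u ∈ nbrs G v → Adj G v u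
∈-nbrs⁻ {n} G {v} p = proj₂ (∈-filter⁻ (T? ∘ adj G v) {xs = allFin n} p)

nbrs-unique : ∀ {n} (G : Graph n) v → Unique (nbrs G v)
nbrs-unique {n} G v = filter⁺ (T? ∘ adj G v) (allFin⁺ n)

deg-≤ : ∀ {n n'} (G : Graph n) (G' : Graph n') {v v'} (R : Fin n → Fin n' → Set)
  → (∀ {x x' y} → R x y → R x' y → x ≡ x')
  → (∀ {u} → Adj G v u → ∃ λ u' → Adj G' v' u' × R u u')
  → deg G v ≤ deg G' v'
deg-≤ G G' {v} R inj f = length-⊆-rel R inj (nbrs-unique G v)
  λ u∈ → let (u' , p , r) = f (∈-nbrs⁻ G u∈) in u' , ∈-nbrs⁺ G' p , r

cubic-cover : ∀ {n} (G : Graph n) {v p q r} → deg G v ≡ 3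
  → Adj G v p → Adj G v q → Adj G v r → p ≢ q → p ≢ r → q ≢ r
  → ∀ {u} → Adj G v u → u ≡ p ⊎ u ≡ q ⊎ u ≡ r
cubic-cover G {v} {p} {q} {r} d3 vp vq vr p≢q p≢r q≢r {u} vu
  with u ≟ p | u ≟ q | u ≟ r
... | yes e | _ | _ = inj₁ e
... | no _ | yes e | _ = inj₂ (inj₁ e)
... | no _ | no _ | yes e = inj₂ (inj₂ e)
... | no u≢p | no u≢q | no u≢r = ⊥-elim (ℕₚ.1+n≰n (subst (4 ≤_) d3 (length-⊆ uniq sub)))
  where
  uniq : Unique (u ∷ p ∷ q ∷ r ∷ [])
  uniq = (u≢p ∷ u≢q ∷ u≢r ∷ []) ∷ (p≢q ∷ p≢r ∷ []) ∷ (q≢r ∷ []) ∷ [] ∷ []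
  sub : ∀ {w} → w ∈ u ∷ p ∷ q ∷ r ∷ [] → w ∈ nbrs G v
  sub (here refl) = ∈-nbrs⁺ G vu
  sub (there (here refl)) = ∈-nbrs⁺ G vp
  sub (there (there (here refl))) = ∈-nbrs⁺ G vq
  sub (there (there (there (here refl)))) = ∈-nbrs⁺ G vr

cubic-third : ∀ {n} (G : Graph n) {v} → deg G v ≡ 3 → ∀ p q
  → ∃ λ u → Adj G v u × u ≢ p × u ≢ q
cubic-third G {v} d3 p q = go (nbrs G v) d3 (nbrs-unique G v) (∈-nbrs⁻ G)
  where
  go : ∀ l → length l ≡ 3 → Unique l → (∀ {u} → u ∈ l → Adj G v u)
     → ∃ λ u → Adj G v u × u ≢ p × u ≢ q
  go (a ∷ b ∷ c ∷ []) _ ((a≢b ∷ a≢c ∷ _) ∷ (b≢c ∷ _) ∷ _) f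
    with a ≟ p | a ≟ q | b ≟ p | b ≟ q
  ... | no x | no y | _ | _ = a , f (here refl) , x , y
  ... | _ | _ | no x | no y = b , f (there (here refl)) , x , y
  ... | yes x | yes y | yes z | _ = ⊥-elim (a≢b (trans x (sym z)))
  ... | yes x | yes y | no _ | yes z = ⊥-elim (a≢b (trans y (sym z)))
  ... | yes x | no y | yes z | _ = ⊥-elim (a≢b (trans x (sym z)))
  ... | no y | yes x | _ | yes z = ⊥-elim (a≢b (trans x (sym z)))
  ... | yes x | no y | no _ | yes z = c , f (there (there (here refl))) ,
        (λ e → a≢c (trans x (sym e))) , (λ e → b≢c (trans z (sym e)))
  ... | no y | yes x | yes z | no _ = c , f (there (there (here refl))) ,
        (λ e → b≢c (trans z (sym e))) , (λ e → a≢c (trans x (sym e)))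

T-isEdge : ∀ {n} {a b i j : Fin n} → T (isEdge a b i j) → (i ≡ a × j ≡ b) ⊎ (i ≡ b × j ≡ a)
T-isEdge {a = a} {b} {i} {j} t with i ≟ a | j ≟ b | i ≟ b | j ≟ a
... | yes p | yes q | _ | _ = inj₁ (p , q)
... | yes _ | no _ | yes p | yes q = inj₂ (p , q)
... | no _ | _ | yes p | yes q = inj₂ (p , q)

isEdge-T₁ : ∀ {n} (a b : Fin n) → T (isEdge a b a b)
isEdge-T₁ a b rewrite ==-refl a | ==-refl b = _

T-∧⁺ : ∀ {x y} → T x → T y → T (x ∧ y)
T-∧⁺ p q = Equivalence.from T-∧ (p , q)

T-∧⁻ : ∀ {x y} → T (x ∧ y) → T x × T y
T-∧⁻ = Equivalence.to T-∧

T-not⁺ : ∀ {x} → ¬ T x → T (not x)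
T-not⁺ {true} f = ⊥-elim (f _)
T-not⁺ {false} _ = _

T-not⁻ : ∀ {x} → T (not x) → ¬ T x
T-not⁻ {false} _ ()

Adj-sym : ∀ {n} (G : Graph n) {u v} → Adj G u v → Adj G v u
Adj-sym G {u} {v} = subst T (adj-sym G u v)

delEdge-⊆ : ∀ {n} (G : Graph n) {a b u v} → Adj (delEdge G a b) u v → Adj G u v
delEdge-⊆ G = proj₁ ∘ T-∧⁻

delEdge-∌ : ∀ {n} (G : Graph n) {a b} → ¬ Adj (delEdge G a b) a b
delEdge-∌ G {a} {b} p = T-not⁻ (proj₂ (T-∧⁻ {adj G a b} p)) (isEdge-T₁ a b)

delEdge⁺ : ∀ {n} (G : Graph n) {a b u v} → Adj G u v
  → ¬ (u ≡ a × v ≡ b) → ¬ (u ≡ b × v ≡ a) → Adj (delEdge G a b) u v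
delEdge⁺ G {a} {b} {u} {v} p f g = T-∧⁺ p (T-not⁺ λ t → case (T-isEdge {a = a} {b} {u} {v} t))
  where
  case : (u ≡ a × v ≡ b) ⊎ (u ≡ b × v ≡ a) → ⊥
  case (inj₁ x) = f x
  case (inj₂ x) = g x

sumDeg-cubic : ∀ {n} (G : Graph n) → Cubic G → sumDeg G ≡ 3 * n
sumDeg-cubic {n} G cub = trans (go (allFin n)) (trans (cong (_* 3) (length-tabulate {n = n} id)) (ℕₚ.*-comm n 3))
  where
  go : ∀ l → sum (map (deg G) l) ≡ length l * 3
  go [] = refl
  go (v ∷ l) = cong₂ _+_ (cub v) (go l)

numIsolated-cubic : ∀ {n} (G : Graph n) → Cubic G → numIsolated G ≡ 0
numIsolated-cubic {n} G cub = go (allFin n)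
  where
  go : ∀ l → length (filterᵇ (λ v → deg G v ≡ᵇ 0) l) ≡ 0
  go [] = refl
  go (v ∷ l) rewrite cub v = go l

darts : ∀ {n} → Graph n → List (Fin n × Fin n)
darts {n} G = concatMap (λ u → map (u ,_) (nbrs G u)) (allFin n)

length-darts : ∀ {n} (G : Graph n) → length (darts G) ≡ sumDeg G
length-darts {n} G = go (allFin n)
  where
  go : ∀ l → length (concatMap (λ u → map (u ,_) (nbrs G u)) l) ≡ sum (map (deg G) l)
  go [] = refl
  go (u ∷ l) rewrite length-++ (map (u ,_) (nbrs G u)) {concatMap (λ u → map (u ,_) (nbrs G u)) l}
                   | length-map (u ,_) (nbrs G u) = cong (deg G u +_) (go l)

∈-darts⁺ : ∀ {n} (G : Graph n) {u v} → Adj G u v → (u , v) ∈ darts G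
∈-darts⁺ {n} G {u} {v} p = go (allFin n) (∈-allFin u)
  where
  go : ∀ l → u ∈ l → (u , v) ∈ concatMap (λ u → map (u ,_) (nbrs G u)) l
  go (_ ∷ l) (here refl) = ∈-++⁺ˡ (∈-map⁺ (u ,_) (∈-nbrs⁺ G p))
  go (w ∷ l) (there q) = ∈-++⁺ʳ (map (w ,_) (nbrs G w)) (go l q)

∈-darts⁻ : ∀ {n} (G : Graph n) {u v} → (u , v) ∈ darts G → Adj G u v
∈-darts⁻ {n} G {u} {v} p = proj₂ (go (allFin n) p)
  where
  go : ∀ l → (u , v) ∈ concatMap (λ u → map (u ,_) (nbrs G u)) l → u ∈ l × Adj G u v
  go (w ∷ l) q with ∈-++⁻ (map (w ,_) (nbrs G w)) q
  ... | inj₂ r = let (x , y) = go l r in there x , y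
  ... | inj₁ r with ∈-map⁻ (w ,_) r
  ... | _ , s , refl = here refl , ∈-nbrs⁻ G s

darts-unique : ∀ {n} (G : Graph n) → Unique (darts G)
darts-unique {n} G = go (allFin n) (allFin⁺ n)
  where
  src : ∀ {d} l → d ∈ concatMap (λ u → map (u ,_) (nbrs G u)) l → proj₁ d ∈ l
  src (w ∷ l) q with ∈-++⁻ (map (w ,_) (nbrs G w)) q
  ... | inj₂ r = there (src l r)
  ... | inj₁ r with ∈-map⁻ (w ,_) r
  ... | _ , s , refl = here refl
  go : ∀ l → Unique l → Unique (concatMap (λ u → map (u ,_) (nbrs G u)) l)
  go [] _ = []
  go (w ∷ l) u@(_ ∷ ul) = Uniqueₚ.++⁺ (Uniqueₚ.map⁺ (cong proj₂) (nbrs-unique G w)) (go l ul) disj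
    where
    disj : ∀ {d} → d ∈ map (w ,_) (nbrs G w) × d ∈ concatMap (λ u → map (u ,_) (nbrs G u)) l → ⊥
    disj (p , q) with ∈-map⁻ (w ,_) p
    ... | _ , _ , refl = Unique[x∷xs]⇒x∉xs u (src l q)

-- Degree sums are lengths of dart lists, and the two darts of `ab` can be adjoined to those that
-- remain.
sumDeg-delEdge : ∀ {n} (G : Graph n) {a b} → Adj G a b → 2 + sumDeg (delEdge G a b) ≤ sumDeg G
sumDeg-delEdge G {a} {b} ab = subst₂ (λ x y → 2 + x ≤ y) (length-darts K) (length-darts G)
  (length-⊆ {xs = (a , b) ∷ (b , a) ∷ darts K}
    ((ab≢ba ∷ fresh ab∉) ∷ fresh ba∉ ∷ darts-unique K) sub)
  where
  K = delEdge G a b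
  fresh : ∀ {d} {l : List (Dart _)} → d ∉ l → All (λ x → d ≢ x) l
  fresh f = All.tabulate λ x∈ e → f (subst (_∈ _) (sym e) x∈)
  ab≢ba : (a , b) ≢ (b , a)
  ab≢ba e = adj⇒≢ G ab (cong proj₁ e)
  ab∉ : (a , b) ∉ darts K
  ab∉ p = delEdge-∌ G (∈-darts⁻ K p)
  ba∉ : (b , a) ∉ darts K
  ba∉ p = delEdge-∌ G (Adj-sym K (∈-darts⁻ K p))
  sub : ∀ {d} → d ∈ (a , b) ∷ (b , a) ∷ darts K → d ∈ darts G
  sub (here refl) = ∈-darts⁺ G ab
  sub (there (here refl)) = ∈-darts⁺ G (Adj-sym G ab)
  sub (there (there p)) = ∈-darts⁺ G (delEdge-⊆ G (∈-darts⁻ K p))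

-- Orbits of permutations

_⟨_⟩⇝_ : {D : Set} → D → (D → D) → D → Set
d ⟨ π ⟩⇝ d' = ∃ λ k → iter π k d ≡ d'

iter-+ : ∀ {A : Set} (f : A → A) j k x → iter f j (iter f k x) ≡ iter f (j + k) x
iter-+ f zero k x = refl
iter-+ f (suc j) k x = cong f (iter-+ f j k x)

iter-shift : ∀ {A : Set} (f : A → A) k x → iter f k (f x) ≡ f (iter f k x)
iter-shift f zero x = refl
iter-shift f (suc k) x = cong f (iter-shift f k x)

module _ {D : Set} {π : D → D} where

  ⇝-refl : ∀ {d} → d ⟨ π ⟩⇝ d
  ⇝-refl = 0 , refl

  ⇝-step : ∀ {d} → d ⟨ π ⟩⇝ π d
  ⇝-step = 1 , refl

  ⇝-trans : ∀ {d e f} → d ⟨ π ⟩⇝ e → e ⟨ π ⟩⇝ f → d ⟨ π ⟩⇝ f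
  ⇝-trans (j , refl) (k , refl) = k + j , sym (iter-+ π k j _)

  ⇝-≡ : ∀ {d e} → d ≡ e → d ⟨ π ⟩⇝ e
  ⇝-≡ refl = ⇝-refl

  iter-invariant : {X : Set} (P : D → Set) (g : D → X) → (∀ d → P d → P (π d))
    → (∀ d → P d → g (π d) ≡ g d) → ∀ k {d} → P d → P (iter π k d) × g (iter π k d) ≡ g d
  iter-invariant P g cl inv zero p = p , refl
  iter-invariant P g cl inv (suc k) p with iter-invariant P g cl inv k p
  ... | q , e = cl _ q , trans (inv _ q) e

  ⇝-invariant : {X : Set} (P : D → Set) (g : D → X) → (∀ d → P d → P (π d))
    → (∀ d → P d → g (π d) ≡ g d) → ∀ {d e} → P d → d ⟨ π ⟩⇝ e → g d ≡ g e
  ⇝-invariant P g cl inv p (k , refl) = sym (proj₂ (iter-invariant P g cl inv k p))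

  ⇝-closed : (P : D → Set) → (∀ d → P d → P (π d)) → ∀ {d e} → P d → d ⟨ π ⟩⇝ e → P e
  ⇝-closed P cl p (k , refl) = proj₁ (iter-invariant P (λ _ → 0) cl (λ _ _ → refl) k p)

-- HasFaces R F is definitionally HasOrbits (IsDart G) (faceStep R) F.
HasOrbits : {D : Set} (P : D → Set) (π : D → D) → ℕ → Set
HasOrbits {D} P π F =
  ∃ λ (lab : D → Fin F) →
      (∀ i → ∃ λ d → P d × lab d ≡ i)
    × (∀ d d' → P d → P d' → (lab d ≡ lab d' → d ⟨ π ⟩⇝ d') × (d ⟨ π ⟩⇝ d' → lab d ≡ lab d'))

module Orbits {D : Set} {P : D → Set} {π : D → D} {F : ℕ}
  (closed : ∀ d → P d → P (π d)) (orb : HasOrbits P π F) where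

  label : D → Fin F
  label = proj₁ orb

  label-surjective : ∀ i → ∃ λ d → P d × label d ≡ i
  label-surjective = proj₁ (proj₂ orb)

  ≡⇒⇝ : ∀ {d d'} → P d → P d' → label d ≡ label d' → d ⟨ π ⟩⇝ d'
  ≡⇒⇝ p q = proj₁ (proj₂ (proj₂ orb) _ _ p q)

  ⇝⇒≡ : ∀ {d d'} → P d → d ⟨ π ⟩⇝ d' → label d ≡ label d'
  ⇝⇒≡ p r = proj₂ (proj₂ (proj₂ orb) _ _ p (⇝-closed P closed p r)) r

  ⇝-sym : ∀ {d d'} → P d → d ⟨ π ⟩⇝ d' → d' ⟨ π ⟩⇝ d
  ⇝-sym p r = ≡⇒⇝ (⇝-closed P closed p r) p (sym (⇝⇒≡ p r))

  label-step : ∀ {d} → P d → label (π d) ≡ label d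
  label-step p = sym (⇝⇒≡ p ⇝-step)

  ⇝? : ∀ {d d'} → P d → P d' → Dec (d ⟨ π ⟩⇝ d')
  ⇝? {d} {d'} p q with label d ≟ label d'
  ... | yes e = yes (≡⇒⇝ p q e)
  ... | no ne = no (ne ∘ ⇝⇒≡ p)

orbits-≤ : ∀ {D : Set} {P : D → Set} {π : D → D} {F F'} → (∀ d → P d → P (π d))
  → HasOrbits P π F → HasOrbits P π F' → F ≤ F'
orbits-≤ {P = P} {π} {F} {F'} cl o o' = injective⇒≤ {f = f} f-inj
  where
  module O = Orbits cl o
  module O' = Orbits cl o'
  f : Fin F → Fin F'
  f i = O'.label (proj₁ (O.label-surjective i))
  f-inj : ∀ {i j} → f i ≡ f j → i ≡ j
  f-inj {i} {j} e with O.label-surjective i | O.label-surjective j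
  ... | d , p , refl | d' , p' , refl = O.⇝⇒≡ p (O'.≡⇒⇝ p p' e)

-- The induction behind Euler's inequality builds its own numbering of the orbits; this carries its
-- count over to any given numbering.
orbits-unique : ∀ {D : Set} {P : D → Set} {π : D → D} {F F'} → (∀ d → P d → P (π d))
  → HasOrbits P π F → HasOrbits P π F' → F ≡ F'
orbits-unique cl o o' = ≤-antisym (orbits-≤ cl o o') (orbits-≤ cl o' o)

module _ {F : ℕ} (i j : Fin (suc F)) (i≢j : i ≢ j) where

  identify : Fin (suc F) → Fin F
  identify k with j ≟ k
  ... | yes _ = punchOut (i≢j ∘ sym)
  ... | no j≢k = punchOut j≢k

  identify-j : identify j ≡ identify i
  identify-j with j ≟ j | j ≟ i
  ... | no q | _ = ⊥-elim (q refl)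
  ... | yes _ | yes e = ⊥-elim (i≢j (sym e))
  ... | yes _ | no _ = punchOut-cong j refl

  identify-surjective : ∀ l → ∃ λ k → identify k ≡ l
  identify-surjective l = punchIn j l , eq
    where
    eq : identify (punchIn j l) ≡ l
    eq with j ≟ punchIn j l
    ... | yes e = ⊥-elim (punchInᵢ≢i j l (sym e))
    ... | no _ = trans (punchOut-cong j refl) (punchOut-punchIn j)

  identify-≡ : ∀ k l → identify k ≡ identify l
    → k ≡ l ⊎ (k ≡ i × l ≡ j) ⊎ (k ≡ j × l ≡ i)
  identify-≡ k l e with j ≟ k | j ≟ l
  ... | yes p | yes q = inj₁ (trans (sym p) q)
  ... | yes p | no q = inj₂ (inj₂ (sym p , sym (punchOut-injective (i≢j ∘ sym) q e)))
  ... | no p | yes q = inj₂ (inj₁ (punchOut-injective p (i≢j ∘ sym) e , sym q))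
  ... | no p | no q = inj₁ (punchOut-injective p q e)

-- `π'` is `π` after the transposition of `p` and `q`. The number of orbits then changes by exactly
-- one: down if `p` and `q` lie on different orbits (`Join`), up if they are distinct and share one
-- (`Split`).
record Swapped {D : Set} (p q : D) (π π' : D → D) : Set where
  field
    at-p : π' p ≡ π q
    at-q : π' q ≡ π p
    off  : ∀ {d} → d ≢ p → d ≢ q → π' d ≡ π d

module Swap {D : Set} (_≟ᴰ_ : DecidableEquality D) {P : D → Set} {π π' : D → D} {F : ℕ}
  (closed : ∀ d → P d → P (π d)) (orb : HasOrbits P π F) {p q : D} (Pp : P p) (Pq : P q)
  (sw : Swapped p q π π') where

  open Orbits closed orb
  open Swapped sw

  closed' : ∀ d → P d → P (π' d)
  closed' d x with d ≟ᴰ p | d ≟ᴰ q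
  ... | yes refl | _ = subst P (sym at-p) (closed q Pq)
  ... | no _ | yes refl = subst P (sym at-q) (closed p Pp)
  ... | no a | no b = subst P (sym (off a b)) (closed d x)

  avoid : ∀ {d} → P d → label d ≢ label p → label d ≢ label q → ∀ k → iter π' k d ≡ iter π k d
  avoid x a b zero = refl
  avoid {d} x a b (suc k) with iter-invariant P label closed (λ _ → label-step) k x
  ... | y , e = trans (cong π' (avoid x a b k))
     (off (λ z → a (trans (sym e) (cong label z))) (λ z → b (trans (sym e) (cong label z))))

  module Join (p↛q : ¬ p ⟨ π ⟩⇝ q) where

    private
      lp≢lq : label p ≢ label q
      lp≢lq e = p↛q (≡⇒⇝ Pp Pq e)

      -- Off the two swapped points the permutations agree, so the π-path back
      -- to r survives as long as it stays away from the other orbit.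
      back : ∀ {r r'} → (∀ {d} → d ≢ r → d ≢ r' → π' d ≡ π d) → label r ≢ label r'
        → ∀ k {e} → P e → label e ≡ label r → iter π k e ≡ r → e ⟨ π' ⟩⇝ r
      back off' ne zero x l refl = ⇝-refl
      back {r} {r'} off' ne (suc k) {e} x l eq with e ≟ᴰ r
      ... | yes refl = ⇝-refl
      ... | no e≢r = ⇝-trans (1 , off' e≢r λ z → ne (trans (sym l) (cong label z)))
            (back off' ne k (closed e x) (trans (label-step x) l) (trans (iter-shift π k e) eq))

      πq⇝q : π q ⟨ π' ⟩⇝ q
      πq⇝q with ≡⇒⇝ (closed q Pq) Pq (label-step Pq)
      ... | k , eq = back (λ a b → off b a) (lp≢lq ∘ sym) k (closed q Pq) (label-step Pq) eq

      πp⇝p : π p ⟨ π' ⟩⇝ p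
      πp⇝p with ≡⇒⇝ (closed p Pp) Pp (label-step Pp)
      ... | k , eq = back off lp≢lq k (closed p Pp) (label-step Pp) eq

    -- From `p` the new permutation jumps to `π q` and then follows the old orbit of `q`, which does
    -- not contain `p`, back to `q`.
    p⇝q : p ⟨ π' ⟩⇝ q
    p⇝q = ⇝-trans (1 , at-p) πq⇝q

    q⇝p : q ⟨ π' ⟩⇝ p
    q⇝p = ⇝-trans (1 , at-q) πp⇝p

    private
      -- Only the old steps at `p` and `q` are lost. The one from `p` is recovered by going to `q`
      -- first, as `π' q ≡ π p`; the other symmetrically.
      step⁺ : ∀ d → d ⟨ π' ⟩⇝ π d
      step⁺ d with d ≟ᴰ p | d ≟ᴰ q
      ... | yes refl | _ = ⇝-trans p⇝q (1 , at-q)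
      ... | no _ | yes refl = ⇝-trans q⇝p (1 , at-p)
      ... | no a | no b = 1 , off a b

    join⁺ : ∀ {d e} → d ⟨ π ⟩⇝ e → d ⟨ π' ⟩⇝ e
    join⁺ (zero , eq) = 0 , eq
    join⁺ (suc k , refl) = ⇝-trans (join⁺ (k , refl)) (step⁺ _)

    private
      orbits-suc : ∀ {F} (l : Fin F) → ∃ λ F' → F ≡ suc F'
      orbits-suc {suc F} _ = F , refl

      build : ∀ F' → F ≡ suc F' → HasOrbits P π' F'
        × (∀ {d e} → P d → P e → d ⟨ π' ⟩⇝ e
           → d ⟨ π ⟩⇝ e ⊎ (d ⟨ π ⟩⇝ p × q ⟨ π ⟩⇝ e) ⊎ (d ⟨ π ⟩⇝ q × p ⟨ π ⟩⇝ e))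
      build F' refl = (lab' , surj , λ d d' x y → to x y , ⇝-invariant P lab' closed' inv x) , join⁻
        where
        m = identify (label p) (label q) lp≢lq
        lab' : D → Fin F'
        lab' = m ∘ label
        surj : ∀ i → ∃ λ d → P d × lab' d ≡ i
        surj i with identify-surjective (label p) (label q) lp≢lq i
        ... | k , refl with label-surjective k
        ... | d , x , refl = d , x , refl
        inv : ∀ d → P d → lab' (π' d) ≡ lab' d
        inv d x with d ≟ᴰ p | d ≟ᴰ q
        ... | yes refl | _ = trans (cong lab' at-p) (trans (cong m (label-step Pq))
                               (identify-j (label p) (label q) lp≢lq))
        ... | no _ | yes refl = trans (cong lab' at-q) (trans (cong m (label-step Pp))
                               (sym (identify-j (label p) (label q) lp≢lq)))
        ... | no a | no b = trans (cong lab' (off a b)) (cong m (label-step x))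
        cases : ∀ {d e} → P d → P e → lab' d ≡ lab' e
           → d ⟨ π ⟩⇝ e ⊎ (d ⟨ π ⟩⇝ p × q ⟨ π ⟩⇝ e) ⊎ (d ⟨ π ⟩⇝ q × p ⟨ π ⟩⇝ e)
        cases {d} {e} x y eq with identify-≡ (label p) (label q) lp≢lq (label d) (label e) eq
        ... | inj₁ r = inj₁ (≡⇒⇝ x y r)
        ... | inj₂ (inj₁ (r , s)) = inj₂ (inj₁ (≡⇒⇝ x Pp r , ≡⇒⇝ Pq y (sym s)))
        ... | inj₂ (inj₂ (r , s)) = inj₂ (inj₂ (≡⇒⇝ x Pq r , ≡⇒⇝ Pp y (sym s)))
        to : ∀ {d e} → P d → P e → lab' d ≡ lab' e → d ⟨ π' ⟩⇝ e
        to x y eq with cases x y eq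
        ... | inj₁ r = join⁺ r
        ... | inj₂ (inj₁ (r , s)) = ⇝-trans (join⁺ r) (⇝-trans p⇝q (join⁺ s))
        ... | inj₂ (inj₂ (r , s)) = ⇝-trans (join⁺ r) (⇝-trans q⇝p (join⁺ s))
        join⁻ : ∀ {d e} → P d → P e → d ⟨ π' ⟩⇝ e
           → d ⟨ π ⟩⇝ e ⊎ (d ⟨ π ⟩⇝ p × q ⟨ π ⟩⇝ e) ⊎ (d ⟨ π ⟩⇝ q × p ⟨ π ⟩⇝ e)
        join⁻ x y r = cases x y (⇝-invariant P lab' closed' inv x r)

    abstract
      joined : ∃ λ F' → F ≡ suc F' × HasOrbits P π' F'
      joined with orbits-suc (label p)
      ... | F' , eq = F' , eq , proj₁ (build F' eq)

      -- This allows further exchanges to be analysed: whether two elements share an orbit after a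
      -- join is decided by the orbits before it.
      join⁻ : ∀ {d e} → P d → P e → d ⟨ π' ⟩⇝ e
             → d ⟨ π ⟩⇝ e ⊎ (d ⟨ π ⟩⇝ p × q ⟨ π ⟩⇝ e) ⊎ (d ⟨ π ⟩⇝ q × p ⟨ π ⟩⇝ e)
      join⁻ with orbits-suc (label p)
      ... | F' , eq = proj₂ (build F' eq)

  module Split (P? : ∀ d → Dec (P d)) (p⇝q : p ⟨ π ⟩⇝ q) (p≢q : p ≢ q) where

    -- First d t: walking along π from d, the first of p and q to be met is t.
    data First : D → D → Set where
      first-p   : First p p
      first-q   : First q q
      walk : ∀ {d t} → d ≢ p → d ≢ q → First (π d) t → First d t

    private
      First-det : ∀ {d s t} → First d s → First d t → s ≡ t
      First-det first-p first-p = refl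
      First-det first-p first-q = refl
      First-det first-p (walk a _ _) = ⊥-elim (a refl)
      First-det first-q first-p = refl
      First-det first-q first-q = refl
      First-det first-q (walk _ b _) = ⊥-elim (b refl)
      First-det (walk a _ _) first-p = ⊥-elim (a refl)
      First-det (walk _ b _) first-q = ⊥-elim (b refl)
      First-det (walk _ _ x) (walk _ _ y) = First-det x y

      First-step : ∀ {d t} → d ≢ p → d ≢ q → First d t → First (π d) t
      First-step a b first-p = ⊥-elim (a refl)
      First-step a b first-q = ⊥-elim (b refl)
      First-step _ _ (walk _ _ x) = x

      first : ∀ {d} → label d ≡ label p → P d → First d p ⊎ First d q
      first {d} e x with ≡⇒⇝ x Pp e
      ... | k , eq = go k d eq
        where
        go : ∀ k d → iter π k d ≡ p → First d p ⊎ First d q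
        go zero d refl = inj₁ first-p
        go (suc k) d eq with d ≟ᴰ p | d ≟ᴰ q
        ... | yes refl | _ = inj₁ first-p
        ... | no _ | yes refl = inj₂ first-q
        ... | no a | no b with go k (π d) (trans (iter-shift π k d) eq)
        ... | inj₁ f = inj₁ (walk a b f)
        ... | inj₂ f = inj₂ (walk a b f)

      -- If `r'` is met before `r` on the way from `π r'`, then every iterate of `r'` meets `r'`
      -- first, so the orbit never reaches `r`. Hence the point met first after `p` is `q`, and
      -- conversely.
      trapped : ∀ {r r'} → r ≢ r' → r' ≡ p ⊎ r' ≡ q → r' ⟨ π ⟩⇝ r
        → (∀ {d} → d ≢ r → d ≢ r' → d ≢ p × d ≢ q) → First r r → First (π r') r' → ⊥
      trapped {r} {r'} ne tgt (k , eq) off' fr f = ne (First-det fr (subst (λ z → First z r') eq (go k)))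
        where
        base : r' ≡ p ⊎ r' ≡ q → First r' r'
        base (inj₁ refl) = first-p
        base (inj₂ refl) = first-q
        next : ∀ {e} → First e r' → First (π e) r'
        next {e} g with e ≟ᴰ r' | e ≟ᴰ r
        ... | yes refl | _ = f
        ... | no _ | yes refl = ⊥-elim (ne (First-det fr g))
        ... | no a | no b = let (u , v) = off' b a in First-step u v g
        go : ∀ k → First (iter π k r') r'
        go zero = base tgt
        go (suc k) = next (go k)

      πp-lab : label (π p) ≡ label p
      πp-lab = label-step Pp

      πq-lab : label (π q) ≡ label p
      πq-lab = trans (label-step Pq) (sym (⇝⇒≡ Pp p⇝q))

      first-πq : First (π q) p
      first-πq with first πq-lab (closed q Pq)
      ... | inj₁ f = f
      ... | inj₂ f = ⊥-elim (trapped p≢q (inj₂ refl) (⇝-sym Pp p⇝q) (λ a b → a , b) first-p f)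

      first-πp : First (π p) q
      first-πp with first πp-lab (closed p Pp)
      ... | inj₂ f = f
      ... | inj₁ f = ⊥-elim (trapped (p≢q ∘ sym) (inj₁ refl) p⇝q (λ a b → b , a) first-q f)

      -- `First` is defined by `π`, yet `π'` preserves it: `p` now moves to `π q`, and from there
      -- `p` is met first. So the old orbit falls apart into the elements that meet `p` first and
      -- those that meet `q` first.
      First-π' : ∀ {d t} → First d t → First (π' d) t
      First-π' {d} f with d ≟ᴰ p | d ≟ᴰ q
      First-π' {d} f | yes refl | _ with First-det f first-p
      ... | refl = subst (λ z → First z p) (sym (at-p)) first-πq
      First-π' {d} f | no _ | yes refl with First-det f first-q
      ... | refl = subst (λ z → First z q) (sym (at-q)) first-πp
      First-π' {d} f | no a | no b = subst (λ z → First z _) (sym (off a b)) (First-step a b f)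

      First⇒⇝ : ∀ {d t} → First d t → d ⟨ π' ⟩⇝ t
      First⇒⇝ first-p = ⇝-refl
      First⇒⇝ first-q = ⇝-refl
      First⇒⇝ (walk a b f) = ⇝-trans (1 , off a b) (First⇒⇝ f)

      First-iter : ∀ k {d t} → First d t → First (iter π' k d) t
      First-iter zero f = f
      First-iter (suc k) f = First-π' (First-iter k f)

      reach : ∀ k → p ⟨ π' ⟩⇝ iter π k p ⊎ q ⟨ π' ⟩⇝ iter π k p
      reach zero = inj₁ ⇝-refl
      reach (suc k) with iter π k p ≟ᴰ p | iter π k p ≟ᴰ q | reach k
      ... | yes e | _ | _ = inj₂ (1 , trans (at-q) (cong π (sym e)))
      ... | no _ | yes e | _ = inj₁ (1 , trans (at-p) (cong π (sym e)))
      ... | no a | no b | inj₁ r = inj₁ (⇝-trans r (1 , off a b))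
      ... | no a | no b | inj₂ r = inj₂ (⇝-trans r (1 , off a b))

      from-first : ∀ {d t} → P d → label d ≡ label p → First d t → t ⟨ π' ⟩⇝ d
      from-first x e f with ≡⇒⇝ Pp x (sym e)
      ... | k , refl with reach k
      ... | inj₁ r@(j , eq) with First-det f (subst (λ z → First z p) eq (First-iter j first-p))
      ... | refl = r
      from-first x e f | k , refl | inj₂ r@(j , eq)
        with First-det f (subst (λ z → First z q) eq (First-iter j first-q))
      ... | refl = r

      -- The graph of `lab'` on `P`, kept as a relation so that invariance can be proved without
      -- unfolding decisions. Old labels are shifted by `suc`; the part around `q` receives the new
      -- label `zero`.
      data Piece (d : D) : Fin (suc F) → Set where
        elsewhere : label d ≢ label p → Piece d (suc (label d))
        p-piece   : label d ≡ label p → First d p → Piece d (suc (label d))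
        q-piece   : label d ≡ label p → First d q → Piece d zero

      lab' : D → Fin (suc F)
      lab' d with P? d
      -- An arbitrary value: the specification of a labelling speaks of `P` only.
      ... | no _ = zero
      ... | yes x with label d ≟ label p
      ... | no _ = suc (label d)
      ... | yes e with first e x
      ... | inj₁ _ = suc (label d)
      ... | inj₂ _ = zero

      piece : ∀ {d} → P d → Piece d (lab' d)
      piece {d} x with P? d
      ... | no ¬x = ⊥-elim (¬x x)
      ... | yes x' with label d ≟ label p
      ... | no ne = elsewhere ne
      ... | yes e with first e x'
      ... | inj₁ f = p-piece e f
      ... | inj₂ f = q-piece e f

      piece-det : ∀ {d i j} → Piece d i → Piece d j → i ≡ j
      piece-det (elsewhere _) (elsewhere _) = refl
      piece-det (elsewhere a) (p-piece e _) = refl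
      piece-det (elsewhere a) (q-piece e _) = ⊥-elim (a e)
      piece-det (p-piece _ _) (elsewhere _) = refl
      piece-det (p-piece _ _) (p-piece _ _) = refl
      piece-det (p-piece _ f) (q-piece _ g) = ⊥-elim (p≢q (First-det f g))
      piece-det (q-piece e _) (elsewhere a) = ⊥-elim (a e)
      piece-det (q-piece _ g) (p-piece _ f) = ⊥-elim (p≢q (First-det f g))
      piece-det (q-piece _ _) (q-piece _ _) = refl

      label-π' : ∀ {d} → P d → label (π' d) ≡ label d
      label-π' {d} x with d ≟ᴰ p | d ≟ᴰ q
      ... | yes refl | _ = trans (cong label at-p) πq-lab
      ... | no _ | yes refl = trans (cong label at-q) (trans πp-lab (⇝⇒≡ Pp p⇝q))
      ... | no a | no b = trans (cong label (off a b)) (label-step x)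

      piece-step : ∀ {d i} → P d → Piece d i → Piece (π' d) i
      piece-step {d} x (elsewhere a) = subst (λ l → Piece (π' d) (suc l)) (label-π' x)
        (elsewhere (a ∘ trans (sym (label-π' x))))
      piece-step {d} x (p-piece e f) = subst (λ l → Piece (π' d) (suc l)) (label-π' x)
        (p-piece (trans (label-π' x) e) (First-π' f))
      piece-step x (q-piece e f) = q-piece (trans (label-π' x) e) (First-π' f)

      lab'-step : ∀ d → P d → lab' (π' d) ≡ lab' d
      lab'-step d x = piece-det (piece (closed' d x)) (piece-step x (piece x))

      ⇝-lab : ∀ {d e} → P d → d ⟨ π' ⟩⇝ e → lab' d ≡ lab' e
      ⇝-lab = ⇝-invariant P lab' closed' lab'-step

      far : ∀ {d e} → P d → P e → label d ≢ label p → label d ≡ label e → d ⟨ π' ⟩⇝ e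
      far x y a e with ≡⇒⇝ x y e
      ... | k , eq = k , trans (avoid x a (a ∘ λ z → trans z (sym (⇝⇒≡ Pp p⇝q))) k) eq

      join-pieces : ∀ {d e i j} → P d → P e → Piece d i → Piece e j → i ≡ j → d ⟨ π' ⟩⇝ e
      join-pieces x y (elsewhere a) (elsewhere _) e = far x y a (suc-injective e)
      join-pieces x y (elsewhere a) (p-piece r _) e = ⊥-elim (a (trans (suc-injective e) r))
      join-pieces x y (p-piece r _) (elsewhere a) e = ⊥-elim (a (trans (sym (suc-injective e)) r))
      join-pieces x y (p-piece r f) (p-piece s g) _ = ⇝-trans (First⇒⇝ f) (from-first y s g)
      join-pieces x y (q-piece r f) (q-piece s g) _ = ⇝-trans (First⇒⇝ f) (from-first y s g)

      surj : ∀ i → ∃ λ d → P d × lab' d ≡ i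
      surj zero = q , Pq , piece-det (piece Pq) (q-piece (sym (⇝⇒≡ Pp p⇝q)) first-q)
      surj (suc i) with label-surjective i
      ... | d , x , refl with label d ≟ label p
      ... | no a = d , x , piece-det (piece x) (elsewhere a)
      -- `d` may have fallen into the part around `q`; `p` certainly keeps the old label.
      ... | yes e = p , Pp , trans (piece-det (piece Pp) (p-piece refl first-p)) (cong suc (sym e))

    abstract
      split : HasOrbits P π' (suc F)
      split = lab' , surj , λ d d' x y → join-pieces x y (piece x) (piece y) , ⇝-lab x

-- Euler's inequality for rotation systems

_≟ᴰ_ : ∀ {n} → DecidableEquality (Dart n)
_≟ᴰ_ = ×-≡-dec _≟_ _≟_

isDart? : ∀ {n} (G : Graph n) (d : Dart n) → Dec (IsDart G d)
isDart? G (u , v) = T? (adj G u v)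

_⊆ᴳ_ : ∀ {n} → Graph n → Graph n → Set
K ⊆ᴳ G = ∀ {u v} → Adj K u v → Adj G u v

module Rotation {n} {G : Graph n} (R : RotationSystem G) where

  -- The face permutation of the spanning subgraph K, on all darts of G: the
  -- darts outside K are kept as dangling half-edges.
  stepIn : Graph n → Dart n → Dart n
  stepIn K (u , v) = if adj K u v then (v , rot R v u) else (u , rot R u v)

  stepIn-∈ : ∀ K {u v} → Adj K u v → stepIn K (u , v) ≡ (v , rot R v u)
  stepIn-∈ K {u} {v} p with adj K u v
  ... | true = refl

  stepIn-∉ : ∀ K {u v} → ¬ Adj K u v → stepIn K (u , v) ≡ (u , rot R u v)
  stepIn-∉ K {u} {v} p with adj K u v
  ... | true = ⊥-elim (p _)
  ... | false = refl

  stepIn-closed : ∀ {K} → K ⊆ᴳ G → ∀ d → IsDart G d → IsDart G (stepIn K d)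
  stepIn-closed {K} sub (u , v) uv with adj K u v
  ... | true = rot-adj R v u (Adj-sym G uv)
  ... | false = rot-adj R u v uv

  swapped-edge : ∀ K {u v} → Adj K u v
    → Swapped (u , v) (v , u) (stepIn (delEdge K u v)) (stepIn K)
  swapped-edge K {u} {v} uv = record
    { at-p = trans (stepIn-∈ K uv) (sym (stepIn-∉ K' (delEdge-∌ K ∘ Adj-sym K')))
    ; at-q = trans (stepIn-∈ K (Adj-sym K uv)) (sym (stepIn-∉ K' (delEdge-∌ K)))
    ; off = off }
    where
    K' = delEdge K u v
    off : ∀ {d} → d ≢ (u , v) → d ≢ (v , u) → stepIn K d ≡ stepIn K' d
    off {i , j} a b with T? (adj K i j)
    ... | yes p = trans (stepIn-∈ K p) (sym (stepIn-∈ K'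
            (delEdge⁺ K p (λ { (refl , refl) → a refl }) (λ { (refl , refl) → b refl }))))
    ... | no ¬p = trans (stepIn-∉ K ¬p) (sym (stepIn-∉ K' (¬p ∘ delEdge-⊆ K)))

  swapped-edge⁻ : ∀ K {u v} → Adj K u v
    → Swapped (u , v) (v , u) (stepIn K) (stepIn (delEdge K u v))
  swapped-edge⁻ K uv = record { at-p = sym at-q ; at-q = sym at-p ; off = λ a b → sym (off a b) }
    where open Swapped (swapped-edge K uv)

  module _ (has-dart : ∀ v → ∃ λ u → Adj G v u) where

    private
      edge? : ∀ K → Dec (∃₂ λ (u v : Fin n) → Adj K u v)
      edge? K = any? λ u → any? λ v → T? (adj K u v)

      -- Edges are added one at a time.  An edge between different classes of ℓ
      -- joins two orbits; any other edge creates at most one new orbit.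
      euler-bound : ∀ s K → K ⊆ᴳ G → sumDeg K ≤ s
        → ∃₂ λ z c → ∃ λ (ℓ : Fin n → Fin c)
          → HasOrbits (IsDart G) (stepIn K) z
          × (∀ i → ∃ λ v → ℓ v ≡ i)
          × (∀ {u v} → Adj K u v → ℓ u ≡ ℓ v)
          × 2 * z + 2 * n ≤ sumDeg K + 4 * c
      euler-bound s K sub le with edge? K
      -- Without edges the permutation only rotates around each vertex. Each vertex has a dart, so
      -- orbits and classes both correspond to the vertices, and the bound reads 4n ≤ 0 + 4n.
      ... | no none = n , n , id , (proj₁ , (λ v → _ , proj₂ (has-dart v) , refl) , conn)
                    , (λ i → i , refl) , (λ p → ⊥-elim (none (_ , _ , p)))
                    , subst (_≤ sumDeg K + 4 * n) (double n) (ℕₚ.m≤n+m (4 * n) (sumDeg K))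
        where
        double : ∀ n → 4 * n ≡ 2 * n + 2 * n
        double = solve-∀
        stepK : ∀ {u v} → stepIn K (u , v) ≡ (u , rot R u v)
        stepK = stepIn-∉ K λ p → none (_ , _ , p)
        iter-rot : ∀ k {u v} → iter (stepIn K) k (u , v) ≡ (u , iter (rot R u) k v)
        iter-rot zero = refl
        iter-rot (suc k) {u} {v} = trans (cong (stepIn K) (iter-rot k)) stepK
        conn : ∀ d d' → IsDart G d → IsDart G d' → (proj₁ d ≡ proj₁ d' → d ⟨ stepIn K ⟩⇝ d')
             × (d ⟨ stepIn K ⟩⇝ d' → proj₁ d ≡ proj₁ d')
        conn (u , v) (u' , v') p q = to , λ { (k , refl) → sym (cong proj₁ (iter-rot k)) }
          where
          to : u ≡ u' → (u , v) ⟨ stepIn K ⟩⇝ (u' , v')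
          to refl with rot-cyc R u v v' p q
          ... | k , refl = k , iter-rot k
      euler-bound zero K sub le | yes (u , v , uv)
        with ≤-trans (sumDeg-delEdge K uv) le
      ... | ()
      euler-bound (suc s) K sub le | yes (u , v , uv)
        with euler-bound s (delEdge K u v) (sub ∘ delEdge-⊆ K)
               (ℕₚ.≤-pred (≤-trans (ℕₚ.m≤n+m _ 1) (≤-trans (sumDeg-delEdge K uv) le)))
      ... | z , c , ℓ , orb , surj , cl , bound = result (ℓ u ≟ ℓ v)
        where
        K' = delEdge K u v
        open Swap _≟ᴰ_ (stepIn-closed {K'} (sub ∘ delEdge-⊆ K)) orb (sub uv) (Adj-sym G (sub uv))
               (swapped-edge K uv)
        open Orbits (stepIn-closed {K'} (sub ∘ delEdge-⊆ K)) orb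
        fewer : 2 + sumDeg K' ≤ sumDeg K
        fewer = sumDeg-delEdge K uv
        p≢q : (u , v) ≢ (v , u)
        p≢q e = adj⇒≢ K uv (cong proj₁ e)
        cl⁺ : ∀ {c'} (f : Fin c → Fin c') → f (ℓ u) ≡ f (ℓ v) → ∀ {i j} → Adj K i j → f (ℓ i) ≡ f (ℓ j)
        cl⁺ f e {i} {j} p with (i , j) ≟ᴰ (u , v) | (i , j) ≟ᴰ (v , u)
        ... | yes refl | _ = e
        ... | no _ | yes refl = sym e
        ... | no a | no b = cong f (cl (delEdge⁺ K p (λ { (refl , refl) → a refl })
                                                    (λ { (refl , refl) → b refl })))
        -- A step across an edge of `K'` stays in the class by `cl`, and a dangling dart keeps its
        -- source. So each orbit lies in one class, and the two darts of an edge between classes lie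
        -- on different orbits.
        same-class : ∀ {d} → (u , v) ⟨ stepIn K' ⟩⇝ d → ℓ u ≡ ℓ (proj₁ d)
        same-class = ⇝-invariant (IsDart G) (ℓ ∘ proj₁) (stepIn-closed {K'} (sub ∘ delEdge-⊆ K)) inv (sub uv)
          where
          inv : ∀ d → IsDart G d → ℓ (proj₁ (stepIn K' d)) ≡ ℓ (proj₁ d)
          inv (i , j) _ with T? (adj K' i j)
          ... | yes p = trans (cong (ℓ ∘ proj₁) (stepIn-∈ K' p)) (sym (cl p))
          ... | no ¬p = cong (ℓ ∘ proj₁) (stepIn-∉ K' ¬p)
        Goal : Set
        Goal = ∃₂ λ z c → ∃ λ (ℓ : Fin n → Fin c)
          → HasOrbits (IsDart G) (stepIn K) z
          × (∀ i → ∃ λ v → ℓ v ≡ i)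
          × (∀ {u v} → Adj K u v → ℓ u ≡ ℓ v)
          × 2 * z + 2 * n ≤ sumDeg K + 4 * c
        open ℕₚ.≤-Reasoning
        reorder : ∀ z n → 2 * suc z + 2 * n ≡ 2 + (2 * z + 2 * n)
        reorder = solve-∀
        result : Dec (ℓ u ≡ ℓ v) → Goal
        result (yes e) with ⇝? (sub uv) (Adj-sym G (sub uv))
        ... | yes r = suc z , c , ℓ , Split.split (isDart? G) r p≢q , surj , cl⁺ id e , (begin
              2 * suc z + 2 * n ≡⟨ reorder z n ⟩
              2 + (2 * z + 2 * n) ≤⟨ ℕₚ.+-monoʳ-≤ 2 bound ⟩
              (2 + sumDeg K') + 4 * c ≤⟨ ℕₚ.+-monoˡ-≤ (4 * c) fewer ⟩
              sumDeg K + 4 * c ∎)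
        -- An edge within a class that joins orbits: here the embedding gains genus, and the bound
        -- has 4 to spare.
        ... | no ¬r with Join.joined ¬r
        ... | z' , refl , orb' = z' , c , ℓ , orb' , surj , cl⁺ id e , (begin
              2 * z' + 2 * n ≤⟨ ℕₚ.m≤n+m _ 4 ⟩
              4 + (2 * z' + 2 * n) ≡⟨ cong (2 +_) (sym (reorder z' n)) ⟩
              2 + (2 * suc z' + 2 * n) ≤⟨ ℕₚ.+-monoʳ-≤ 2 bound ⟩
              (2 + sumDeg K') + 4 * c ≤⟨ ℕₚ.+-monoˡ-≤ (4 * c) fewer ⟩
              sumDeg K + 4 * c ∎)
        -- `identify` needs the number of classes as a successor. The equation carries `same-class`,
        -- which speaks of `ℓ`, over to the generalised `ℓ₁`.
        result (no ne) = merge c ℓ ne surj refl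
          where
          merge : ∀ c₁ (ℓ₁ : Fin n → Fin c₁) (ne₁ : ℓ₁ u ≢ ℓ₁ v) → (∀ i → ∃ λ v → ℓ₁ v ≡ i)
            → (eq : (c₁ , ℓ₁) ≡ (c , ℓ)) → Goal
          merge zero ℓ₁ ne₁ surj₁ _ with ℓ₁ u
          ... | ()
          merge (suc c₁) ℓ₁ ne₁ surj₁ refl with Join.joined (ne₁ ∘ same-class)
          ... | z' , refl , orb' = z' , c₁ , f ∘ ℓ₁ , orb' , surj' , cl⁺ f (sym (identify-j _ _ ne₁)) ,
              ℕₚ.+-cancelˡ-≤ 4 _ _ (begin
              4 + (2 * z' + 2 * n) ≡⟨ cong (2 +_) (sym (reorder z' n)) ⟩
              2 + (2 * suc z' + 2 * n) ≤⟨ ℕₚ.+-monoʳ-≤ 2 bound ⟩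
              (2 + sumDeg K') + 4 * suc c₁ ≤⟨ ℕₚ.+-monoˡ-≤ (4 * suc c₁) fewer ⟩
              sumDeg K + 4 * suc c₁ ≡⟨ shuffle (sumDeg K) c₁ ⟩
              4 + (sumDeg K + 4 * c₁) ∎)
            where
            f : Fin (suc c₁) → Fin c₁
            f = identify (ℓ₁ u) (ℓ₁ v) ne₁
            shuffle : ∀ s c → s + 4 * suc c ≡ 4 + (s + 4 * c)
            shuffle = solve-∀
            surj' : ∀ i → ∃ λ w → f (ℓ₁ w) ≡ i
            surj' i with identify-surjective (ℓ₁ u) (ℓ₁ v) ne₁ i
            ... | j , refl with surj₁ j
            ... | w , refl = w , refl

    -- An onto labelling that is constant along the edges of a connected graph has at most one
    -- value, so the 4c of the bound becomes 4.
    euler : ∀ {K} → K ⊆ᴳ G → (∀ u v → Star (Adj K) u v) → ∀ {z}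
      → HasOrbits (IsDart G) (stepIn K) z → 2 * z + 2 * n ≤ sumDeg K + 4
    euler {K} sub conn orb with euler-bound (sumDeg K) K sub ≤-refl
    ... | z' , c , ℓ , orb' , surj , cl , bound
      rewrite orbits-unique (stepIn-closed {K} sub) orb orb' =
        ≤-trans bound (ℕₚ.+-monoʳ-≤ (sumDeg K) (ℕₚ.*-monoʳ-≤ 4 (c≤1 c ℓ surj cl)))
      where
      along : ∀ {c} (ℓ : Fin n → Fin c) → (∀ {u v} → Adj K u v → ℓ u ≡ ℓ v)
            → ∀ {u v} → Star (Adj K) u v → ℓ u ≡ ℓ v
      along ℓ cl ε = refl
      along ℓ cl (p ◅ ps) = trans (cl p) (along ℓ cl ps)
      c≤1 : ∀ c (ℓ : Fin n → Fin c) → (∀ i → ∃ λ v → ℓ v ≡ i)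
          → (∀ {u v} → Adj K u v → ℓ u ≡ ℓ v) → c ≤ 1
      c≤1 zero ℓ surj cl = z≤n
      c≤1 (suc zero) ℓ surj cl = ≤-refl
      c≤1 (suc (suc c)) ℓ surj cl with surj zero | surj (suc zero)
      ... | u , eu | v , ev with trans (sym eu) (trans (along ℓ cl (conn u v)) ev)
      ... | ()

-- Deleting edges from plane graphs

star⇒connected : ∀ {n} (G : Graph n) {u v} → Star (Adj G) u v → Connected G u v
star⇒connected G ε = _ ∷ [] , [-] , refl , refl
star⇒connected G {u} (p ◅ ps) with star⇒connected G ps
... | w ∷ l , lk , refl , e = u ∷ w ∷ l , p ∷ lk , refl , e

iter-cong : ∀ {D : Set} {P : D → Set} {π π' : D → D} → (∀ d → P d → P (π d))
  → (∀ d → P d → π' d ≡ π d) → ∀ k {d} → P d → iter π' k d ≡ iter π k d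
iter-cong cl eq zero x = refl
iter-cong {P = P} {π} {π'} cl eq (suc k) x = trans (cong π' (iter-cong cl eq k x))
  (eq _ (proj₁ (iter-invariant P (λ _ → 0) cl (λ _ _ → refl) k x)))

-- Agreement is asked on `P` only, because `faceStep R` and `stepIn G` differ off the darts of `G`.
orbits-cong : ∀ {D : Set} {P : D → Set} {π π' : D → D} {F} → (∀ d → P d → P (π d))
  → (∀ d → P d → π' d ≡ π d) → HasOrbits P π F → HasOrbits P π' F
orbits-cong cl eq (lab , surj , spec) = lab , surj , λ d d' x y →
    (λ e → let (k , r) = proj₁ (spec d d' x y) e in k , trans (iter-cong cl eq k x) r)
  , λ (k , r) → proj₂ (spec d d' x y) (k , trans (sym (iter-cong cl eq k x)) r)

module Planarity {n} {G : Graph n} (R : RotationSystem G) (cubic : Cubic G) where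

  open Rotation R public

  has-dart : ∀ v → ∃ λ u → Adj G v u
  has-dart v = let (u , p , _) = cubic-third G (cubic v) v v in u , p

  faceStep-stepIn : ∀ d → IsDart G d → stepIn G d ≡ faceStep R d
  faceStep-stepIn (u , v) p = stepIn-∈ G p

  faceStep-closed : ∀ d → IsDart G d → IsDart G (faceStep R d)
  faceStep-closed (u , v) p = rot-adj R v u (Adj-sym G p)

  -- The half of Euler's formula opposite to `euler`, E + 2 ≤ V + F, doubled. A deletion that joins
  -- two faces preserves it.
  Tight : Graph n → ℕ → Set
  Tight K z = HasOrbits (IsDart G) (stepIn K) z × sumDeg K + 4 ≤ 2 * z + 2 * n

  abstract
    tight : Fin n → (∀ u v → Star (Adj G) u v) → ∀ {F C} → HasFaces R F → HasComponents G C
      → 2 * n + 2 * F + 2 * numIsolated G ≡ sumDeg G + 4 * C → Tight G F × 2 * n + 2 * F ≡ sumDeg G + 4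
    tight v₀ conn {F} {C} faces (lab , surj , spec) eq =
        (orbits-cong faceStep-closed faceStep-stepIn faces , ℕₚ.≤-reflexive (trans (sym eq') (ℕₚ.+-comm (2 * n) _)))
      , eq'
      where
      one : ∀ C (lab : Fin n → Fin C) → (∀ i → ∃ λ v → lab v ≡ i) → (∀ u v → lab u ≡ lab v) → C ≡ 1
      one zero lab surj all with lab v₀
      ... | ()
      one (suc zero) lab surj all = refl
      one (suc (suc C)) lab surj all with surj zero | surj (suc zero)
      ... | u , eu | v , ev with trans (sym eu) (trans (all u v) ev)
      ... | ()
      C≡1 : C ≡ 1
      C≡1 = one C lab surj λ u v → proj₂ (spec u v) (star⇒connected G (conn u v))
      eq' : 2 * n + 2 * F ≡ sumDeg G + 4
      eq' = begin
        2 * n + 2 * F ≡⟨ sym (ℕₚ.+-identityʳ _) ⟩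
        2 * n + 2 * F + 2 * 0 ≡⟨ cong (λ i → 2 * n + 2 * F + 2 * i) (sym (numIsolated-cubic G cubic)) ⟩
        2 * n + 2 * F + 2 * numIsolated G ≡⟨ eq ⟩
        sumDeg G + 4 * C ≡⟨ cong (λ i → sumDeg G + 4 * i) C≡1 ⟩
        sumDeg G + 4 ∎
        where open ≡-Reasoning

  module Delete (K : Graph n) (sub : K ⊆ᴳ G) {z} (tightK : Tight K z) {u v} (uv : Adj K u v)
    (conn : ∀ i j → Star (Adj (delEdge K u v)) i j) where

    K' : Graph n
    K' = delEdge K u v

    sub' : K' ⊆ᴳ G
    sub' = sub ∘ delEdge-⊆ K

    uv≢vu : (u , v) ≢ (v , u)
    uv≢vu e = adj⇒≢ K uv (cong proj₁ e)

    open Swap _≟ᴰ_ (stepIn-closed {K} sub) (proj₁ tightK) (sub uv) (Adj-sym G (sub uv))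
               (swapped-edge⁻ K uv) public

    -- Otherwise deleting uv would split a face, beyond the Euler bound.
    two-sides : ¬ (u , v) ⟨ stepIn K ⟩⇝ (v , u)
    two-sides r = ℕₚ.1+n≰n {3 + (sumDeg K' + 4)} (begin
      4 + (sumDeg K' + 4) ≡⟨⟩
      2 + (2 + sumDeg K' + 4) ≤⟨ ℕₚ.+-monoʳ-≤ 2 (ℕₚ.+-monoˡ-≤ 4 (sumDeg-delEdge K uv)) ⟩
      2 + (sumDeg K + 4) ≤⟨ ℕₚ.+-monoʳ-≤ 2 (proj₂ tightK) ⟩
      2 + (2 * z + 2 * n) ≡⟨ reorder z n ⟩
      2 * suc z + 2 * n ≤⟨ euler has-dart {K'} sub' conn (Split.split (isDart? G) r uv≢vu) ⟩
      sumDeg K' + 4 ≤⟨ ℕₚ.m≤n+m _ 3 ⟩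
      3 + (sumDeg K' + 4) ∎)
      where
      open ℕₚ.≤-Reasoning
      reorder : ∀ z n → 2 + (2 * z + 2 * n) ≡ 2 * suc z + 2 * n
      reorder = solve-∀

    open Join two-sides public

    abstract
      -- One edge and one face disappear together, so V - E + F does not drop.
      tight' : ∃ λ z' → z ≡ suc z' × Tight K' z'
      tight' with joined
      ... | z' , refl , orb' = z' , refl , orb' , ℕₚ.+-cancelˡ-≤ 2 _ _ (begin
        2 + sumDeg K' + 4 ≤⟨ ℕₚ.+-monoˡ-≤ 4 (sumDeg-delEdge K uv) ⟩
        sumDeg K + 4 ≤⟨ proj₂ tightK ⟩
        2 * suc z' + 2 * n ≡⟨ reorder z' n ⟩
        2 + (2 * z' + 2 * n) ∎)
        where
        open ℕₚ.≤-Reasoning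
        reorder : ∀ z n → 2 * suc z + 2 * n ≡ 2 + (2 * z + 2 * n)
        reorder = solve-∀

-- The dot product and its darts

-- (true , true), (true , false), (false , true), (false , false) stand for
-- the cross edges aa', bb', cc', dd'.
Corner : Set
Corner = Bool × Bool

side : Corner → Bool
side = proj₁

mate : Corner → Corner
mate (s , i) = s , not i

_≟ᶜ_ : DecidableEquality Corner
_≟ᶜ_ = ×-≡-dec _≟ᵇ_ _≟ᵇ_

mate-involutive : ∀ t → mate (mate t) ≡ t
mate-involutive (s , i) = cong (s ,_) (not-involutive i)

mate≢ : ∀ t → mate t ≢ t
mate≢ (_ , true) ()
mate≢ (_ , false) ()

same-side : ∀ {s t} → side s ≡ side t → s ≡ t ⊎ s ≡ mate t
same-side {_ , true} {_ , true} refl = inj₁ refl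
same-side {_ , true} {_ , false} refl = inj₂ refl
same-side {_ , false} {_ , true} refl = inj₂ refl
same-side {_ , false} {_ , false} refl = inj₁ refl

anyCorner? : ∀ {P : Corner → Set} → (∀ t → Dec (P t)) → Dec (∃ P)
anyCorner? P? with P? (true , true) | P? (true , false) | P? (false , true) | P? (false , false)
... | yes p | _ | _ | _ = yes (_ , p)
... | no _ | yes p | _ | _ = yes (_ , p)
... | no _ | no _ | yes p | _ = yes (_ , p)
... | no _ | no _ | no _ | yes p = yes (_ , p)
... | no p | no q | no r | no s = no λ
  { ((true , true) , x) → p x ; ((true , false) , x) → q x
  ; ((false , true) , x) → r x ; ((false , false) , x) → s x }

corners : List Corner
corners = (false , true) ∷ (false , false) ∷ (true , false) ∷ (true , true) ∷ []

corners-unique : Unique corners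
corners-unique = ((λ ()) ∷ (λ ()) ∷ (λ ()) ∷ []) ∷ ((λ ()) ∷ (λ ()) ∷ []) ∷ ((λ ()) ∷ []) ∷ [] ∷ []

∈-corners : ∀ t → t ∈ corners
∈-corners (false , true) = here refl
∈-corners (false , false) = there (here refl)
∈-corners (true , false) = there (there (here refl))
∈-corners (true , true) = there (there (there (here refl)))

-- Indexing by corners makes `a`, `b`, `c`, `d` and the two hubs `x`, `y` interchangeable, so one
-- argument serves all of them and `relabel` can rename them. Values of `kv` on different sides may
-- coincide: `x` and `y` may have a common neighbour.
record Setting {n m : ℕ} (H : Graph n) (H' : Graph (suc (suc m))) : Set where
  field
    hv      : Corner → Fin n
    hv-inj  : ∀ {s t} → hv s ≡ hv t → s ≡ t
    hv-adj  : ∀ t → Adj H (hv t) (hv (mate t))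
    hub     : Bool → Fin (suc (suc m))
    hub-adj : ∀ s → Adj H' (hub s) (hub (not s))
    kv      : Corner → Fin (suc (suc m))
    kv-adj  : ∀ t → Adj H' (hub (side t)) (kv t)
    kv≢hub  : ∀ t → kv t ≢ hub (not (side t))
    kv-mate : ∀ t → kv (mate t) ≢ kv t
    hub-nbr : ∀ s {v} → Adj H' (hub s) v → v ≡ hub (not s) ⊎ ∃ λ i → v ≡ kv (s , i)
    e       : Fin m → Fin (suc (suc m))
    e-inj   : ∀ {k k'} → e k ≡ e k' → k ≡ k'
    e≢hub   : ∀ k s → e k ≢ hub s
    e-onto  : ∀ {v} → (∀ s → v ≢ hub s) → ∃ λ k → e k ≡ v

module Dot {n m : ℕ} {H : Graph n} {H' : Graph (suc (suc m))} (S : Setting H H') where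

  open Setting S public

  V : Set
  V = Fin n ⊎ Fin m

  Cut : Fin n → Fin n → Set
  Cut h h' = ∃ λ t → h ≡ hv t × h' ≡ hv (mate t)

  cut? : ∀ h h' → Dec (Cut h h')
  cut? h h' = anyCorner? λ t → (h ≟ hv t) ×-dec (h' ≟ hv (mate t))

  cut-sym : ∀ {h h'} → Cut h h' → Cut h' h
  cut-sym (t , refl , refl) = mate t , refl , cong hv (sym (mate-involutive t))

  AdjJ : Fin n → Fin n → Set
  AdjJ h h' = Adj H h h' × ¬ Cut h h'

  AdjJ-sym : ∀ {h h'} → AdjJ h h' → AdjJ h' h
  AdjJ-sym (p , q) = Adj-sym H p , q ∘ cut-sym

  -- The dot product on a disjoint union, free of the arithmetic of `splitAt`; `IsDot` ties it to a
  -- Boolean graph.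
  data DotAdj : V → V → Set where
    jj : ∀ {h h'} → AdjJ h h' → DotAdj (inj₁ h) (inj₁ h')
    jk : ∀ t {h k} → h ≡ hv t → e k ≡ kv t → DotAdj (inj₁ h) (inj₂ k)
    kj : ∀ t {h k} → h ≡ hv t → e k ≡ kv t → DotAdj (inj₂ k) (inj₁ h)
    kk : ∀ {k k'} → Adj H' (e k) (e k') → DotAdj (inj₂ k) (inj₂ k')

  DotAdj-sym : ∀ {u v} → DotAdj u v → DotAdj v u
  DotAdj-sym (jj p) = jj (AdjJ-sym p)
  DotAdj-sym (jk t p q) = kj t p q
  DotAdj-sym (kj t p q) = jk t p q
  DotAdj-sym (kk p) = kk (Adj-sym H' p)

  hub-inj : ∀ {s t} → hub s ≡ hub t → s ≡ t
  hub-inj {true} {true} _ = refl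
  hub-inj {true} {false} p = ⊥-elim (adj⇒≢ H' (hub-adj true) p)
  hub-inj {false} {true} p = ⊥-elim (adj⇒≢ H' (hub-adj false) p)
  hub-inj {false} {false} _ = refl

  kv≢hubs : ∀ t s → kv t ≢ hub s
  kv≢hubs t s p with side t ≟ᵇ s
  ... | yes refl = adj⇒≢ H' (kv-adj t) (sym p)
  ... | no ne = kv≢hub t (trans p (cong hub (other ne)))
    where
    other : ∀ {a b} → a ≢ b → b ≡ not a
    other {true} {true} f = ⊥-elim (f refl)
    other {true} {false} f = refl
    other {false} {true} f = refl
    other {false} {false} f = ⊥-elim (f refl)

  kv-inj : ∀ {s t} → side s ≡ side t → kv s ≡ kv t → s ≡ t
  kv-inj {s} {t} p q with same-side {s} {t} p
  ... | inj₁ r = r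
  ... | inj₂ refl = ⊥-elim (kv-mate t q)

  hub? : ∀ v → (∃ λ s → v ≡ hub s) ⊎ (∀ s → v ≢ hub s)
  hub? v with v ≟ hub true | v ≟ hub false
  ... | yes p | _ = inj₁ (true , p)
  ... | no _ | yes p = inj₁ (false , p)
  ... | no p | no q = inj₂ λ { true → p ; false → q }

  H'-xy : Graph (suc (suc m))
  H'-xy = delEdge H' (hub true) (hub false)

  H'-xy-adj : ∀ {v w} → Adj H' v w → (∀ s → ¬ (v ≡ hub s × w ≡ hub (not s))) → Adj H'-xy v w
  H'-xy-adj p f = delEdge⁺ H' p (f true) (f false)

  H'-xy-hub : ∀ s → ¬ Adj H'-xy (hub s) (hub (not s))
  H'-xy-hub true = delEdge-∌ H'
  H'-xy-hub false = delEdge-∌ H' ∘ Adj-sym H'-xy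

  H'-xy-kv : ∀ t → Adj H'-xy (kv t) (hub (side t))
  H'-xy-kv t = H'-xy-adj (Adj-sym H' (kv-adj t)) λ s (p , _) → kv≢hubs t s p

  kv₀ : ∀ t → ∃ λ k → e k ≡ kv t
  kv₀ t = e-onto (kv≢hubs t)

  -- Darts of the dot product against darts of H and of H'; the latter are
  -- those which do not start at x or y.
  data Θ : V × V → Dart n ⊎ Dart (suc (suc m)) → Set where
    jj : ∀ {h h'} → ¬ Cut h h' → Θ (inj₁ h , inj₁ h') (inj₁ (h , h'))
    jk : ∀ t {h h' k} → h ≡ hv t → h' ≡ hv (mate t) → e k ≡ kv t
       → Θ (inj₁ h , inj₂ k) (inj₁ (h , h'))
    kj : ∀ t {h k v w} → h ≡ hv t → e k ≡ kv t → v ≡ e k → w ≡ hub (side t)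
       → Θ (inj₂ k , inj₁ h) (inj₂ (v , w))
    kk : ∀ {k k' v w} → v ≡ e k → w ≡ e k' → Θ (inj₂ k , inj₂ k') (inj₂ (v , w))

  IsDart⊎ : Dart n ⊎ Dart (suc (suc m)) → Set
  IsDart⊎ (inj₁ d) = IsDart H d
  IsDart⊎ (inj₂ d) = IsDart H' d

  FromHub : Dart n ⊎ Dart (suc (suc m)) → Set
  FromHub (inj₁ d) = ⊥
  FromHub (inj₂ (v , w)) = ∃ λ s → v ≡ hub s

  fromHub? : ∀ d → Dec (FromHub d)
  fromHub? (inj₁ d) = no λ ()
  fromHub? (inj₂ (v , w)) with hub? v
  ... | inj₁ p = yes p
  ... | inj₂ q = no λ (s , r) → q s r

  Θ-functional : ∀ {δ d d'} → Θ δ d → Θ δ d' → d ≡ d'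
  Θ-functional (jj _) (jj _) = refl
  Θ-functional (jk s refl refl _) (jk t p refl _) with hv-inj p
  ... | refl = refl
  Θ-functional (kj s refl _ refl refl) (kj t p _ refl refl) with hv-inj p
  ... | refl = refl
  Θ-functional (kk refl refl) (kk refl refl) = refl

  -- A dart on `ab` or `cd` names its corner because `hv` is injective. A dart of `H'` into a hub
  -- names the side, and then `kv-inj` the corner.
  Θ-injective : ∀ {δ δ' d} → Θ δ d → Θ δ' d → δ ≡ δ'
  Θ-injective (jj _) (jj _) = refl
  Θ-injective (jj c) (jk t p q _) = ⊥-elim (c (t , p , q))
  Θ-injective (jk t p q _) (jj c) = ⊥-elim (c (t , p , q))
  Θ-injective (jk s refl _ x) (jk t p _ y) with hv-inj p
  ... | refl = cong (λ k → _ , inj₂ k) (e-inj (trans x (sym y)))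
  Θ-injective (kj s refl x refl refl) (kj t refl y p q) with e-inj p
  ... | refl with kv-inj {s} {t} (hub-inj q) (trans (sym x) y)
  ... | refl = refl
  Θ-injective (kj s _ _ _ p) (kk {k' = k'} _ q) = ⊥-elim (e≢hub k' (side s) (trans (sym q) p))
  Θ-injective (kk {k' = k'} _ q) (kj s _ _ _ p) = ⊥-elim (e≢hub k' (side s) (trans (sym q) p))
  Θ-injective (kk refl refl) (kk p q) with e-inj p | e-inj q
  ... | refl | refl = refl

  Θ-from : ∀ {u v} → DotAdj u v → ∃ λ d → IsDart⊎ d × Θ (u , v) d
  Θ-from (jj (p , q)) = _ , p , jj q
  Θ-from (jk t refl p) = inj₁ (hv t , hv (mate t)) , hv-adj t , jk t refl refl p
  Θ-from (kj t refl p) = _ , subst (λ v → Adj H' v (hub (side t))) (sym p) (Adj-sym H' (kv-adj t))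
                       , kj t refl p refl refl
  Θ-from (kk p) = _ , p , kk refl refl

  Θ-to₁ : ∀ {h h'} → Adj H h h' → ∃ λ v → DotAdj (inj₁ h) v × Θ (inj₁ h , v) (inj₁ (h , h'))
  Θ-to₁ {h} {h'} p with cut? h h'
  ... | no c = inj₁ h' , jj (p , c) , jj c
  ... | yes (t , refl , refl) with kv₀ t
  ... | k , q = inj₂ k , jk t refl q , jk t refl refl q

  Θ-to₂ : ∀ {k w} → Adj H' (e k) w → ∃ λ v → DotAdj (inj₂ k) v × Θ (inj₂ k , v) (inj₂ (e k , w))
  Θ-to₂ {k} {w} p with hub? w
  ... | inj₂ f with e-onto f
  ... | k' , refl = inj₂ k' , kk p , kk refl refl
  Θ-to₂ {k} p | inj₁ (s , refl) with hub-nbr s (Adj-sym H' p)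
  ... | inj₁ q = ⊥-elim (e≢hub k (not s) q)
  ... | inj₂ (i , q) = inj₁ (hv (s , i)) , kj (s , i) refl q , kj (s , i) refl q refl refl

  Θ-¬hub : ∀ {δ d} → Θ δ d → ¬ FromHub d
  Θ-¬hub (kj t {k = k} _ _ refl _) (s , p) = e≢hub k s p
  Θ-¬hub (kk {k = k} refl _) (s , p) = e≢hub k s p

  record IsDot (G : Graph (n + m)) : Set where
    field
      to   : ∀ {u v} → Adj G (join n m u) (join n m v) → DotAdj u v
      from : ∀ {u v} → DotAdj u v → Adj G (join n m u) (join n m v)

  module Cubicity (cubicH : Cubic H) (cubicH' : Cubic H') {G : Graph (n + m)} (isDot : IsDot G) where

    open IsDot isDot

    -- `Θ` matches the darts at a vertex of the dot product with the darts at the same vertex of `H`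
    -- or `H'`; counting along it in both directions gives equal degrees.
    deg-join : ∀ u → deg G (join n m u) ≡ 3
    deg-join (inj₁ h) = trans (≤-antisym
      (deg-≤ G H (λ j h' → Θ (inj₁ h , splitAt n j) (inj₁ (h , h')))
        (λ {x} {x'} r s → splitAt-injective n (cong proj₂ (Θ-injective r s)))
        λ {j} p → down (subst (Adj G _) (sym (join-splitAt n m j)) p))
      (deg-≤ H G (λ h' j → Θ (inj₁ h , splitAt n j) (inj₁ (h , h')))
        (λ r s → target (Θ-functional r s))
        λ p → up (Θ-to₁ p))) (cubicH h)
      where
      target : ∀ {h h' h'' : Fin n} → inj₁ {B = Dart (suc (suc m))} (h , h') ≡ inj₁ (h , h'') → h' ≡ h''
      target refl = refl
      down : ∀ {v} → Adj G (join n m (inj₁ h)) (join n m v)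
           → ∃ λ h' → Adj H h h' × Θ (inj₁ h , v) (inj₁ (h , h'))
      down {v} p with Θ-from (to {inj₁ h} {v} p)
      ... | inj₁ (_ , h') , q , r@(jj _) = h' , q , r
      ... | inj₁ (_ , h') , q , r@(jk _ _ _ _) = h' , q , r
      up : ∀ {h'} → (∃ λ v → DotAdj (inj₁ h) v × Θ (inj₁ h , v) (inj₁ (h , h')))
         → ∃ λ j → Adj G (join n m (inj₁ h)) j × Θ (inj₁ h , splitAt n j) (inj₁ (h , h'))
      up (v , p , r) = join n m v , from p , subst (λ w → Θ (_ , w) _) (sym (splitAt-join n m v)) r
    deg-join (inj₂ k) = trans (≤-antisym
      (deg-≤ G H' (λ j w → Θ (inj₂ k , splitAt n j) (inj₂ (e k , w)))
        (λ {x} {x'} r s → splitAt-injective n (cong proj₂ (Θ-injective r s)))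
        λ {j} p → down (subst (Adj G _) (sym (join-splitAt n m j)) p))
      (deg-≤ H' G (λ w j → Θ (inj₂ k , splitAt n j) (inj₂ (e k , w)))
        (λ r s → target (Θ-functional r s))
        λ p → up (Θ-to₂ p))) (cubicH' (e k))
      where
      target : ∀ {h h' h'' : Fin (suc (suc m))} → inj₂ {A = Dart n} (h , h') ≡ inj₂ (h , h'') → h' ≡ h''
      target refl = refl
      down : ∀ {v} → Adj G (join n m (inj₂ k)) (join n m v)
           → ∃ λ w → Adj H' (e k) w × Θ (inj₂ k , v) (inj₂ (e k , w))
      down {v} p with Θ-from (to {inj₂ k} {v} p)
      ... | inj₂ (_ , w) , q , r@(kj _ _ _ refl _) = w , q , r
      ... | inj₂ (_ , w) , q , r@(kk refl _) = w , q , r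
      up : ∀ {w} → (∃ λ v → DotAdj (inj₂ k) v × Θ (inj₂ k , v) (inj₂ (e k , w)))
         → ∃ λ j → Adj G (join n m (inj₂ k)) j × Θ (inj₂ k , splitAt n j) (inj₂ (e k , w))
      up (v , p , r) = join n m v , from p , subst (λ w → Θ (_ , w) _) (sym (splitAt-join n m v)) r

    dot-cubic : Cubic G
    dot-cubic i = subst (λ j → deg G j ≡ 3) (join-splitAt n m i) (deg-join (splitAt n i))

-- Faces of the dot product

abstract
  orbits-⊎ : ∀ {D D' : Set} {P : D ⊎ D' → Set} {π : D → D} {π' : D' → D'} {F F'}
    → (∀ d → P (inj₁ d) → P (inj₁ (π d))) → (∀ d → P (inj₂ d) → P (inj₂ (π' d)))
    → HasOrbits (P ∘ inj₁) π F → HasOrbits (P ∘ inj₂) π' F' → HasOrbits P (Sum.map π π') (F + F')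
  orbits-⊎ {D} {D'} {P} {π} {π'} {F} {F'} cl cl' o o' = lab , surj , λ d d' x y → to d d' x y , ⇝-invariant P lab clos inv x
    where
    module O = Orbits cl o
    module O' = Orbits cl' o'
    lab : D ⊎ D' → Fin (F + F')
    lab = join F F' ∘ Sum.map O.label O'.label
    clos : ∀ d → P d → P (Sum.map π π' d)
    clos (inj₁ d) = cl d
    clos (inj₂ d) = cl' d
    inv : ∀ d → P d → lab (Sum.map π π' d) ≡ lab d
    inv (inj₁ d) x = cong (join F F' ∘ inj₁) (O.label-step x)
    inv (inj₂ d) x = cong (join F F' ∘ inj₂) (O'.label-step x)
    iter₁ : ∀ k d → iter (Sum.map π π') k (inj₁ d) ≡ inj₁ (iter π k d)
    iter₁ zero d = refl
    iter₁ (suc k) d = cong (Sum.map π π') (iter₁ k d)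
    iter₂ : ∀ k d → iter (Sum.map π π') k (inj₂ d) ≡ inj₂ (iter π' k d)
    iter₂ zero d = refl
    iter₂ (suc k) d = cong (Sum.map π π') (iter₂ k d)
    to : ∀ d d' → P d → P d' → lab d ≡ lab d' → d ⟨ Sum.map π π' ⟩⇝ d'
    to (inj₁ d) (inj₁ d') x y p with O.≡⇒⇝ x y (inj₁-injective (join-injective F F' p))
    ... | k , refl = k , iter₁ k d
    to (inj₂ d) (inj₂ d') x y p with O'.≡⇒⇝ x y (inj₂-injective (join-injective F F' {inj₂ _} {inj₂ _} p))
    ... | k , refl = k , iter₂ k d
    to (inj₁ d) (inj₂ d') x y p with join-injective F F' {inj₁ _} {inj₂ _} p
    ... | ()
    to (inj₂ d) (inj₁ d') x y p with join-injective F F' {inj₂ _} {inj₁ _} p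
    ... | ()
    surj : ∀ i → ∃ λ d → P d × lab d ≡ i
    surj i with splitAt F i in eq
    ... | inj₁ j with O.label-surjective j
    ... | d , x , refl = inj₁ d , x , trans (sym (cong (join F F') eq)) (join-splitAt F F' i)
    surj i | inj₂ j with O'.label-surjective j
    ... | d , x , refl = inj₂ d , x , trans (sym (cong (join F F') eq)) (join-splitAt F F' i)

map-⇝₁ : ∀ {D D' : Set} {π : D → D} {π' : D' → D'} {d x} → inj₁ d ⟨ Sum.map π π' ⟩⇝ x
  → ∃ λ d' → x ≡ inj₁ d' × d ⟨ π ⟩⇝ d'
map-⇝₁ {π = π} {π'} {d} (k , refl) = go k
  where
  go : ∀ k → ∃ λ d' → iter (Sum.map π π') k (inj₁ d) ≡ inj₁ d' × d ⟨ π ⟩⇝ d'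
  go zero = d , refl , ⇝-refl
  go (suc k) with go k
  ... | d' , p , r = π d' , cong (Sum.map π π') p , ⇝-trans r ⇝-step

⇝-map₁ : ∀ {D D' : Set} {π : D → D} {π' : D' → D'} {d d'} → d ⟨ π ⟩⇝ d' → inj₁ d ⟨ Sum.map π π' ⟩⇝ inj₁ d'
⇝-map₁ {π = π} {π'} {d} (k , refl) = go k
  where
  go : ∀ k → inj₁ d ⟨ Sum.map π π' ⟩⇝ inj₁ (iter π k d)
  go zero = ⇝-refl
  go (suc k) = ⇝-trans (go k) ⇝-step

⇝-map₂ : ∀ {D D' : Set} {π : D → D} {π' : D' → D'} {d d'} → d ⟨ π' ⟩⇝ d' → inj₂ d ⟨ Sum.map π π' ⟩⇝ inj₂ d'
⇝-map₂ {π = π} {π'} {d} (k , refl) = go k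
  where
  go : ∀ k → inj₂ d ⟨ Sum.map π π' ⟩⇝ inj₂ (iter π' k d)
  go zero = ⇝-refl
  go (suc k) = ⇝-trans (go k) ⇝-step

module SwapAt {D : Set} (_≟_ : DecidableEquality D) where

  abstract
    swapAt : (D → D) → D → D → D → D
    swapAt π p q d with d ≟ p | d ≟ q
    ... | yes _ | _ = π q
    ... | no _ | yes _ = π p
    ... | no _ | no _ = π d

    swapAt-swapped : ∀ π {p q} → p ≢ q → Swapped p q π (swapAt π p q)
    swapAt-swapped π {p} {q} p≢q = record { at-p = at-p ; at-q = at-q ; off = off }
      where
      at-p : swapAt π p q p ≡ π q
      at-p with p ≟ p | p ≟ q
      ... | yes _ | _ = refl
      ... | no a | _ = ⊥-elim (a refl)
      at-q : swapAt π p q q ≡ π p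
      at-q with q ≟ p | q ≟ q
      ... | yes e | _ = ⊥-elim (p≢q (sym e))
      ... | no _ | yes _ = refl
      ... | no _ | no a = ⊥-elim (a refl)
      off : ∀ {d} → d ≢ p → d ≢ q → swapAt π p q d ≡ π d
      off {d} a b with d ≟ p | d ≟ q
      ... | yes e | _ = ⊥-elim (a e)
      ... | no _ | yes e = ⊥-elim (b e)
      ... | no _ | no _ = refl

  module Many {I : Set} (f g : I → D) (f-inj : ∀ {i j} → f i ≡ f j → i ≡ j)
    (g-inj : ∀ {i j} → g i ≡ g j → i ≡ j) (f≢g : ∀ i j → f i ≢ g j) (π : D → D) where

    swaps : List I → D → D
    swaps [] = π
    swaps (i ∷ is) = swapAt (swaps is) (f i) (g i)

    swaps-swapped : ∀ i is → Swapped (f i) (g i) (swaps is) (swaps (i ∷ is))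
    swaps-swapped i is = swapAt-swapped (swaps is) (f≢g i i)

    swaps-off : ∀ is {d} → (∀ i → i ∈ is → d ≢ f i × d ≢ g i) → swaps is d ≡ π d
    swaps-off [] h = refl
    swaps-off (i ∷ is) h = trans (Swapped.off (swaps-swapped i is) (proj₁ (h i (here refl))) (proj₂ (h i (here refl))))
                                 (swaps-off is (λ j p → h j (there p)))

    -- The exchanged pairs are disjoint, so each exchange still finds the images given by `π`. The
    -- values are thus known at once, while `swaps-swapped` lets orbits be counted one exchange at a
    -- time.
    swaps-at : ∀ is {i} → Unique is → i ∈ is → swaps is (f i) ≡ π (g i) × swaps is (g i) ≡ π (f i)
    swaps-at (i ∷ is) u (here refl) =
        trans (Swapped.at-p (swaps-swapped i is)) (swaps-off is λ j p → (f≢g j i ∘ sym) , ne p ∘ g-inj)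
      , trans (Swapped.at-q (swaps-swapped i is)) (swaps-off is λ j p → (ne p ∘ f-inj) , f≢g i j)
      where
      ne : ∀ {j} → j ∈ is → i ≢ j
      ne p refl = Unique[x∷xs]⇒x∉xs u p
    swaps-at (j ∷ is) {i} u@(_ ∷ us) (there p) =
        trans (Swapped.off (swaps-swapped j is) (ne ∘ f-inj) (f≢g i j)) (proj₁ (swaps-at is us p))
      , trans (Swapped.off (swaps-swapped j is) (f≢g j i ∘ sym) (ne ∘ g-inj)) (proj₂ (swaps-at is us p))
      where
      ne : i ≢ j
      ne refl = Unique[x∷xs]⇒x∉xs u p

module DotFaces {n m : ℕ} {H : Graph n} {H' : Graph (suc (suc m))} (S : Setting H H')
  {G : Graph (n + m)} (isDot : Dot.IsDot S G)
  (cubicH : Cubic H) (cubicH' : Cubic H')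
  (R : RotationSystem H) (R' : RotationSystem H')
  (rot-yx : ∀ s → rot R' (Setting.hub S s) (Setting.hub S (not s)) ≡ Setting.kv S (s , true))
  (rot-first : ∀ s → rot R' (Setting.hub S s) (Setting.kv S (s , true)) ≡ Setting.kv S (s , false))
  (rot-second : ∀ s → rot R' (Setting.hub S s) (Setting.kv S (s , false)) ≡ Setting.hub S (not s)) where

  open Dot S
  open IsDot isDot
  module PH = Planarity R cubicH
  module PH' = Planarity R' cubicH'

  D : Set
  D = Dart n ⊎ Dart (suc (suc m))

  _≟⊎_ : DecidableEquality D
  _≟⊎_ = ⊎-≡-dec _≟ᴰ_ _≟ᴰ_

  open SwapAt _≟⊎_ public

  hd out kd⁻ kd : Corner → D
  hd t = inj₁ (hv t , hv (mate t))
  kd t = inj₂ (kv t , hub (side t))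
  kd⁻ t = inj₂ (hub (side t) , kv t)
  -- The images of hd t and out t are going to be exchanged.
  out (s , true) = kd (s , false)
  out (s , false) = kd⁻ (s , false)

  hd-inj : ∀ {s t} → hd s ≡ hd t → s ≡ t
  hd-inj p = hv-inj (cong proj₁ (inj₁-injective p))

  out-inj : ∀ {s t} → out s ≡ out t → s ≡ t
  out-inj {s , true} {t , true} p = cong (_, true) (hub-inj (cong proj₂ (inj₂-injective p)))
  out-inj {s , true} {t , false} p = ⊥-elim (kv≢hubs _ t (cong proj₁ (inj₂-injective p)))
  out-inj {s , false} {t , true} p = ⊥-elim (kv≢hubs _ s (sym (cong proj₁ (inj₂-injective p))))
  out-inj {s , false} {t , false} p = cong (_, false) (hub-inj (cong proj₁ (inj₂-injective p)))

  -- `H` beside `H'` with `xy` cut into two half-edges. On side `true`, the two exchanges will make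
  -- `(x , b')` the reverse of `(a , b)`, and `(b' , x)` the reverse of `(b , a)`: the edges `ab`
  -- and `xb'` are resewn as `ax` and `bb'`.
  π₀ : D → D
  π₀ = Sum.map (PH.stepIn H) (PH'.stepIn H'-xy)

  hd≢out : ∀ s t → hd s ≢ out t
  hd≢out s (_ , true) ()
  hd≢out s (_ , false) ()

  open Many hd out hd-inj out-inj hd≢out π₀ public

  -- The face permutation of the dot product in which the edge aa' passes
  -- through x and cc' through y, each keeping one dangling half-edge.
  π : D → D
  π = swaps corners

  π-hd : ∀ t → π (hd t) ≡ π₀ (out t)
  π-hd t = proj₁ (swaps-at corners corners-unique (∈-corners t))

  π-out : ∀ t → π (out t) ≡ π₀ (hd t)
  π-out t = proj₂ (swaps-at corners corners-unique (∈-corners t))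

  π-off : ∀ d → (∀ t → d ≢ hd t) → (∀ t → d ≢ out t) → π d ≡ π₀ d
  π-off _ f g = swaps-off corners λ t _ → f t , g t

  σ : D → D
  σ (inj₁ (u , v)) = inj₁ (u , rot R u v)
  σ (inj₂ (u , v)) = inj₂ (u , rot R' u v)

  out≡ : ∀ {v w} t → inj₂ (v , w) ≡ out t
    → (v ≡ kv (side t , false) × w ≡ hub (side t)) ⊎ (v ≡ hub (side t) × w ≡ kv (side t , false))
  out≡ (s , true) refl = inj₁ (refl , refl)
  out≡ (s , false) refl = inj₂ (refl , refl)

  π-H : ∀ {h h'} → Adj H h h' → ¬ Cut h h' → π (inj₁ (h , h')) ≡ inj₁ (h' , rot R h' h)
  π-H p c = trans (π-off (inj₁ _) (λ { t refl → c (t , refl , refl) }) λ { (s , true) () ; (s , false) () })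
                  (cong inj₁ (PH.stepIn-∈ H p))

  π-kk : ∀ {k k'} → Adj H' (e k) (e k') → π (inj₂ (e k , e k')) ≡ inj₂ (e k' , rot R' (e k') (e k))
  π-kk {k} {k'} p = trans (π-off (inj₂ _) (λ _ ()) not-out) (cong inj₂ (PH'.stepIn-∈ H'-xy (H'-xy-adj p λ s (q , _) → e≢hub k s q)))
    where
    not-out : ∀ t → inj₂ (e k , e k') ≢ out t
    not-out t q with out≡ t q
    ... | inj₁ (_ , r) = e≢hub k' (side t) r
    ... | inj₂ (r , _) = e≢hub k (side t) r

  -- On side `true`, running from `a` to `a'` passes `x`: from `(a , b)` to `(x , y)`, the
  -- half-edge, then to `(x , a')`, then beyond `a'`. Three steps of `π` make up one face step.
  π-hd-true : ∀ s → π (hd (s , true)) ≡ inj₂ (hub s , hub (not s))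
  π-hd-true s = trans (π-hd (s , true)) (cong inj₂ (trans (PH'.stepIn-∈ H'-xy (H'-xy-kv (s , false)))
                  (cong (hub s ,_) (rot-second s))))

  π-hub-hub : ∀ s → π (inj₂ (hub s , hub (not s))) ≡ kd⁻ (s , true)
  π-hub-hub s = trans (π-off (inj₂ _) (λ _ ()) not-out)
      (cong inj₂ (trans (PH'.stepIn-∉ H'-xy (H'-xy-hub s)) (cong (hub s ,_) (rot-yx s))))
    where
    not-out : ∀ t → inj₂ (hub s , hub (not s)) ≢ out t
    not-out t q with out≡ t q
    ... | inj₁ (r , _) = kv≢hubs _ s (sym r)
    ... | inj₂ (_ , r) = kv≢hubs _ (not s) (sym r)

  π-kd⁻-true : ∀ s → π (kd⁻ (s , true)) ≡ σ (kd (s , true))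
  π-kd⁻-true s = trans (π-off (inj₂ _) (λ _ ()) not-out) (cong inj₂ (PH'.stepIn-∈ H'-xy (Adj-sym H'-xy (H'-xy-kv (s , true)))))
    where
    not-out : ∀ t → kd⁻ (s , true) ≢ out t
    not-out t q with out≡ t q
    ... | inj₁ (r , _) = kv≢hubs _ s (sym r)
    ... | inj₂ (r , r') with hub-inj r
    ... | refl with kv-inj {s , true} {s , false} refl r'
    ... | ()

  π-kd-true : ∀ s → π (kd (s , true)) ≡ kd⁻ (s , false)
  π-kd-true s = trans (π-off (inj₂ _) (λ _ ()) not-out)
      (cong inj₂ (trans (PH'.stepIn-∈ H'-xy (H'-xy-kv (s , true))) (cong (hub s ,_) (rot-first s))))
    where
    not-out : ∀ t → kd (s , true) ≢ out t
    not-out t q with out≡ t q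
    ... | inj₂ (r , _) = kv≢hubs _ (side t) r
    ... | inj₁ (r , r') with hub-inj r'
    ... | refl with kv-inj {s , true} {s , false} refl r
    ... | ()

  π-hd-false : ∀ s → π (hd (s , false)) ≡ σ (kd (s , false))
  π-hd-false s = trans (π-hd (s , false)) (cong inj₂ (PH'.stepIn-∈ H'-xy (Adj-sym H'-xy (H'-xy-kv (s , false)))))

  π-kd-false : ∀ s → π (kd (s , false)) ≡ σ (hd (s , false))
  π-kd-false s = trans (π-out (s , true)) (cong inj₁ (PH.stepIn-∈ H (hv-adj (s , true))))

  π-kd⁻-false : ∀ s → π (kd⁻ (s , false)) ≡ σ (hd (s , true))
  π-kd⁻-false s = trans (π-out (s , false)) (cong inj₁ (PH.stepIn-∈ H (hv-adj (s , false))))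

  -- A face step of the dot product is the next visit of `π` to a dart that does not start at a hub:
  -- at once, except along `aa'` and `cc'`, where two hub darts intervene on the way from `H` and
  -- one on the way back.
  data Advance (d d* : D) : Set where
    one   : π d ≡ d* → Advance d d*
    two   : FromHub (π d) → π (π d) ≡ d* → Advance d d*
    three : FromHub (π d) → FromHub (π (π d)) → π (π (π d)) ≡ d* → Advance d d*

  advance : ∀ {u v d} → DotAdj u v → Θ (u , v) d → ∃ λ d⁻ → Θ (v , u) d⁻ × IsDart⊎ d⁻ × Advance d (σ d⁻)
  advance (jj (p , _)) (jj c) = _ , jj (c ∘ cut-sym) , Adj-sym H p , one (π-H p c)
  advance (jk _ _ _) (jk t@(s , true) refl refl q) = kd t , kj t refl q (sym q) refl
    , Adj-sym H' (kv-adj t)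
    , three (subst FromHub (sym (π-hd-true s)) (s , refl)) (subst FromHub (sym eq₂) (s , refl))
            (trans (cong π eq₂) (π-kd⁻-true s))
    where
    eq₂ : π (π (hd t)) ≡ kd⁻ t
    eq₂ = trans (cong π (π-hd-true s)) (π-hub-hub s)
  advance (jk _ _ _) (jk t@(s , false) refl refl q) = kd t , kj t refl q (sym q) refl
    , Adj-sym H' (kv-adj t) , one (π-hd-false s)
  advance (kj _ _ _) (kj t@(s , true) refl q refl refl) = hd t , jk t refl refl q , hv-adj t
    , subst (λ v → Advance (inj₂ (v , hub s)) (σ (hd t))) (sym q)
        (two (subst FromHub (sym (π-kd-true s)) (s , refl)) (trans (cong π (π-kd-true s)) (π-kd⁻-false s)))
  advance (kj _ _ _) (kj t@(s , false) refl q refl refl) = hd t , jk t refl refl q , hv-adj t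
    , subst (λ v → Advance (inj₂ (v , hub s)) (σ (hd t))) (sym q) (one (π-kd-false s))
  advance (kk p) (kk refl refl) = _ , kk refl refl , Adj-sym H' p , one (π-kk p)

  -- No orbit of `π` consists of hub darts alone, so no face is lost by skipping them.
  hub-advance : ∀ d → IsDart⊎ d → FromHub d → ∃ λ d' → IsDart⊎ d' × ¬ FromHub d' × d ⟨ π ⟩⇝ d'
  hub-advance (inj₂ (_ , w)) p (s , refl) with hub-nbr s p
  ... | inj₁ refl = σ (kd (s , true)) , rot-adj R' _ _ (Adj-sym H' (kv-adj (s , true)))
                  , (λ (s' , q) → kv≢hubs _ s' q)
                  , 2 , trans (cong π (π-hub-hub s)) (π-kd⁻-true s)
  ... | inj₂ (true , refl) = σ (kd (s , true)) , rot-adj R' _ _ (Adj-sym H' (kv-adj (s , true)))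
                  , (λ (s' , q) → kv≢hubs _ s' q) , 1 , π-kd⁻-true s
  ... | inj₂ (false , refl) = σ (hd (s , true)) , rot-adj R _ _ (hv-adj (s , true)) , (λ ())
                  , 1 , π-kd⁻-false s

  -- The rotation at a vertex is that of `H` or `H'`, transported along `Θ`: the cross edge takes
  -- the place of the edge that was removed there.
  next : ∀ {u v} → DotAdj u v → ∃ λ v' → DotAdj u v' × ∀ {d} → Θ (u , v) d → Θ (u , v') (σ d)
  next {inj₁ h} {v} p with Θ-from p
  ... | inj₁ (_ , h') , q , r@(jj _) with Θ-to₁ (rot-adj R h h' q)
  ... | v' , p' , r' = v' , p' , λ s → subst (λ d → Θ (inj₁ h , v') (σ d)) (Θ-functional r s) r'
  next {inj₁ h} {v} p | inj₁ (_ , h') , q , r@(jk _ _ _ _) with Θ-to₁ (rot-adj R h h' q)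
  ... | v' , p' , r' = v' , p' , λ s → subst (λ d → Θ (inj₁ h , v') (σ d)) (Θ-functional r s) r'
  next {inj₂ k} {v} p with Θ-from p
  ... | inj₂ (_ , w) , q , r@(kj _ _ _ refl _) with Θ-to₂ (rot-adj R' (e k) w q)
  ... | v' , p' , r' = v' , p' , λ s → subst (λ d → Θ (inj₂ k , v') (σ d)) (Θ-functional r s) r'
  next {inj₂ k} {v} p | inj₂ (_ , w) , q , r@(kk refl _) with Θ-to₂ (rot-adj R' (e k) w q)
  ... | v' , p' , r' = v' , p' , λ s → subst (λ d → Θ (inj₂ k , v') (σ d)) (Θ-functional r s) r'

  adj⇒ : ∀ {i j} → Adj G i j → DotAdj (splitAt n i) (splitAt n j)
  adj⇒ {i} {j} p = to (subst₂ (Adj G) (sym (join-splitAt n m i)) (sym (join-splitAt n m j)) p)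

  ⇒adj : ∀ {i u} → DotAdj (splitAt n i) u → Adj G i (join n m u)
  ⇒adj {i} p = subst (λ j → Adj G j _) (join-splitAt n m i) (from p)

  Θ̂ : Dart (n + m) → D → Set
  Θ̂ (i , j) = Θ (splitAt n i , splitAt n j)

  Θ̂-injective : ∀ {δ δ' d} → Θ̂ δ d → Θ̂ δ' d → δ ≡ δ'
  Θ̂-injective {i , j} {i' , j'} r s with cong proj₁ (Θ-injective r s) | cong proj₂ (Θ-injective r s)
  ... | p | q = cong₂ _,_ (splitAt-injective n p) (splitAt-injective n q)

  rotG : Fin (n + m) → Fin (n + m) → Fin (n + m)
  rotG i j with T? (adj G i j)
  ... | yes p = join n m (proj₁ (next (adj⇒ p)))
  ... | no _ = j

  rotG-spec : ∀ {i j} → Adj G i j → Adj G i (rotG i j) × (∀ {d} → Θ̂ (i , j) d → Θ̂ (i , rotG i j) (σ d))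
  rotG-spec {i} {j} p with T? (adj G i j)
  ... | no ¬p = ⊥-elim (¬p p)
  ... | yes p' with next (adj⇒ p')
  ... | v' , q , f = ⇒adj q , λ r → subst (λ v → Θ (splitAt n i , v) _) (sym (splitAt-join n m v')) (f r)

  σ-injective : ∀ {d d'} → IsDart⊎ d → IsDart⊎ d' → σ d ≡ σ d' → d ≡ d'
  σ-injective {inj₁ (u , v)} {inj₁ (u' , v')} p p' q with cong proj₁ (inj₁-injective q)
  ... | refl = cong (λ v → inj₁ (u , v)) (rot-inj R u v v' p p' (cong proj₂ (inj₁-injective q)))
  σ-injective {inj₂ (u , v)} {inj₂ (u' , v')} p p' q with cong proj₁ (inj₂-injective q)
  ... | refl = cong (λ v → inj₂ (u , v)) (rot-inj R' u v v' p p' (cong proj₂ (inj₂-injective q)))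

  iter-σ₁ : ∀ k {u v} → iter σ k (inj₁ (u , v)) ≡ inj₁ (u , iter (rot R u) k v)
  iter-σ₁ zero = refl
  iter-σ₁ (suc k) = cong σ (iter-σ₁ k)

  iter-σ₂ : ∀ k {u v} → iter σ k (inj₂ (u , v)) ≡ inj₂ (u , iter (rot R' u) k v)
  iter-σ₂ zero = refl
  iter-σ₂ (suc k) = cong σ (iter-σ₂ k)

  same-source : ∀ {u v w d d'} → Θ (u , v) d → IsDart⊎ d → Θ (u , w) d' → IsDart⊎ d' → ∃ λ k → iter σ k d ≡ d'
  same-source r p s q = go r p s q
    where
    H-case : ∀ {h h₁ h₂} → Adj H h h₁ → Adj H h h₂ → ∃ λ k → iter σ k (inj₁ (h , h₁)) ≡ inj₁ (h , h₂)
    H-case p q with rot-cyc R _ _ _ p q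
    ... | k , eq = k , trans (iter-σ₁ k) (cong (λ v → inj₁ (_ , v)) eq)
    H'-case : ∀ {h h₁ h₂} → Adj H' h h₁ → Adj H' h h₂ → ∃ λ k → iter σ k (inj₂ (h , h₁)) ≡ inj₂ (h , h₂)
    H'-case p q with rot-cyc R' _ _ _ p q
    ... | k , eq = k , trans (iter-σ₂ k) (cong (λ v → inj₂ (_ , v)) eq)
    go : ∀ {u v w d d'} → Θ (u , v) d → IsDart⊎ d → Θ (u , w) d' → IsDart⊎ d' → ∃ λ k → iter σ k d ≡ d'
    go (jj _) p (jj _) q = H-case p q
    go (jj _) p (jk _ _ _ _) q = H-case p q
    go (jk _ _ _ _) p (jj _) q = H-case p q
    go (jk _ _ _ _) p (jk _ _ _ _) q = H-case p q
    go (kj _ _ _ refl _) p (kj _ _ _ refl _) q = H'-case p q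
    go (kj _ _ _ refl _) p (kk refl _) q = H'-case p q
    go (kk refl _) p (kj _ _ _ refl _) q = H'-case p q
    go (kk refl _) p (kk refl _) q = H'-case p q

  iter-rotG : ∀ k {i j} → Adj G i j → Adj G i (iter (rotG i) k j)
    × (∀ {d} → Θ̂ (i , j) d → Θ̂ (i , iter (rotG i) k j) (iter σ k d))
  iter-rotG zero p = p , id
  iter-rotG (suc k) p with iter-rotG k p
  ... | q , f with rotG-spec q
  ... | q' , f' = q' , f' ∘ f

  RG : RotationSystem G
  RG = record
    { rot = rotG
    ; rot-adj = λ i j p → proj₁ (rotG-spec p)
    ; rot-inj = inj
    ; rot-cyc = cyc }
    where
    inj : ∀ i j l → Adj G i j → Adj G i l → rotG i j ≡ rotG i l → j ≡ l
    inj i j l p q eq with Θ-from (adj⇒ p) | Θ-from (adj⇒ q)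
    ... | d , x , r | d' , y , s
      with σ-injective {d} {d'} x y (Θ-functional (proj₂ (rotG-spec p) r)
             (subst (λ w → Θ̂ (i , w) (σ d')) (sym eq) (proj₂ (rotG-spec q) s)))
    ... | refl = cong proj₂ (Θ̂-injective {i , j} {i , l} r s)
    cyc : ∀ i j l → Adj G i j → Adj G i l → ∃ λ k → iter (rotG i) k j ≡ l
    cyc i j l p q with Θ-from (adj⇒ p) | Θ-from (adj⇒ q)
    ... | d , x , r | d' , y , s with same-source r x s y
    ... | k , refl = k , cong proj₂ (Θ̂-injective {i , iter (rotG i) k j} {i , l} (proj₂ (iter-rotG k p) r) s)

  f : Dart (n + m) → Dart (n + m)
  f = faceStep RG

  f-advance : ∀ {δ d} → IsDart G δ → Θ̂ δ d → ∃ λ d* → IsDart G (f δ) × Θ̂ (f δ) d* × Advance d d*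
  f-advance {i , j} p r with advance (adj⇒ p) r
  ... | d⁻ , r⁻ , _ , a with rotG-spec (Adj-sym G p)
  ... | q , g = σ d⁻ , q , g r⁻ , a

  Advance⇒⇝ : ∀ {d d*} → Advance d d* → d ⟨ π ⟩⇝ d*
  Advance⇒⇝ (one p) = 1 , p
  Advance⇒⇝ (two _ p) = 2 , p
  Advance⇒⇝ (three _ _ p) = 3 , p

  f⇒π : ∀ {δ d} → IsDart G δ → Θ̂ δ d → ∀ k
    → ∃ λ d' → IsDart G (iter f k δ) × Θ̂ (iter f k δ) d' × d ⟨ π ⟩⇝ d'
  f⇒π p r zero = _ , p , r , ⇝-refl
  f⇒π p r (suc k) with f⇒π p r k
  ... | d' , q , s , t with f-advance q s
  ... | d* , q' , s' , a = d* , q' , s' , ⇝-trans t (Advance⇒⇝ a)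

  -- A face step uses up one, two or three of the `k` steps. The count cannot run out in between,
  -- for a dart at a hub corresponds to no dart of the dot product.
  π⇒f : ∀ k {δ δ' d d'} → IsDart G δ → Θ̂ δ d → Θ̂ δ' d' → iter π k d ≡ d' → δ ⟨ f ⟩⇝ δ'
  π⇒f zero p r s refl = ⇝-≡ (Θ̂-injective r s)
  π⇒f (suc k) {δ' = δ'} {d} p r s eq with f-advance p r
  π⇒f (suc k) {δ' = δ'} {d} p r s eq | d* , q , r' , one refl =
    ⇝-trans ⇝-step (π⇒f k {δ' = δ'} q r' s (trans (iter-shift π k d) eq))
  π⇒f (suc zero) p r s refl | d* , q , r' , two h _ = ⊥-elim (Θ-¬hub s h)
  π⇒f (suc (suc k)) {δ' = δ'} {d} p r s eq | d* , q , r' , two h refl =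
    ⇝-trans ⇝-step (π⇒f k {δ' = δ'} q r' s (trans (iter-shift π k (π d)) (trans (cong π (iter-shift π k d)) eq)))
  π⇒f (suc zero) p r s refl | d* , q , r' , three h _ _ = ⊥-elim (Θ-¬hub s h)
  π⇒f (suc (suc zero)) p r s refl | d* , q , r' , three _ h _ = ⊥-elim (Θ-¬hub s h)
  π⇒f (suc (suc (suc k))) {δ' = δ'} {d} p r s eq | d* , q , r' , three _ h refl =
    ⇝-trans ⇝-step (π⇒f k {δ' = δ'} q r' s (trans (iter-shift π k (π (π d)))
      (trans (cong π (trans (iter-shift π k (π d)) (cong π (iter-shift π k d)))) eq)))

  faces : ∀ {z} → (∀ d → IsDart⊎ d → IsDart⊎ (π d)) → HasOrbits IsDart⊎ π z → HasFaces RG z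
  faces {z} closed orb = lab , surj , λ δ δ' p q → same p q , ⇝-lab p
    where
    open Orbits closed orb
    image : ∀ δ → IsDart G δ → ∃ λ d → IsDart⊎ d × Θ̂ δ d
    image (i , j) p = Θ-from (adj⇒ p)
    preimage : ∀ d → IsDart⊎ d → ¬ FromHub d → ∃ λ δ → IsDart G δ × Θ̂ δ d
    preimage (inj₁ (h , h')) p _ with Θ-to₁ p
    ... | v , q , r = (join n m (inj₁ h) , join n m v) , from q
        , subst₂ (λ u v → Θ (u , v) _) (sym (splitAt-join n m (inj₁ h))) (sym (splitAt-join n m v)) r
    preimage (inj₂ (u , w)) p ¬h with e-onto (λ s q → ¬h (s , q))
    ... | k , refl with Θ-to₂ p
    ... | v , q , r = (join n m (inj₂ k) , join n m v) , from q
        , subst₂ (λ u v → Θ (u , v) _) (sym (splitAt-join n m (inj₂ k))) (sym (splitAt-join n m v)) r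
    some : Fin z
    some = label (hd (true , true))
    lab : Dart (n + m) → Fin z
    lab (i , j) with T? (adj G i j)
    ... | yes p = label (proj₁ (image (i , j) p))
    ... | no _ = some
    lab-spec : ∀ {δ d} → IsDart G δ → Θ̂ δ d → lab δ ≡ label d
    lab-spec {i , j} p r with T? (adj G i j)
    ... | no ¬p = ⊥-elim (¬p p)
    ... | yes p' = cong label (Θ-functional (proj₂ (proj₂ (image (i , j) p'))) r)
    same : ∀ {δ δ'} → IsDart G δ → IsDart G δ' → lab δ ≡ lab δ' → δ ⟨ f ⟩⇝ δ'
    same {δ} {δ'} p q eq with image δ p | image δ' q
    ... | d , x , r | d' , y , s with ≡⇒⇝ x y (trans (sym (lab-spec p r)) (trans eq (lab-spec q s)))
    ... | k , t = π⇒f k {δ' = δ'} p r s t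
    ⇝-lab : ∀ {δ δ'} → IsDart G δ → δ ⟨ f ⟩⇝ δ' → lab δ ≡ lab δ'
    ⇝-lab {δ} p (k , refl) with image δ p
    ... | d , x , r with f⇒π p r k
    ... | d' , q , s , t = trans (lab-spec p r) (trans (⇝⇒≡ x t) (sym (lab-spec q s)))
    surj : ∀ i → ∃ λ δ → IsDart G δ × lab δ ≡ i
    surj i with label-surjective i
    ... | d , x , refl with fromHub? d
    ... | no ¬h with preimage d x ¬h
    ... | δ , p , r = δ , p , lab-spec p r
    surj i | d , x , refl | yes h with hub-advance d x h
    ... | d' , y , ¬h , t with preimage d' y ¬h
    ... | δ , p , r = δ , p , trans (lab-spec p r) (sym (⇝⇒≡ x t))

-- Connectedness of the graphs with deleted edges and of the dot product

module Connectivity {n m : ℕ} {H : Graph n} {H' : Graph (suc (suc m))} (S : Setting H H')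
  (conn-J : ∀ u v → Star (Dot.AdjJ S) u v)
  (conn-J' : ∀ k l → Star (λ k l → Adj H' (Setting.e S k) (Setting.e S l)) k l) where

  open Dot S

  H-conn : ∀ u v → Star (Adj H) u v
  H-conn u v = Star.map proj₁ (conn-J u v)

  H-ab : Graph n
  H-ab = delEdge H (hv (true , true)) (hv (true , false))

  H-ab-cd : Graph n
  H-ab-cd = delEdge H-ab (hv (false , true)) (hv (false , false))

  AdjJ⇒H-ab-cd : ∀ {u v} → AdjJ u v → Adj H-ab-cd u v
  AdjJ⇒H-ab-cd (p , c) = delEdge⁺ H-ab (delEdge⁺ H p (λ q → c (_ , q)) (λ q → c (_ , q)))
                             (λ q → c (_ , q)) (λ q → c (_ , q))

  H-ab-cd-conn : ∀ u v → Star (Adj H-ab-cd) u v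
  H-ab-cd-conn u v = Star.map AdjJ⇒H-ab-cd (conn-J u v)

  H-ab-conn : ∀ u v → Star (Adj H-ab) u v
  H-ab-conn u v = Star.map (delEdge-⊆ H-ab) (H-ab-cd-conn u v)

  -- Each hub is tied to `J'` by its edge to `kv (s , true)`.
  H'-xy-conn : ∀ u v → Star (Adj H'-xy) u v
  H'-xy-conn u v = to-e u ◅◅ Star.gmap e (λ p → H'-xy-adj p λ s (q , _) → e≢hub _ s q) (conn-J' _ _) ◅◅ Star.reverse (Adj-sym H'-xy) (to-e v)
    where
    root : Fin (suc (suc m)) → Fin m
    root v with hub? v
    ... | inj₁ (s , _) = proj₁ (kv₀ (s , true))
    ... | inj₂ f = proj₁ (e-onto f)
    to-e : ∀ v → Star (Adj H'-xy) v (e (root v))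
    to-e v with hub? v
    ... | inj₁ (s , refl) = subst (Adj H'-xy (hub s)) (sym (proj₂ (kv₀ (s , true)))) (Adj-sym H'-xy (H'-xy-kv (s , true))) ◅ ε
    ... | inj₂ f = subst (Star (Adj H'-xy) v) (sym (proj₂ (e-onto f))) ε

  H'-conn : ∀ u v → Star (Adj H') u v
  H'-conn u v = Star.map (delEdge-⊆ H') (H'-xy-conn u v)

  dot-conn : ∀ {G} → IsDot G → ∀ i j → Star (Adj G) i j
  dot-conn {G} isDot i j = subst₂ (Star (Adj G)) (join-splitAt n m i) (join-splitAt n m j)
      (Star.gmap (join n m) from (to-kv (splitAt n i) ◅◅ Star.reverse DotAdj-sym (to-kv (splitAt n j))))
    where
    open IsDot isDot
    t₀ : Corner
    t₀ = true , true
    to-kv : ∀ u → Star DotAdj u (inj₂ (proj₁ (kv₀ t₀)))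
    to-kv (inj₁ h) = Star.gmap inj₁ jj (conn-J h (hv t₀)) ◅◅ (jk t₀ refl (proj₂ (kv₀ t₀)) ◅ ε)
    to-kv (inj₂ k) = Star.gmap inj₂ kk (conn-J' k _)

-- The four exchanges and Euler's formula for the dot product

module PlanarDot {n m : ℕ} {H : Graph n} {H' : Graph (suc (suc m))} (S : Setting H H')
  {G : Graph (n + m)} (isDot : Dot.IsDot S G)
  (cubicH : Cubic H) (cubicH' : Cubic H')
  (R : RotationSystem H) (R' : RotationSystem H')
  (rot-yx : ∀ s → rot R' (Setting.hub S s) (Setting.hub S (not s)) ≡ Setting.kv S (s , true))
  (rot-first : ∀ s → rot R' (Setting.hub S s) (Setting.kv S (s , true)) ≡ Setting.kv S (s , false))
  (rot-second : ∀ s → rot R' (Setting.hub S s) (Setting.kv S (s , false)) ≡ Setting.hub S (not s))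
  (conn-J : ∀ u v → Star (Dot.AdjJ S) u v)
  (conn-J' : ∀ k l → Star (λ k l → Adj H' (Setting.e S k) (Setting.e S l)) k l)
  (planarR : IsPlanarEmbedding R) (planarR' : IsPlanarEmbedding R')
  (common : (Setting.hv S (true , true) , Setting.hv S (true , false))
            ⟨ faceStep R ⟩⇝ (Setting.hv S (false , true) , Setting.hv S (false , false))) where

  open Dot S
  open DotFaces S isDot cubicH cubicH' R R' rot-yx rot-first rot-second
  open Connectivity S conn-J conn-J' using (H-ab; H-ab-cd; H-ab-conn; H-ab-cd-conn; H-conn; H'-conn; H'-xy-conn; dot-conn)

  F F' : ℕ
  F = proj₁ planarR
  F' = proj₁ planarR'

  tightH : PH.Tight H F × 2 * n + 2 * F ≡ sumDeg H + 4
  tightH = let (_ , _ , fs , cs , eq) = planarR in PH.tight (hv (true , true)) H-conn fs cs eq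

  tightH' : PH'.Tight H' F' × 2 * suc (suc m) + 2 * F' ≡ sumDeg H' + 4
  tightH' = let (_ , _ , fs , cs , eq) = planarR' in PH'.tight (hub true) H'-conn fs cs eq

  a b c d : Corner
  a = true , true
  b = true , false
  c = false , true
  d = false , false

  module DelAB = PH.Delete H id (proj₁ tightH) (hv-adj a) H-ab-conn

  cd∈H-ab : Adj H-ab (hv c) (hv d)
  cd∈H-ab = delEdge⁺ H (hv-adj c) (λ (p , _) → c≢a (hv-inj p)) (λ (p , _) → c≢b (hv-inj p))
    where
    c≢a : c ≢ a
    c≢a ()
    c≢b : c ≢ b
    c≢b ()

  module DelCD = PH.Delete H-ab (delEdge-⊆ H) (proj₂ (proj₂ DelAB.tight')) cd∈H-ab H-ab-cd-conn

  _~_ : Dart n → Dart n → Set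
  p ~ q = p ⟨ PH.stepIn H ⟩⇝ q

  dart : Corner → Dart n
  dart t = hv t , hv (mate t)

  module OH = Orbits {π = PH.stepIn H} (PH.stepIn-closed {H} id) (proj₁ (proj₁ tightH))

  a~c : dart a ~ dart c
  a~c = let (k , eq) = common in
    k , trans (iter-cong PH.faceStep-closed PH.faceStep-stepIn k (hv-adj a)) eq

  b≁a : ¬ dart b ~ dart a
  b≁a r = DelAB.two-sides (OH.⇝-sym (hv-adj b) r)

  -- `cd` borders two faces even after `ab` is deleted, and joins never separate; so `d` cannot lie
  -- on the common face of `a` and `c`.
  d≁a : ¬ dart d ~ dart a
  d≁a r = DelCD.two-sides (DelAB.join⁺ (OH.⇝-sym (hv-adj d) (⇝-trans r a~c)))

  -- Deleting `ab` joins its two faces. If `d` shared the face of `b`, then in `H-ab` it would share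
  -- that of `a`, hence that of `c`.
  d≁b : ¬ dart d ~ dart b
  d≁b r = DelCD.two-sides (⇝-trans (DelAB.join⁺ (OH.⇝-sym (hv-adj a) a~c))
    (⇝-trans DelAB.p⇝q (DelAB.join⁺ (OH.⇝-sym (hv-adj d) r))))

  module DelXY = PH'.Delete H' id (proj₁ tightH') (hub-adj true) H'-xy-conn

  F₁ : ℕ
  F₁ = proj₁ DelXY.tight'

  F'≡ : F' ≡ suc F₁
  F'≡ = proj₁ (proj₂ DelXY.tight')

  H'-xy-orbits : HasOrbits (IsDart H') (PH'.stepIn H'-xy) F₁
  H'-xy-orbits = proj₁ (proj₂ (proj₂ DelXY.tight'))

  module OK = Orbits {π = PH'.stepIn H'-xy} (PH'.stepIn-closed {H'-xy} (delEdge-⊆ H')) H'-xy-orbits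

  -- `(b' , x)` is followed by the half-edge `(x , y)`, and `(d' , y)` by `(y , x)`. These two share
  -- an orbit because deleting `xy` has joined the faces on its sides.
  kv-facing : (kv b , hub true) ⟨ PH'.stepIn H'-xy ⟩⇝ (kv d , hub false)
  kv-facing = ⇝-trans (to-hubs true) (⇝-trans DelXY.p⇝q
      (OK.⇝-sym (Adj-sym H' (kv-adj d)) (to-hubs false)))
    where
    to-hubs : ∀ s → (kv (s , false) , hub s) ⟨ PH'.stepIn H'-xy ⟩⇝ (hub s , hub (not s))
    to-hubs s = 1 , trans (PH'.stepIn-∈ H'-xy (H'-xy-kv (s , false))) (cong (hub s ,_) (rot-second s))

  isDart⊎? : ∀ x → Dec (IsDart⊎ x)
  isDart⊎? (inj₁ x) = isDart? H x
  isDart⊎? (inj₂ x) = isDart? H' x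

  π₀-closed : ∀ x → IsDart⊎ x → IsDart⊎ (π₀ x)
  π₀-closed (inj₁ x) = PH.stepIn-closed {H} id x
  π₀-closed (inj₂ x) = PH'.stepIn-closed {H'-xy} (delEdge-⊆ H') x

  out-dart : ∀ t → IsDart⊎ (out t)
  out-dart (s , true) = Adj-sym H' (kv-adj (s , false))
  out-dart (s , false) = kv-adj (s , false)

  π₀-orbits : HasOrbits IsDart⊎ π₀ (F + F₁)
  π₀-orbits = orbits-⊎ {P = IsDart⊎} (λ x → π₀-closed (inj₁ x)) (λ x → π₀-closed (inj₂ x))
                (proj₁ (proj₁ tightH)) H'-xy-orbits

  hd⇝₀hd : ∀ {s t} → hd s ⟨ π₀ ⟩⇝ hd t → dart s ~ dart t
  hd⇝₀hd r with map-⇝₁ r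
  ... | _ , refl , r' = r'

  hd⇝₀H' : ∀ {s x} → ¬ hd s ⟨ π₀ ⟩⇝ inj₂ x
  hd⇝₀H' r with map-⇝₁ r
  ... | _ , () , _

  module S₁ = Swap _≟⊎_ {P = IsDart⊎} π₀-closed π₀-orbits {hd a} {out a} (hv-adj a) (out-dart a)
                (swaps-swapped a [])
  module J₁ = S₁.Join (hd⇝₀H' {a})

  π₁ : D → D
  π₁ = swaps (a ∷ [])

  -- The first exchange has only affected the face of `hd a` on the side of `H`; the orbit of `hd b`
  -- is a different face and still lies within `H`.
  b↛ : ¬ hd b ⟨ π₁ ⟩⇝ out b
  b↛ r with J₁.join⁻ (hv-adj b) (out-dart b) r
  ... | inj₁ r' = hd⇝₀H' {b} r'
  ... | inj₂ (inj₁ (r' , _)) = b≁a (hd⇝₀hd {b} {a} r')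
  ... | inj₂ (inj₂ (r' , _)) = hd⇝₀H' {b} r'

  module S₂ = Swap _≟⊎_ {P = IsDart⊎} S₁.closed' (proj₂ (proj₂ J₁.joined)) {hd b} {out b} (hv-adj b) (out-dart b)
                (swaps-swapped b (a ∷ []))
  module J₂ = S₂.Join b↛

  π₂ : D → D
  π₂ = swaps (b ∷ a ∷ [])

  d↛₁ : ∀ {x} → IsDart⊎ x → ¬ hd d ⟨ π₀ ⟩⇝ x → ¬ hd d ⟨ π₁ ⟩⇝ x
  d↛₁ p ne r with J₁.join⁻ (hv-adj d) p r
  ... | inj₁ r' = ne r'
  ... | inj₂ (inj₁ (r' , _)) = d≁a (hd⇝₀hd {d} {a} r')
  ... | inj₂ (inj₂ (r' , _)) = hd⇝₀H' {d} r'

  -- The face of `hd d` is neither that of `hd a` nor that of `hd b`, so two exchanges have left it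
  -- within `H`, whatever they did to the orbits of `H'`.
  d↛ : ¬ hd d ⟨ π₂ ⟩⇝ out d
  d↛ r with J₂.join⁻ (hv-adj d) (out-dart d) r
  ... | inj₁ r' = d↛₁ {out d} (out-dart d) (hd⇝₀H' {d}) r'
  ... | inj₂ (inj₁ (r' , _)) = d↛₁ {hd b} (hv-adj b) (d≁b ∘ hd⇝₀hd {d} {b}) r'
  ... | inj₂ (inj₂ (r' , _)) = d↛₁ {out b} (out-dart b) (hd⇝₀H' {d}) r'

  module S₃ = Swap _≟⊎_ {P = IsDart⊎} S₂.closed' (proj₂ (proj₂ J₂.joined)) {hd d} {out d} (hv-adj d) (out-dart d)
                (swaps-swapped d (b ∷ a ∷ []))
  module J₃ = S₃.Join d↛

  π₃ : D → D
  π₃ = swaps (d ∷ b ∷ a ∷ [])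

  -- From `c` to `a` on the common face, over the first exchange to `(b' , x)`, then by `kv-facing`
  -- to `(d' , y)`, which is `out c`. Joins preserve all these paths.
  c⇝ : hd c ⟨ π₃ ⟩⇝ out c
  c⇝ = J₃.join⁺ (J₂.join⁺ (⇝-trans (J₁.join⁺ (⇝-map₁ (OH.⇝-sym (hv-adj a) a~c)))
         (⇝-trans J₁.p⇝q (J₁.join⁺ (⇝-map₂ kv-facing)))))

  module S₄ = Swap _≟⊎_ {P = IsDart⊎} S₃.closed' (proj₂ (proj₂ J₃.joined)) {hd c} {out c} (hv-adj c) (out-dart c)
                (swaps-swapped c (d ∷ b ∷ a ∷ []))
  module P₄ = S₄.Split isDart⊎? c⇝ (hd≢out c c)

  Z : ℕ
  Z = suc (proj₁ J₃.joined)

  F+F₁≡ : F + F₁ ≡ 2 + Z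
  F+F₁≡ = trans (proj₁ (proj₂ J₁.joined)) (cong suc (trans (proj₁ (proj₂ J₂.joined))
            (cong suc (proj₁ (proj₂ J₃.joined)))))

  dot-faces : HasFaces RG Z
  dot-faces = faces S₄.closed' P₄.split

  dot-components : HasComponents G 1
  dot-components = (λ _ → zero) , (λ { zero → join n m (inj₁ (hv a)) , refl })
    , λ u v → (λ _ → star⇒connected G (dot-conn isDot u v)) , λ _ → refl

  dot-is-cubic : Cubic G
  dot-is-cubic = Cubicity.dot-cubic cubicH cubicH' isDot

  dot-planar : Planar G
  -- The 10 replaces a subtraction when the formulas for `H` and `H'` are added: 4 for the two
  -- vertices `x` and `y`, and 6 because `F + F'` is 3 + `Z`.
  dot-planar = RG , Z , 1 , dot-faces , dot-components , ℕₚ.+-cancelˡ-≡ 10 _ _ (begin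
      10 + (2 * (n + m) + 2 * Z + 2 * numIsolated G)
        ≡⟨ cong (λ i → 10 + (2 * (n + m) + 2 * Z + 2 * i)) (numIsolated-cubic G dot-is-cubic) ⟩
      10 + (2 * (n + m) + 2 * Z + 2 * 0) ≡⟨ regroup n m Z ⟩
      2 * n + 2 * suc (suc m) + 2 * (2 + Z) + 2 ≡⟨ cong (λ i → 2 * n + 2 * suc (suc m) + 2 * i + 2) (sym F+F₁≡) ⟩
      2 * n + 2 * suc (suc m) + 2 * (F + F₁) + 2 ≡⟨ regroup' n m F F₁ ⟩
      (2 * n + 2 * F) + (2 * suc (suc m) + 2 * suc F₁)
        ≡⟨ cong (λ i → 2 * n + 2 * F + (2 * suc (suc m) + 2 * i)) (sym F'≡) ⟩
      (2 * n + 2 * F) + (2 * suc (suc m) + 2 * F') ≡⟨ cong₂ _+_ (proj₂ tightH) (proj₂ tightH') ⟩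
      (sumDeg H + 4) + (sumDeg H' + 4)
        ≡⟨ cong₂ (λ i j → i + 4 + (j + 4)) (sumDeg-cubic H cubicH) (sumDeg-cubic H' cubicH') ⟩
      (3 * n + 4) + (3 * suc (suc m) + 4) ≡⟨ regroup'' n m ⟩
      10 + (3 * (n + m) + 4 * 1) ≡⟨ cong (λ i → 10 + (i + 4 * 1)) (sym (sumDeg-cubic G dot-is-cubic)) ⟩
      10 + (sumDeg G + 4 * 1) ∎)
    where
    open ≡-Reasoning
    regroup : ∀ n m z → 10 + (2 * (n + m) + 2 * z + 2 * 0) ≡ 2 * n + 2 * suc (suc m) + 2 * (2 + z) + 2
    regroup = solve-∀
    regroup' : ∀ n m f g → 2 * n + 2 * suc (suc m) + 2 * (f + g) + 2
             ≡ (2 * n + 2 * f) + (2 * suc (suc m) + 2 * suc g)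
    regroup' = solve-∀
    regroup'' : ∀ n m → (3 * n + 4) + (3 * suc (suc m) + 4) ≡ 10 + (3 * (n + m) + 4 * 1)
    regroup'' = solve-∀

-- Walks and cycles

Unique-↭ : ∀ {A : Set} {p q : List A} → p ↭ q → Unique p → Unique q
Unique-↭ r = ↭ₛ.Unique-resp-↭ (setoid _) (↭⇒↭ₛ r)

Unique-++ˡ : ∀ {A : Set} (p : List A) {q} → Unique (p ++ q) → Unique p
Unique-++ˡ [] u = []
Unique-++ˡ (x ∷ p) (a ∷ u) = Allₚ.++⁻ˡ p a ∷ Unique-++ˡ p u

Unique-++ʳ : ∀ {A : Set} (p : List A) {q} → Unique (p ++ q) → Unique q
Unique-++ʳ [] u = u
Unique-++ʳ (x ∷ p) (_ ∷ u) = Unique-++ʳ p u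

Unique-++-≢ : ∀ {A : Set} {p q : List A} → Unique (p ++ q) → ∀ {x y} → x ∈ p → y ∈ q → x ≢ y
Unique-++-≢ {p = _ ∷ p} u (here refl) y∈ refl = Unique[x∷xs]⇒x∉xs u (∈-++⁺ʳ p y∈)
Unique-++-≢ {p = _ ∷ p} (_ ∷ u) (there x∈) y∈ e = Unique-++-≢ u x∈ y∈ e

data Walk {A : Set} (E : A → A → Set) : A → A → List A → Set where
  stop : ∀ u → Walk E u u (u ∷ [])
  _∷_  : ∀ {u v w p} → E u v → Walk E v w p → Walk E u w (u ∷ p)

module _ {A : Set} {E : A → A → Set} where

  walk-start : ∀ {u v p} → Walk E u v p → u ∈ p
  walk-start (stop u) = here refl
  walk-start (_ ∷ _) = here refl

  walk-end : ∀ {u v p} → Walk E u v p → v ∈ p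
  walk-end (stop u) = here refl
  walk-end (_ ∷ w) = there (walk-end w)

  walk-++ : ∀ {u v w z p q} → Walk E u v p → E v w → Walk E w z q → Walk E u z (p ++ q)
  walk-++ (stop u) r x = r ∷ x
  walk-++ (s ∷ w) r x = s ∷ walk-++ w r x

  walk-reverse : (∀ {x y} → E x y → E y x) → ∀ {u v p} → Walk E u v p → Walk E v u (reverse p)
  walk-reverse sy (stop u) = stop u
  walk-reverse sy {u} {v} {_ ∷ p} (r ∷ w) =
    subst (Walk E v u) (sym (unfold-reverse u p)) (walk-++ (walk-reverse sy w) (sy r) (stop u))

  walk-split : ∀ {u z y} p q → Walk E u z (p ++ y ∷ q) → p ≢ []
    → ∃ λ v → Walk E u v p × E v y × Walk E y z (y ∷ q)
  walk-split [] q w ne = ⊥-elim (ne refl)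
  walk-split (x ∷ []) q (r ∷ w@(stop _)) ne = x , stop x , r , w
  walk-split (x ∷ []) q (r ∷ w@(_ ∷ _)) ne = x , stop x , r , w
  walk-split (x ∷ x' ∷ p) q (r ∷ w) ne with walk-split (x' ∷ p) q w (λ ())
  ... | v , w₁ , s , w₂ = v , r ∷ w₁ , s , w₂

  walk-loop : ∀ {u p} → Unique p → Walk E u u p → p ≡ u ∷ []
  walk-loop u (stop _) = refl
  walk-loop u (_ ∷ w) = ⊥-elim (Unique[x∷xs]⇒x∉xs u (walk-end w))

  walk-length : ∀ {u v p} → Walk E u v p → u ≢ v → 2 ≤ length p
  walk-length (stop u) ne = ⊥-elim (ne refl)
  walk-length (_ ∷ stop _) ne = s≤s (s≤s z≤n)
  walk-length (_ ∷ _ ∷ _) ne = s≤s (s≤s z≤n)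

  walk-length₃ : ∀ {u v p} → Walk E u v p → u ≢ v → ¬ E u v → 3 ≤ length p
  walk-length₃ (stop u) ne ¬r = ⊥-elim (ne refl)
  walk-length₃ (r ∷ stop _) ne ¬r = ⊥-elim (¬r r)
  walk-length₃ (_ ∷ _ ∷ w) ne ¬r = s≤s (s≤s (nonempty w))
    where
    nonempty : ∀ {u v p} → Walk E u v p → 1 ≤ length p
    nonempty (stop _) = s≤s z≤n
    nonempty (_ ∷ _) = s≤s z≤n

  path⇒walk : ∀ {p v w} → Linked E p → head p ≡ just v → last p ≡ just w → Walk E v w p
  path⇒walk [-] refl refl = stop _
  path⇒walk (r ∷ l@([-])) refl e = r ∷ path⇒walk l refl e
  path⇒walk (r ∷ l@(_ ∷ _)) refl e = r ∷ path⇒walk l refl e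

  walk⇒linked : ∀ {u v p} → Walk E u v p → Linked E p × head p ≡ just u × last p ≡ just v
  walk⇒linked (stop u) = [-] , refl , refl
  walk⇒linked (r ∷ w@(stop _)) = r ∷ [-] , refl , refl
  walk⇒linked (r ∷ w@(_ ∷ _)) = let (l , _ , e) = walk⇒linked w in r ∷ l , refl , e

walk-map : ∀ {A B : Set} {E : A → A → Set} {E' : B → B → Set} (f : A → B)
  → (∀ {x y} → E x y → E' (f x) (f y)) → ∀ {u v p} → Walk E u v p → Walk E' (f u) (f v) (map f p)
walk-map f h (stop u) = stop (f u)
walk-map f h (r ∷ w) = h r ∷ walk-map f h w

walk-unmap : ∀ {A B : Set} {E : B → B → Set} (f : A → B) p {u v} → Walk E u v (map f p)
  → ∃₂ λ u₀ v₀ → f u₀ ≡ u × f v₀ ≡ v × Walk (λ x y → E (f x) (f y)) u₀ v₀ p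
walk-unmap f (x ∷ []) (stop _) = x , x , refl , refl , stop x
walk-unmap f (x ∷ y ∷ p) (r ∷ w) with walk-unmap f (y ∷ p) w
... | u₀ , v₀ , refl , refl , w'@(stop _) = x , v₀ , refl , refl , r ∷ w'
... | u₀ , v₀ , refl , refl , w'@(_ ∷ _) = x , v₀ , refl , refl , r ∷ w'

Cycle : {A : Set} → (A → A → Set) → List A → Set
Cycle E p = ∃₂ λ u w → Walk E u w p × E w u

cycle⇒isCycle : ∀ {n} (G : Graph n) {p} → Cycle (Adj G) p → Unique p → 3 ≤ length p → IsCycle G p
cycle⇒isCycle G (u , w , x , r) uq l = let (lk , h , e) = walk⇒linked x in uq , l , lk , u , w , h , e , r

isCycle⇒cycle : ∀ {n} (G : Graph n) {p} → IsCycle G p → Cycle (Adj G) p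
isCycle⇒cycle G (_ , _ , lk , u , w , h , e , r) = u , w , path⇒walk lk h e , r

-- From cycles of the dot product to cycles of `H` or `H'`

module Lifting {n m : ℕ} {H : Graph n} {H' : Graph (suc (suc m))} (S : Setting H H') where

  open Dot S

  AdjK : Fin m → Fin m → Set
  AdjK k k' = Adj H' (e k) (e k')

  -- Bounds the crossings: a cycle with more than four of them would use five distinct corners.
  no-fifth : ∀ {l} → Unique l → 5 ≤ length l → ⊥
  no-fifth u le = ℕₚ.1+n≰n (≤-trans le (length-⊆ {ys = corners} u (λ {t} _ → ∈-corners t)))

  data FromJ (h : Fin n) (z : V) (p : List V) : Set where
    stays : ∀ {h' s} → z ≡ inj₁ h' → Walk AdjJ h h' s → p ≡ map inj₁ s → FromJ h z p
    exits : ∀ t {k s q} → Walk AdjJ h (hv t) s → e k ≡ kv t → Walk DotAdj (inj₂ k) z q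
          → p ≡ map inj₁ s ++ q → FromJ h z p

  data FromK (k : Fin m) (z : V) (p : List V) : Set where
    stays : ∀ {k' s} → z ≡ inj₂ k' → Walk AdjK k k' s → p ≡ map inj₂ s → FromK k z p
    exits : ∀ t {k' s q} → Walk AdjK k k' s → e k' ≡ kv t → Walk DotAdj (inj₁ (hv t)) z q
          → p ≡ map inj₂ s ++ q → FromK k z p

  fromJ : ∀ {h z p} → Walk DotAdj (inj₁ h) z p → FromJ h z p
  fromJ (stop _) = stays refl (stop _) refl
  fromJ (jk t refl q ∷ w) = exits t (stop _) q w refl
  fromJ (jj r ∷ w) with fromJ w
  ... | stays refl x refl = stays refl (r ∷ x) refl
  ... | exits t x q w' refl = exits t (r ∷ x) q w' refl

  fromK : ∀ {k z p} → Walk DotAdj (inj₂ k) z p → FromK k z p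
  fromK (stop _) = stays refl (stop _) refl
  fromK (kj t refl q ∷ w) = exits t (stop _) q w refl
  fromK (kk r ∷ w) with fromK w
  ... | stays refl x refl = stays refl (r ∷ x) refl
  ... | exits t x q w' refl = exits t (r ∷ x) q w' refl

  -- In the case in-H', the vertices of L make up for the added x and y when
  -- lengths are compared.
  data Lifted (p : List V) : Set where
    in-H  : ∀ L R → p ↭ map inj₁ L ++ map inj₂ R → Cycle (Adj H) L → 3 ≤ length L → Lifted p
    in-H' : ∀ L R q → p ↭ map inj₁ L ++ map inj₂ R → Cycle (Adj H') q
          → q ↭ hub true ∷ hub false ∷ map e R → 2 ≤ length L → 1 ≤ length R → Lifted p
    in-J' : ∀ R → p ↭ map inj₂ R → Cycle (Adj H') (map e R) → Lifted p

  lifted-↭ : ∀ {p q} → p ↭ q → Lifted q → Lifted p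
  lifted-↭ r (in-H L R s c l) = in-H L R (↭-trans r s) c l
  lifted-↭ r (in-H' L R x s c s' l l') = in-H' L R x (↭-trans r s) c s' l l'
  lifted-↭ r (in-J' R s c) = in-J' R (↭-trans r s) c

  same-hub : ∀ {s t} → side s ≡ side t → Adj H' (hub (side s)) (kv t)
  same-hub {t = t} refl = kv-adj t

  kv-hub : ∀ t → Adj H' (kv t) (hub (side t))
  kv-hub t = Adj-sym H' (kv-adj t)

  walk-H : ∀ {u v p} → Walk AdjJ u v p → Walk (Adj H) u v p
  walk-H w = subst (Walk (Adj H) _ _) (map-id _) (walk-map id proj₁ w)

  walk-H' : ∀ {s t k k' p} → e k ≡ kv s → e k' ≡ kv t → Walk AdjK k k' p → Walk (Adj H') (kv s) (kv t) (map e p)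
  walk-H' refl₁ refl₂ w = subst₂ (λ u v → Walk (Adj H') u v _) refl₁ refl₂ (walk-map e id w)

  hubs-↭ : ∀ {s t} {xs : List (Fin (suc (suc m)))} → side s ≢ side t
    → hub (side s) ∷ hub (side t) ∷ xs ↭ hub true ∷ hub false ∷ xs
  hubs-↭ {true , _} {true , _} ne = ⊥-elim (ne refl)
  hubs-↭ {true , _} {false , _} ne = ↭-refl
  hubs-↭ {false , _} {true , _} ne = swap _ _ ↭-refl
  hubs-↭ {false , _} {false , _} ne = ⊥-elim (ne refl)

  -- The direct edge is missing in `J`. Hence the removed edge closes such a path to a genuine
  -- cycle.
  cut-length : ∀ t {s} → Walk AdjJ (hv t) (hv (mate t)) s → 3 ≤ length s
  cut-length t w = walk-length₃ w (λ q → mate≢ t (sym (hv-inj q))) λ r → proj₂ r (t , refl , refl)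

  nonempty : ∀ {A : Set} {x : A} {xs} → x ∈ xs → 1 ≤ length xs
  nonempty {xs = _ ∷ _} _ = s≤s z≤n

  merge-↭ : ∀ S₁ T₁ S₂ T₂ → map inj₁ S₁ ++ map inj₂ T₁ ++ map inj₁ S₂ ++ map inj₂ T₂
    ↭ map (inj₁ {B = Fin m}) (S₁ ++ S₂) ++ map (inj₂ {A = Fin n}) (T₁ ++ T₂)
  merge-↭ S₁ T₁ S₂ T₂ = ↭-trans (++⁺ˡ (map inj₁ S₁) (shifts (map inj₂ T₁) (map inj₁ S₂)))
    (↭-reflexive (trans (sym (++-assoc (map inj₁ S₁) (map inj₁ S₂) _))
      (sym (cong₂ _++_ (map-++ inj₁ S₁ S₂) (map-++ inj₂ T₁ T₂)))))

  -- A segment of `J` between the ends of a removed edge is closed by that edge. Otherwise both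
  -- segments run from one side to the other, and the one in `J'` is closed through `x` and `y`; the
  -- segment of `J` has at least two vertices to pay for them.
  two-segments : ∀ {t t' k k' s r} → e k ≡ kv t → Walk AdjJ (hv t) (hv t') s → e k' ≡ kv t'
    → Walk AdjK k' k r → t ≢ t' → Lifted (map inj₁ s ++ map inj₂ r)
  two-segments {t} {t'} {s = s} {r} kt x kt' y t≢t' with t' ≟ᶜ mate t
  ... | yes refl = in-H s r ↭-refl (hv t , hv (mate t) , walk-H x , Adj-sym H (hv-adj t)) (cut-length t x)
  ... | no t'≢ = in-H' s r (map e r ++ hub (side t) ∷ hub (side t') ∷ []) ↭-refl
        (kv t' , hub (side t')
          , walk-++ (walk-H' kt' kt y) (kv-hub t) (hubs-adj ∷ stop _)
          , kv-adj t')
        (↭-trans (++-comm (map e r) _) (hubs-↭ {t} {t'} sides))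
        (walk-length x (t≢t' ∘ hv-inj)) (nonempty (walk-start y))
    where
    sides : side t ≢ side t'
    sides q with same-side {t'} {t} (sym q)
    ... | inj₁ z = t≢t' (sym z)
    ... | inj₂ z = t'≢ z
    hubs-adj : Adj H' (hub (side t)) (hub (side t'))
    hubs-adj = hubs-adj' sides
      where
      hubs-adj' : ∀ {a b} → a ≢ b → Adj H' (hub a) (hub b)
      hubs-adj' {true} {true} ne = ⊥-elim (ne refl)
      hubs-adj' {true} {false} ne = hub-adj true
      hubs-adj' {false} {true} ne = hub-adj false
      hubs-adj' {false} {false} ne = ⊥-elim (ne refl)

  -- All four corners occur. If the segments of `J` run from `a` to `b` and from `c` to `d`, closing
  -- them in `H` would give two cycles; instead both segments of `J'` run between the sides and are
  -- linked by `x` and `y`. Otherwise `ab` and `cd` link the segments of `J` into one cycle, the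
  -- second one reversed if it starts at the mate of `t`.
  four-segments : ∀ {t t₁ t₂ t₃ k k₁ k₂ k₃ S₁ T₁ S₂ T₂} → Unique (t ∷ t₁ ∷ t₂ ∷ t₃ ∷ [])
    → Walk AdjJ (hv t) (hv t₁) S₁ → e k₁ ≡ kv t₁ → Walk AdjK k₁ k₂ T₁ → e k₂ ≡ kv t₂
    → Walk AdjJ (hv t₂) (hv t₃) S₂ → e k₃ ≡ kv t₃ → Walk AdjK k₃ k T₂ → e k ≡ kv t
    → Lifted (map inj₁ S₁ ++ map inj₂ T₁ ++ map inj₁ S₂ ++ map inj₂ T₂)
  four-segments {t} {t₁} {t₂} {t₃} {S₁ = S₁} {T₁} {S₂} {T₂} uq@((n1 ∷ n2 ∷ n3 ∷ _) ∷ (n4 ∷ n5 ∷ _) ∷ (n6 ∷ _) ∷ _)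
    x k₁t y k₂t z k₃t w kt = go (mate-cases t)
    where
    all-four : ∀ s → s ∈ t ∷ t₁ ∷ t₂ ∷ t₃ ∷ []
    all-four s with s ≟ᶜ t | s ≟ᶜ t₁ | s ≟ᶜ t₂ | s ≟ᶜ t₃
    ... | yes p | _ | _ | _ = here p
    ... | no _ | yes p | _ | _ = there (here p)
    ... | no _ | no _ | yes p | _ = there (there (here p))
    ... | no _ | no _ | no _ | yes p = there (there (there (here p)))
    ... | no a | no b | no c | no d = ⊥-elim (no-fifth ((a ∷ b ∷ c ∷ d ∷ []) ∷ uq) (s≤s (s≤s (s≤s (s≤s (s≤s z≤n))))))
    mate-cases : ∀ s → mate s ≡ t ⊎ mate s ≡ t₁ ⊎ mate s ≡ t₂ ⊎ mate s ≡ t₃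
    mate-cases s with all-four (mate s)
    ... | here p = inj₁ p
    ... | there (here p) = inj₂ (inj₁ p)
    ... | there (there (here p)) = inj₂ (inj₂ (inj₁ p))
    ... | there (there (there (here p))) = inj₂ (inj₂ (inj₂ p))
    mate-flip : ∀ {a b} → mate a ≡ b → mate b ≡ a
    mate-flip refl = mate-involutive _
    mated : ∀ {a b} → mate a ≡ b → Adj H (hv a) (hv b)
    mated refl = hv-adj _
    long : ∀ (a b : List (Fin n)) → 2 ≤ length a → 2 ≤ length b → 3 ≤ length (a ++ b)
    long a b p q = subst (3 ≤_) (sym (length-++ a)) (≤-trans (ℕₚ.n≤1+n 3) (ℕₚ.+-mono-≤ p q))
    len₁ : 2 ≤ length S₁
    len₁ = walk-length x (n1 ∘ hv-inj)
    len₂ : 2 ≤ length S₂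
    len₂ = walk-length z (n6 ∘ hv-inj)
    Result : Set
    Result = Lifted (map inj₁ S₁ ++ map inj₂ T₁ ++ map inj₁ S₂ ++ map inj₂ T₂)
    go : mate t ≡ t ⊎ mate t ≡ t₁ ⊎ mate t ≡ t₂ ⊎ mate t ≡ t₃ → Result
    go (inj₁ p) = ⊥-elim (mate≢ t p)
    go (inj₂ (inj₁ refl)) = in-H' (S₁ ++ S₂) (T₁ ++ T₂)
        (map e T₁ ++ hub (side t₂) ∷ map e T₂ ++ hub (side t) ∷ []) (merge-↭ S₁ T₁ S₂ T₂)
        (kv t₁ , hub (side t)
          , walk-++ (walk-H' k₁t k₂t y) (kv-hub t₂) (same-hub {t₂} {t₃} side₂₃ ∷ walk-++ (walk-H' k₃t kt w) (kv-hub t) (stop _))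
          , same-hub {t} {t₁} refl)
        perm (≤-trans (ℕₚ.n≤1+n 2) (long S₁ S₂ len₁ len₂))
        (subst (1 ≤_) (sym (length-++ T₁)) (≤-trans (nonempty (walk-start y)) (ℕₚ.m≤m+n _ _)))
      where
      sides : side t ≢ side t₂
      sides q with same-side {t₂} {t} (sym q)
      ... | inj₁ p = n2 (sym p)
      ... | inj₂ p = n4 (sym p)
      side₂₃ : side t₂ ≡ side t₃
      side₂₃ with mate-cases t₂
      ... | inj₁ p = ⊥-elim (n4 (mate-flip p))
      ... | inj₂ (inj₁ p) = ⊥-elim (n2 (trans (sym (mate-involutive t)) (mate-flip p)))
      ... | inj₂ (inj₂ (inj₁ p)) = ⊥-elim (mate≢ t₂ p)
      ... | inj₂ (inj₂ (inj₂ refl)) = refl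
      perm : map e T₁ ++ hub (side t₂) ∷ map e T₂ ++ hub (side t) ∷ [] ↭ hub true ∷ hub false ∷ map e (T₁ ++ T₂)
      perm = ↭-trans (shifts (map e T₁) (hub (side t₂) ∷ []))
        (↭-trans (prep _ (↭-trans (↭-reflexive (sym (++-assoc (map e T₁) (map e T₂) _)))
          (↭-trans (++-comm (map e T₁ ++ map e T₂) _) (prep _ (↭-reflexive (sym (map-++ e T₁ T₂)))))))
        (hubs-↭ {t₂} {t} (sides ∘ sym)))
    go (inj₂ (inj₂ (inj₁ refl))) = in-H (S₁ ++ reverse S₂) (T₁ ++ T₂)
        (↭-trans (merge-↭ S₁ T₁ S₂ T₂) (++⁺ʳ _ (map⁺ inj₁ (++⁺ˡ S₁ (↭-sym (↭-reverse S₂))))))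
        (hv t , hv t₂ , walk-++ (walk-H x) (mated mate₁₃) (walk-reverse (Adj-sym H) (walk-H z)) , Adj-sym H (hv-adj t))
        (subst (3 ≤_) (↭-length (++⁺ˡ S₁ (↭-sym (↭-reverse S₂)))) (long S₁ S₂ len₁ len₂))
      where
      mate₁₃ : mate t₁ ≡ t₃
      mate₁₃ with mate-cases t₁
      ... | inj₁ p = ⊥-elim (n4 (trans (sym (mate-involutive t₁)) (cong mate p)))
      ... | inj₂ (inj₁ p) = ⊥-elim (mate≢ t₁ p)
      ... | inj₂ (inj₂ (inj₁ p)) = ⊥-elim (n1 (trans (sym (mate-involutive t)) (mate-flip p)))
      ... | inj₂ (inj₂ (inj₂ p)) = p
    go (inj₂ (inj₂ (inj₂ refl))) = in-H (S₁ ++ S₂) (T₁ ++ T₂) (merge-↭ S₁ T₁ S₂ T₂)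
        (hv t , hv t₃ , walk-++ (walk-H x) (mated mate₁₂) (walk-H z) , Adj-sym H (hv-adj t))
        (long S₁ S₂ len₁ len₂)
      where
      mate₁₂ : mate t₁ ≡ t₂
      mate₁₂ with mate-cases t₁
      ... | inj₁ p = ⊥-elim (n5 (trans (sym (mate-involutive t₁)) (cong mate p)))
      ... | inj₂ (inj₁ p) = ⊥-elim (mate≢ t₁ p)
      ... | inj₂ (inj₂ (inj₁ p)) = p
      ... | inj₂ (inj₂ (inj₂ p)) = ⊥-elim (n1 (trans (sym (mate-involutive t)) (mate-flip p)))

  hv-sep : ∀ {s t} (p : List V) {q} → Unique (p ++ q) → inj₁ (hv s) ∈ p → inj₁ (hv t) ∈ q → s ≢ t
  hv-sep p u x y refl = Unique-++-≢ u x y refl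

  kv-sep : ∀ {s t k k'} (p : List V) {q} → Unique (p ++ q) → e k ≡ kv s → e k' ≡ kv t
    → inj₂ k ∈ p → inj₂ k' ∈ q → s ≢ t
  kv-sep p u ks kt x y refl = Unique-++-≢ u x y (cong inj₂ (e-inj (trans ks (sym kt))))

  -- The closing edge is a cross edge, so segments of `J` and `J'` alternate from the start to the
  -- end. That the corners differ follows from the distinctness of the vertices at the ends of the
  -- segments.
  lift-crossing : ∀ {t k p} → Walk DotAdj (inj₁ (hv t)) (inj₂ k) p → e k ≡ kv t
    → Unique p → 3 ≤ length p → Lifted p
  lift-crossing {t} w kt u len with fromJ w
  ... | stays () _ _
  ... | exits t₁ {k₁} {S₁} x k₁t w₁ refl with fromK w₁
  ... | stays {s = T₁} refl y refl = two-segments kt x k₁t y t≢t₁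
    where
    t≢t₁ : t ≢ t₁
    -- Otherwise both segments are single vertices, and the cycle would only run back and forth
    -- along one cross edge.
    t≢t₁ q = ℕₚ.1+n≰n (subst (3 ≤_)
        (cong₂ (λ s r → length (map (inj₁ {B = Fin m}) s ++ map inj₂ r)) S₁-single T₁-single) len)
      where
      S₁-single : S₁ ≡ hv t ∷ []
      S₁-single = walk-loop (Uniqueₚ.map⁻ (Unique-++ˡ (map inj₁ S₁) u))
        (subst (λ z → Walk AdjJ (hv t) (hv z) S₁) (sym q) x)
      T₁-single : T₁ ≡ k₁ ∷ []
      T₁-single = walk-loop (Uniqueₚ.map⁻ (Unique-++ʳ (map inj₁ S₁) u))
        (subst (λ z → Walk AdjK k₁ z T₁) (e-inj (trans kt (trans (cong kv q) (sym k₁t)))) y)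
  lift-crossing {t} w kt u len | exits t₁ {k₁} {S₁} x k₁t w₁ refl | exits t₂ {k₂} {T₁} y k₂t w₂ refl with fromJ w₂
  ... | stays () _ _
  ... | exits t₃ {k₃} {S₂} z k₃t w₃ refl with fromK w₃
  ... | stays {s = T₂} refl v refl = four-segments
          ((t≢t₁ ∷ hv-sep (map inj₁ S₁) u (inJ (walk-start x)) (J₂ (walk-start z)) ∷ hv-sep (map inj₁ S₁) u (inJ (walk-start x)) (J₂ (walk-end z)) ∷ [])
          ∷ (hv-sep (map inj₁ S₁) u (inJ (walk-end x)) (J₂ (walk-start z)) ∷ hv-sep (map inj₁ S₁) u (inJ (walk-end x)) (J₂ (walk-end z)) ∷ [])
          ∷ (t₂≢t₃ ∷ []) ∷ [] ∷ [])
          x k₁t y k₂t z k₃t v kt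
    where
    u' : Unique (map inj₂ T₁ ++ map inj₁ S₂ ++ map inj₂ T₂)
    u' = Unique-++ʳ (map inj₁ S₁) u
    inJ : ∀ {h s} → h ∈ s → inj₁ h ∈ map inj₁ s
    inJ = ∈-map⁺ inj₁
    J₂ : ∀ {h} → h ∈ S₂ → inj₁ h ∈ map inj₂ T₁ ++ map inj₁ S₂ ++ map inj₂ T₂
    J₂ p = ∈-++⁺ʳ (map inj₂ T₁) (∈-++⁺ˡ (inJ p))
    t≢t₁ : t ≢ t₁
    t≢t₁ q = kv-sep (map inj₂ T₁) u' k₁t kt (∈-map⁺ inj₂ (walk-start y)) (∈-++⁺ʳ (map inj₁ S₂) (∈-map⁺ inj₂ (walk-end v))) (sym q)
    t₂≢t₃ : t₂ ≢ t₃
    t₂≢t₃ = kv-sep (map inj₂ T₁) u' k₂t k₃t (∈-map⁺ inj₂ (walk-end y)) (∈-++⁺ʳ (map inj₁ S₂) (∈-map⁺ inj₂ (walk-start v)))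
  lift-crossing {t} w kt u len | exits t₁ {k₁} {S₁} x k₁t w₁ refl | exits t₂ {k₂} {T₁} y k₂t w₂ refl
    | exits t₃ {k₃} {S₂} z k₃t w₃ refl | exits t₄ {k₄} {T₂} {q} v k₄t w₄ refl = ⊥-elim (no-fifth
        ((t≢t₁ ∷ hv-sep (map inj₁ S₁) u (inJ (walk-start x)) (J₂ (walk-start z)) ∷ hv-sep (map inj₁ S₁) u (inJ (walk-start x)) (J₂ (walk-end z))
            ∷ hv-sep (map inj₁ S₁) u (inJ (walk-start x)) J₄ ∷ [])
        ∷ (hv-sep (map inj₁ S₁) u (inJ (walk-end x)) (J₂ (walk-start z)) ∷ hv-sep (map inj₁ S₁) u (inJ (walk-end x)) (J₂ (walk-end z))
            ∷ hv-sep (map inj₁ S₁) u (inJ (walk-end x)) J₄ ∷ [])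
        ∷ (t₂≢t₃ ∷ hv-sep (map inj₁ S₂) u'' (inJ (walk-start z)) (∈-++⁺ʳ (map inj₂ T₂) (walk-start w₄)) ∷ [])
        ∷ (hv-sep (map inj₁ S₂) u'' (inJ (walk-end z)) (∈-++⁺ʳ (map inj₂ T₂) (walk-start w₄)) ∷ []) ∷ [] ∷ [])
        (s≤s (s≤s (s≤s (s≤s (s≤s z≤n))))))
    where
    u' : Unique (map inj₂ T₁ ++ map inj₁ S₂ ++ map inj₂ T₂ ++ q)
    u' = Unique-++ʳ (map inj₁ S₁) u
    u'' : Unique (map inj₁ S₂ ++ map inj₂ T₂ ++ q)
    u'' = Unique-++ʳ (map inj₂ T₁) u'
    inJ : ∀ {h s} → h ∈ s → inj₁ h ∈ map inj₁ s
    inJ = ∈-map⁺ inj₁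
    J₂ : ∀ {h} → h ∈ S₂ → inj₁ h ∈ map inj₂ T₁ ++ map inj₁ S₂ ++ map inj₂ T₂ ++ q
    J₂ p = ∈-++⁺ʳ (map inj₂ T₁) (∈-++⁺ˡ (inJ p))
    J₄ : inj₁ (hv t₄) ∈ map inj₂ T₁ ++ map inj₁ S₂ ++ map inj₂ T₂ ++ q
    J₄ = ∈-++⁺ʳ (map inj₂ T₁) (∈-++⁺ʳ (map inj₁ S₂) (∈-++⁺ʳ (map inj₂ T₂) (walk-start w₄)))
    t≢t₁ : t ≢ t₁
    t≢t₁ r = kv-sep (map inj₂ T₁) u' k₁t kt (∈-map⁺ inj₂ (walk-start y))
      (∈-++⁺ʳ (map inj₁ S₂) (∈-++⁺ʳ (map inj₂ T₂) (walk-end w₄))) (sym r)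
    t₂≢t₃ : t₂ ≢ t₃
    t₂≢t₃ = kv-sep (map inj₂ T₁) u' k₂t k₃t (∈-map⁺ inj₂ (walk-end y)) (∈-++⁺ʳ (map inj₁ S₂) (∈-++⁺ˡ (∈-map⁺ inj₂ (walk-start v))))

  rotated : ∀ {t k p q} → Walk DotAdj (inj₁ (hv t)) (inj₂ k) p → e k ≡ kv t → q ↭ p
    → Unique q → 3 ≤ length q → Lifted q
  rotated w kt r u len = lifted-↭ r (lift-crossing w kt (Unique-↭ r u) (subst (3 ≤_) (↭-length r) len))

  -- A cycle that meets the cut is rotated until its closing edge is a cross edge from `J'` to `J`;
  -- any other lies within `J` or `J'`.
  lift : ∀ {p} → Cycle DotAdj p → Unique p → 3 ≤ length p → Lifted p
  lift (inj₁ h , z , w , r) u len with fromJ w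
  lift (inj₁ h , _ , w , jj r) u len | stays {s = s} refl x refl =
    in-H s [] (↭-reflexive (sym (++-identityʳ _))) (_ , _ , walk-H x , proj₁ r) (subst (3 ≤_) (length-map inj₁ s) len)
  ... | exits t x kt w₁ refl with fromK w₁
  lift (inj₁ h , _ , w , kj t' refl k't) u len | exits t x kt w₁ refl | stays refl y refl =
    lift-crossing w k't u len
  ... | exits t₁ {k₁} {T} {q} y k₁t w₂ refl =
    rotated (walk-++ w₂ r (walk-++ (walk-map inj₁ jj x) (jk t refl kt) (walk-map inj₂ kk y))) k₁t
      (↭-trans (↭-reflexive (sym (++-assoc (map inj₁ _) (map inj₂ T) q))) (++-comm (map inj₁ _ ++ map inj₂ T) q)) u len
  lift (inj₂ k , z , w , r) u len with fromK w
  lift (inj₂ k , _ , w , kk r) u len | stays {s = s} refl y refl =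
    in-J' s ↭-refl (_ , _ , walk-map e id y , r)
  ... | exits t {s = T} {q} y kt w₁ refl =
    rotated (walk-++ w₁ r (walk-map inj₂ kk y)) kt (++-comm (map inj₂ T) q) u len

-- Hamiltonian cycles of vertex-deleted graphs

map-image : ∀ {A B : Set} (f : A → B) q → (∀ {x} → x ∈ q → ∃ λ y → f y ≡ x) → ∃ λ p → map f p ≡ q
map-image f [] h = [] , refl
map-image f (x ∷ q) h with h (here refl) | map-image f q (h ∘ there)
... | y , refl | p , refl = y ∷ p , refl

walk-star : ∀ {A : Set} {E : A → A → Set} {u v p} → Walk E u v p → ∀ {x} → x ∈ p → Star E u x
walk-star (stop u) (here refl) = ε
walk-star (r ∷ w) (here refl) = ε
walk-star (r ∷ w) (there x∈) = r ◅ walk-star w x∈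

cycle-at : ∀ {A : Set} {E : A → A → Set} {p x} → Cycle E p → x ∈ p
  → ∃ λ q → Cycle E (x ∷ q) × p ↭ x ∷ q
cycle-at (u , w , c , r) x∈ with ∈-∃++ x∈
cycle-at (u , w , c@(stop _) , r) x∈ | [] , b , refl = b , (_ , _ , c , r) , ↭-refl
cycle-at (u , w , c@(_ ∷ _) , r) x∈ | [] , b , refl = b , (_ , _ , c , r) , ↭-refl
cycle-at (u , w , c , r) x∈ | a@(_ ∷ _) , b , refl with walk-split a b c (λ ())
... | v , c₁ , s , c₂ = b ++ a , (_ , v , walk-++ c₂ r c₁ , s) , ++-comm a _

SpansAllBut : ∀ {A : Set} → A → List A → Set
SpansAllBut v p = ¬ v ∈ p × (∀ u → u ≢ v → u ∈ p)

hamiltonian-─⁻ : ∀ {n} (G : Graph (suc n)) v → Hamiltonian (G ─ v)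
  → ∃ λ p → Cycle (Adj G) p × Unique p × 3 ≤ length p × SpansAllBut v p
hamiltonian-─⁻ G v (p , c , span) with isCycle⇒cycle (G ─ v) c
... | _ , _ , w , r = map (punchIn v) p , (_ , _ , walk-map (punchIn v) id w , r)
      , Uniqueₚ.map⁺ (punchIn-injective v _ _) (proj₁ c)
      , subst (3 ≤_) (sym (length-map _ p)) (proj₁ (proj₂ c)) , v∉ , span'
  where
  v∉ : ¬ v ∈ map (punchIn v) p
  v∉ v∈ with ∈-map⁻ (punchIn v) v∈
  ... | i , _ , e = punchInᵢ≢i v i (sym e)
  span' : ∀ u → u ≢ v → u ∈ map (punchIn v) p
  span' u ne = subst (_∈ map (punchIn v) p) (punchIn-punchOut (ne ∘ sym)) (∈-map⁺ _ (span (punchOut (ne ∘ sym))))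

hamiltonian-─⁺ : ∀ {n} (G : Graph (suc n)) v p → Cycle (Adj G) p → Unique p → 3 ≤ length p
  → SpansAllBut v p → Hamiltonian (G ─ v)
hamiltonian-─⁺ G v p c u len (v∉ , span)
  with map-image (punchIn v) p (λ {x} x∈ → punchOut (λ e → v∉ (subst (_∈ p) (sym e) x∈)) , punchIn-punchOut _)
hamiltonian-─⁺ G v _ (_ , _ , w , r) u len (v∉ , span) | q , refl with walk-unmap (punchIn v) q w
... | u₀ , v₀ , refl , refl , w' = q
    , cycle⇒isCycle (G ─ v) (u₀ , v₀ , w' , r) (Uniqueₚ.map⁻ u) (subst (3 ≤_) (length-map _ q) len)
    , λ x → span' x
  where
  span' : ∀ x → x ∈ q
  span' x with ∈-map⁻ (punchIn v) (span (punchIn v x) (punchInᵢ≢i v x))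
  ... | y , y∈ , e = subst (_∈ q) (sym (punchIn-injective v _ _ e)) y∈

-- Hamiltonian cycles of the vertex-deleted dot product

module Gluing {n m : ℕ} {H : Graph (suc n)} {H' : Graph (suc (suc m))} (S : Setting H H')
  {G : Graph (suc n + m)} (isDot : Dot.IsDot S G) where

  open Dot S
  open IsDot isDot
  open Lifting S using (AdjK; merge-↭)

  ∈-inj₁⁻ : ∀ L {R : List (Fin m)} {h : Fin (suc n)} → inj₁ h ∈ map inj₁ L ++ map inj₂ R → h ∈ L
  ∈-inj₁⁻ L x with ∈-++⁻ (map inj₁ L) x
  ... | inj₁ y with ∈-map⁻ inj₁ y
  ... | _ , z , refl = z
  ∈-inj₁⁻ L x | inj₂ y with ∈-map⁻ inj₂ y
  ... | _ , _ , ()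

  ∈-inj₂⁻ : ∀ (L : List (Fin (suc n))) {R : List (Fin m)} {k} → inj₂ k ∈ map inj₁ L ++ map inj₂ R → k ∈ R
  ∈-inj₂⁻ L x with ∈-++⁻ (map inj₁ L) x
  ... | inj₂ y with ∈-map⁻ inj₂ y
  ... | _ , z , refl = z
  ∈-inj₂⁻ L x | inj₁ y with ∈-map⁻ inj₁ y
  ... | _ , _ , ()

  unique-⊎ : ∀ {L : List (Fin (suc n))} {R : List (Fin m)} → Unique L → Unique R → Unique (map inj₁ L ++ map inj₂ R)
  unique-⊎ uL uR = Uniqueₚ.++⁺ (Uniqueₚ.map⁺ inj₁-injective uL) (Uniqueₚ.map⁺ inj₂-injective uR) disj
    where
    disj : ∀ {v} → v ∈ map inj₁ _ × v ∈ map inj₂ _ → ⊥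
    disj (x , y) with ∈-map⁻ inj₁ x
    ... | _ , _ , refl with ∈-map⁻ inj₂ y
    ... | _ , _ , ()

  finish : ∀ v {p L R} → Cycle DotAdj p → p ↭ map inj₁ L ++ map inj₂ R → Unique L → Unique R
    → SpansAllBut v (map inj₁ L ++ map inj₂ R) → Hamiltonian (G ─ join (suc n) m v)
  finish v {p} {L} {R} (_ , _ , w , r) perm uL uR (v∉ , span) =
    hamiltonian-─⁺ G (j v) (map j p) (_ , _ , walk-map j from w , from r)
      (Uniqueₚ.map⁺ (join-injective (suc n) m) (Unique-↭ (↭-sym perm) (unique-⊎ uL uR)))
      (subst (3 ≤_) (sym (length-map j p)) long)
      (v∉' , span')
    where
    j : V → Fin (suc n + m)
    j = join (suc n) m
    in-p : ∀ u → u ≢ v → u ∈ p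
    in-p u ne = ∈-resp-↭ (↭-sym perm) (span u ne)
    v∉' : ¬ j v ∈ map j p
    v∉' x with ∈-map⁻ j x
    ... | u , y , e with join-injective (suc n) m {v} {u} e
    ... | refl = v∉ (∈-resp-↭ perm y)
    span' : ∀ i → i ≢ j v → i ∈ map j p
    span' i ne = subst (_∈ map j p) (join-splitAt (suc n) m i)
      (∈-map⁺ j (in-p (splitAt (suc n) i) λ e → ne (trans (sym (join-splitAt (suc n) m i)) (cong j e))))
    _≟ⱽ_ : (u v : V) → Dec (u ≡ v)
    _≟ⱽ_ = ⊎-≡-dec _≟_ _≟_
    cornersV : List V
    cornersV = map (inj₁ ∘ hv) corners
    -- Of the four distinct vertices `hv t`, at most one is `v`; the others lie on `p`.
    long : 3 ≤ length p
    long = ℕₚ.≤-pred (length-⊆ {xs = cornersV} {ys = v ∷ p}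
      (Uniqueₚ.map⁺ (hv-inj ∘ inj₁-injective) corners-unique) sub)
      where
      sub : ∀ {u} → u ∈ cornersV → u ∈ v ∷ p
      sub {u} _ with u ≟ⱽ v
      ... | yes e = here e
      ... | no ne = there (in-p u ne)

  glue : ∀ {s t k k' P T} → Walk AdjJ (hv s) (hv t) P → e k ≡ kv t → Walk AdjK k k' T → e k' ≡ kv s
    → Cycle DotAdj (map inj₁ P ++ map inj₂ T)
  glue {s} {t} x kt y ks = _ , _ , walk-++ (walk-map inj₁ jj x) (jk t refl kt) (walk-map inj₂ kk y) , kj s refl ks

  glue₂ : ∀ {s t s' t' k k₁ k₂ k₃ P T Q T'} → Walk AdjJ (hv s) (hv t) P → e k ≡ kv t → Walk AdjK k k₁ T → e k₁ ≡ kv s'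
    → Walk AdjJ (hv s') (hv t') Q → e k₂ ≡ kv t' → Walk AdjK k₂ k₃ T' → e k₃ ≡ kv s
    → Cycle DotAdj (map inj₁ P ++ map inj₂ T ++ map inj₁ Q ++ map inj₂ T')
  glue₂ {s} {t} {s'} {t'} x kt y ks' z kt' w ks = _ , _
    , walk-++ (walk-map inj₁ jj x) (jk t refl kt) (walk-++ (walk-map inj₂ kk y) (kj s' refl ks')
        (walk-++ (walk-map inj₁ jj z) (jk t' refl kt') (walk-map inj₂ kk w)))
    , kj s refl ks

  module _
    (goodJ : ∀ i j → ∃ λ p → Unique p × (∀ h → h ∈ p) × Walk AdjJ (hv (true , i)) (hv (false , j)) p)
    (twoJ : ∀ i j → ∃₂ λ p q → Unique (p ++ q) × (∀ h → h ∈ p ++ q)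
        × Walk AdjJ (hv (true , i)) (hv (true , not i)) p × Walk AdjJ (hv (false , j)) (hv (false , not j)) q)
    (delJ : ∀ h → ∃ λ s → ∃ λ p → Unique p × SpansAllBut h p × Walk AdjJ (hv (s , true)) (hv (s , false)) p)
    (hypoH' : ∀ v → ∃ λ p → Cycle (Adj H') p × Unique p × 3 ≤ length p × SpansAllBut v p) where

    conn-J : ∀ u v → Star AdjJ u v
    conn-J u v = let (p , _ , cover , w) = goodJ true true in
      Star.reverse AdjJ-sym (walk-star w (cover u)) ◅◅ walk-star w (cover v)

    unmap-e : ∀ q → (∀ {v} → v ∈ q → ∀ s → v ≢ hub s) → ∃ λ T → map e T ≡ q
    unmap-e q f = map-image e q λ x → e-onto (f x)

    ∈-unmap : ∀ {k T} → e k ∈ map e T → k ∈ T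
    ∈-unmap x with ∈-map⁻ e x
    ... | k' , y , eq with e-inj eq
    ... | refl = y

    cyc-split : ∀ {x q} → Cycle (Adj H') (x ∷ q) → 3 ≤ length (x ∷ q)
      → ∃₂ λ u w → Adj H' x u × Walk (Adj H') u w q × Adj H' w x
    cyc-split (_ , w , stop _ , r) (s≤s ())
    cyc-split (_ , w , s ∷ c , r) _ = _ , w , s , c , r

    ends≢ : ∀ {u w q} → Unique q → 2 ≤ length q → Walk (Adj H') u w q → u ≢ w
    ends≢ uq len c refl with walk-loop uq c
    ends≢ uq (s≤s ()) c refl | refl

    not-≢ : ∀ {i j} → i ≢ j → j ≡ not i
    not-≢ {true} {true} ne = ⊥-elim (ne refl)
    not-≢ {true} {false} ne = refl
    not-≢ {false} {true} ne = refl
    not-≢ {false} {false} ne = ⊥-elim (ne refl)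

    -- Once the other hub is deleted, `hub s` has only the two neighbours `kv (s , i)`. A
    -- hamiltonian cycle passes from one to the other through `hub s`; taking the hub out leaves the
    -- path.
    spanning-J' : ∀ s → ∃ λ T₀ → Unique T₀ × (∀ k → k ∈ T₀)
      × ∃₂ λ k k' → e k ≡ kv (s , true) × e k' ≡ kv (s , false) × Walk AdjK k k' T₀
    spanning-J' s with hypoH' (hub (not s))
    ... | p , c , up , len , y∉ , span with cycle-at c (span (hub s) (λ q → adj⇒≢ H' (hub-adj s) q))
    ... | q , c' , perm with cyc-split c' (subst (3 ≤_) (↭-length perm) len)
    ... | u , w , r , x , r' = orient (hub-nbr s r) (hub-nbr s (Adj-sym H' r'))
      where
      uxq : Unique (hub s ∷ q)
      uxq = Unique-↭ perm up
      uq : Unique q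
      uq = Unique-++ʳ (hub s ∷ []) uxq
      avoids : ∀ {v} → v ∈ q → ∀ s' → v ≢ hub s'
      avoids v∈ s' refl with s' ≟ᵇ s
      ... | yes refl = Unique[x∷xs]⇒x∉xs uxq v∈
      ... | no ne = y∉ (∈-resp-↭ (↭-sym perm) (there (subst (λ z → hub z ∈ q) (not-≢ (ne ∘ sym)) v∈)))
      u≢w : u ≢ w
      u≢w = ends≢ uq (ℕₚ.≤-pred (subst (3 ≤_) (↭-length perm) len)) x
      T₀ : List (Fin m)
      T₀ = proj₁ (unmap-e q avoids)
      eT : map e T₀ ≡ q
      eT = proj₂ (unmap-e q avoids)
      uT : Unique T₀
      uT = Uniqueₚ.map⁻ (subst Unique (sym eT) uq)
      T-all : ∀ k → k ∈ T₀
      T-all k with ∈-resp-↭ perm (span (e k) (e≢hub k (not s)))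
      ... | here z = ⊥-elim (e≢hub k s z)
      ... | there z = ∈-unmap (subst (e k ∈_) (sym eT) z)
      walkT : ∃₂ λ k k' → e k ≡ u × e k' ≡ w × Walk AdjK k k' T₀
      walkT = walk-unmap e T₀ (subst (Walk (Adj H') u w) (sym eT) x)
      orient : u ≡ hub (not s) ⊎ (∃ λ i → u ≡ kv (s , i)) → w ≡ hub (not s) ⊎ (∃ λ i → w ≡ kv (s , i)) → _
      orient (inj₁ z) _ = ⊥-elim (avoids (walk-start x) (not s) z)
      orient (inj₂ _) (inj₁ z) = ⊥-elim (avoids (walk-end x) (not s) z)
      orient (inj₂ (true , a)) (inj₂ (true , b)) = ⊥-elim (u≢w (trans a (sym b)))
      orient (inj₂ (false , a)) (inj₂ (false , b)) = ⊥-elim (u≢w (trans a (sym b)))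
      orient (inj₂ (true , a)) (inj₂ (false , b)) = let (k , k' , p , q , y) = walkT in
        T₀ , uT , T-all , k , k' , trans p a , trans q b , y
      orient (inj₂ (false , a)) (inj₂ (true , b)) = let (k , k' , p , q , y) = walkT in
        reverse T₀ , Unique-↭ (↭-sym (↭-reverse T₀)) uT , (λ k → ∈-resp-↭ (↭-sym (↭-reverse T₀)) (T-all k))
        , k' , k , trans q b , trans p a , walk-reverse (Adj-sym H') y

    conn-J' : ∀ k l → Star AdjK k l
    conn-J' k l = let (T , _ , all , _ , _ , _ , _ , w) = spanning-J' true in
      Star.reverse (Adj-sym H') (walk-star w (all k)) ◅◅ walk-star w (all l)

    -- The path of `delJ` around `h` joins the two ends of one removed edge; `spanning-J'` for the
    -- same side closes it.
    ham-J : ∀ h → Hamiltonian (G ─ join (suc n) m (inj₁ h))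
    ham-J h with delJ h
    ... | s , P , uP , (h∉ , spanP) , x with spanning-J' s
    ... | T , uT , allT , k , k' , kt , kt' , y =
      finish (inj₁ h) (glue x kt' (walk-reverse (Adj-sym H') y) kt) (++⁺ˡ _ (map⁺ inj₂ (↭-reverse T))) uP uT
        ((h∉ ∘ ∈-inj₁⁻ P) , λ
          { (inj₁ h') ne → ∈-++⁺ˡ (∈-map⁺ inj₁ (spanP h' (ne ∘ cong inj₁)))
          ; (inj₂ k) _ → ∈-++⁺ʳ (map inj₁ P) (∈-map⁺ inj₂ (allT k)) })

    module _ (k₀ : Fin m) where

      Goal : Set
      Goal = Hamiltonian (G ─ join (suc n) m (inj₂ k₀))

      conclude : ∀ {p L R} → Cycle DotAdj p → p ↭ map inj₁ L ++ map inj₂ R → Unique L → (∀ h → h ∈ L)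
        → Unique R → SpansAllBut k₀ R → Goal
      conclude {L = L} {R} c perm uL allL uR (k∉ , spanR) = finish (inj₂ k₀) c perm uL uR
        ((k∉ ∘ ∈-inj₂⁻ L) , λ
          { (inj₁ h') _ → ∈-++⁺ˡ (∈-map⁺ inj₁ (allL h'))
          ; (inj₂ k) ne → ∈-++⁺ʳ (map inj₁ L) (∈-map⁺ inj₂ (spanR k (ne ∘ cong inj₂))) })

      -- The cycle of `H'` uses the edge `xy`. Without `x` and `y` it is one path of `J'` from a
      -- neighbour of `x` to a neighbour of `y`, closed by the good pair at the same two corners;
      -- any of the four pairs may occur.
      through-hub-edge : ∀ {w q} → Walk (Adj H') (hub false) w (hub false ∷ q) → Adj H' w (hub true) → w ≢ hub false
        → Unique (hub true ∷ hub false ∷ q) → SpansAllBut (e k₀) (hub true ∷ hub false ∷ q) → Goal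
      through-hub-edge (stop _) r ne u s = ⊥-elim (ne refl)
      through-hub-edge {w} {q} (r ∷ x) r' ne u (k∉ , span) with hub-nbr false r | hub-nbr true (Adj-sym H' r')
      ... | inj₁ refl | _ = ⊥-elim (Unique[x∷xs]⇒x∉xs u (there (walk-start x)))
      ... | inj₂ _ | inj₁ z = ⊥-elim (ne z)
      ... | inj₂ (j , refl) | inj₂ (i , refl) with unmap-e q avoids
        where
        avoids : ∀ {v} → v ∈ q → ∀ s → v ≢ hub s
        avoids v∈ true refl = Unique[x∷xs]⇒x∉xs u (there v∈)
        avoids v∈ false refl = Unique[x∷xs]⇒x∉xs (Unique-++ʳ (hub true ∷ []) u) v∈
      ... | T , refl with walk-unmap e T x | goodJ i j
      ... | k , k' , kt , kt' , y | P , uP , allP , z = conclude (glue z kt y kt') ↭-refl uP allP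
            (Uniqueₚ.map⁻ (Unique-++ʳ (hub true ∷ hub false ∷ []) u)) (k₀∉ , spanT)
        where
        k₀∉ : ¬ k₀ ∈ T
        k₀∉ k∈ = k∉ (there (there (∈-map⁺ e k∈)))
        spanT : ∀ k → k ≢ k₀ → k ∈ T
        spanT k ne with span (e k) (ne ∘ e-inj)
        ... | here z = ⊥-elim (e≢hub k true z)
        ... | there (here z) = ⊥-elim (e≢hub k false z)
        ... | there (there z) = ∈-unmap z

      -- The cycle of `H'` passes `x` and `y` separately. Without them it is two paths of `J'`, each
      -- from a neighbour of `x` to a neighbour of `y`; the disjoint paths from `a` to `b` and from
      -- `c` to `d` link them.
      around-hubs : ∀ {i i' w q} → Walk (Adj H') (kv (true , i)) w q → w ≡ kv (true , i') → i ≢ i'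
        → Unique (hub true ∷ q) → hub false ∈ q → SpansAllBut (e k₀) (hub true ∷ q) → Goal
      around-hubs {i} {i'} x w≡ i≢i' u y∈ (k∉ , span) with ∈-∃++ y∈
      around-hubs {i} {i'} (stop _) w≡ i≢i' u y∈ (k∉ , span) | [] , b , eq = ⊥-elim (kv≢hubs _ false (∷-injectiveˡ eq))
      around-hubs {i} {i'} (_ ∷ _) w≡ i≢i' u y∈ (k∉ , span) | [] , b , eq = ⊥-elim (kv≢hubs _ false (∷-injectiveˡ eq))
      around-hubs {i} {i'} x w≡ i≢i' u y∈ (k∉ , span) | A@(_ ∷ _) , B , refl with walk-split A B x (λ ())
      ... | v , x₁ , r , stop _ = ⊥-elim (kv≢hubs _ false (sym w≡))
      ... | v , x₁ , r , r' ∷ x₂ with hub-nbr false (Adj-sym H' r) | hub-nbr false r'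
      ... | inj₁ refl | _ = ⊥-elim (Unique[x∷xs]⇒x∉xs u (∈-++⁺ˡ (walk-end x₁)))
      ... | inj₂ _ | inj₁ refl = ⊥-elim (Unique[x∷xs]⇒x∉xs u (∈-++⁺ʳ A (there (walk-start x₂))))
      ... | inj₂ (j , refl) | inj₂ (j' , refl) with unmap-e A avoidsA | unmap-e B avoidsB
        where
        uq : Unique (A ++ hub false ∷ B)
        uq = Unique-++ʳ (hub true ∷ []) u
        avoidsA : ∀ {v} → v ∈ A → ∀ s → v ≢ hub s
        avoidsA v∈ true refl = Unique[x∷xs]⇒x∉xs u (∈-++⁺ˡ v∈)
        avoidsA v∈ false refl = Unique-++-≢ uq v∈ (here refl) refl
        avoidsB : ∀ {v} → v ∈ B → ∀ s → v ≢ hub s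
        avoidsB v∈ true refl = Unique[x∷xs]⇒x∉xs u (∈-++⁺ʳ A (there v∈))
        avoidsB v∈ false refl = Unique[x∷xs]⇒x∉xs (Unique-++ʳ A uq) v∈
      -- The path on side `true` has to end at corner `i`, where `T₁` begins; it therefore starts at
      -- `not i`.
      ... | T₁ , eq₁ | T₂ , refl with walk-unmap e T₁ (subst (Walk (Adj H') _ _) (sym eq₁) x₁) | walk-unmap e T₂ x₂ | twoJ (not i) j
      ... | k₁ , k₂ , kt₁ , kt₂ , y₁ | k₃ , k₄ , kt₃ , kt₄ , y₂ | P , Q , uPQ , allPQ , z₁ , z₂ =
        conclude (glue₂ {true , not i} {true , i} {false , j} {false , not j} z₁' kt₁ y₁ kt₂ z₂
                    (trans kt₃ (cong (λ l → kv (false , l)) (not-≢ j≢j'))) y₂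
                    (trans kt₄ (trans w≡ (cong (λ l → kv (true , l)) (not-≢ i≢i')))))
          (merge-↭ P T₁ Q T₂) uPQ allPQ uT (k₀∉ , spanT)
        where
        uq : Unique (A ++ hub false ∷ map e T₂)
        uq = Unique-++ʳ (hub true ∷ []) u
        z₁' : Walk AdjJ (hv (true , not i)) (hv (true , i)) P
        z₁' = subst (λ l → Walk AdjJ (hv (true , not i)) (hv (true , l)) P) (not-involutive i) z₁
        j≢j' : j ≢ j'
        j≢j' refl = Unique-++-≢ uq (walk-end x₁) (there (walk-start x₂)) refl
        rest-↭ : A ++ hub false ∷ map e T₂ ↭ hub false ∷ map e (T₁ ++ T₂)
        rest-↭ = ↭-trans (shifts A (hub false ∷ []))
          (prep _ (↭-reflexive (trans (cong (_++ map e T₂) (sym eq₁)) (sym (map-++ e T₁ T₂)))))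
        uT : Unique (T₁ ++ T₂)
        uT = Uniqueₚ.map⁻ (Unique-++ʳ (hub false ∷ []) (Unique-↭ rest-↭ uq))
        k₀∉ : ¬ k₀ ∈ T₁ ++ T₂
        k₀∉ k∈ = k∉ (there (∈-resp-↭ (↭-sym rest-↭) (there (∈-map⁺ e k∈))))
        spanT : ∀ k → k ≢ k₀ → k ∈ T₁ ++ T₂
        spanT k ne with span (e k) (ne ∘ e-inj)
        ... | here z = ⊥-elim (e≢hub k true z)
        ... | there z with ∈-resp-↭ rest-↭ z
        ... | here z' = ⊥-elim (e≢hub k false z')
        ... | there z' = ∈-unmap z'

      spans-↭ : ∀ {A : Set} {v : A} {p q} → p ↭ q → SpansAllBut v p → SpansAllBut v q
      spans-↭ r (a , b) = (a ∘ ∈-resp-↭ (↭-sym r)) , λ u ne → ∈-resp-↭ r (b u ne)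

      ham-J' : Goal
      ham-J' with hypoH' (e k₀)
      ... | p , c , up , len , sp with cycle-at c (proj₂ sp (hub true) (e≢hub k₀ true ∘ sym))
      ... | q , c' , perm with cyc-split c' (subst (3 ≤_) (↭-length perm) len)
      ... | u , w , r , x , r' = go (hub-nbr true r) (hub-nbr true (Adj-sym H' r'))
        where
        uxq : Unique (hub true ∷ q)
        uxq = Unique-↭ perm up
        spq : SpansAllBut (e k₀) (hub true ∷ q)
        spq = spans-↭ perm sp
        u≢w : u ≢ w
        u≢w = ends≢ (Unique-++ʳ (hub true ∷ []) uxq) (ℕₚ.≤-pred (subst (3 ≤_) (↭-length perm) len)) x
        uncons : ∀ {u w q} → Walk (Adj H') u w q → ∃ λ q' → q ≡ u ∷ q'
        uncons (stop _) = _ , refl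
        uncons (_ ∷ _) = _ , refl
        edge-case : ∀ {w q} → Walk (Adj H') (hub false) w q → Adj H' w (hub true) → w ≢ hub false
          → Unique (hub true ∷ q) → SpansAllBut (e k₀) (hub true ∷ q) → Goal
        edge-case x r ne u s with uncons x
        ... | _ , refl = through-hub-edge x r ne u s
        y∈q : hub false ∈ q
        y∈q with proj₂ spq (hub false) (e≢hub k₀ false ∘ sym)
        ... | here z = ⊥-elim (adj⇒≢ H' (hub-adj false) z)
        ... | there z = z
        go : u ≡ hub false ⊎ (∃ λ i → u ≡ kv (true , i)) → w ≡ hub false ⊎ (∃ λ i → w ≡ kv (true , i)) → Goal
        go (inj₁ refl) _ = edge-case x r' (u≢w ∘ sym) uxq spq
        go (inj₂ _) (inj₁ refl) = edge-case (walk-reverse (Adj-sym H') x) (Adj-sym H' r) u≢w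
          (Unique-↭ (prep _ (↭-sym (↭-reverse q))) uxq) (spans-↭ (prep _ (↭-sym (↭-reverse q))) spq)
        go (inj₂ (i , refl)) (inj₂ (i' , w≡)) = around-hubs x w≡ (λ { refl → u≢w (sym w≡) }) uxq y∈q spq

    ham-minus : ∀ i → Hamiltonian (G ─ i)
    ham-minus i = subst (λ j → Hamiltonian (G ─ j)) (join-splitAt (suc n) m i) (both (splitAt (suc n) i))
      where
      both : ∀ v → Hamiltonian (G ─ join (suc n) m v)
      both (inj₁ h) = ham-J h
      both (inj₂ k) = ham-J' k

-- Non-hamiltonicity and girth of the dot product

module DotCycles {n m : ℕ} {H : Graph (suc n)} {H' : Graph (suc (suc m))} (S : Setting H H')
  {G : Graph (suc n + m)} (isDot : Dot.IsDot S G) where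

  open Dot S
  open IsDot isDot
  open Lifting S using (Lifted; in-H; in-H'; in-J'; lift)
  open Gluing S isDot using (∈-inj₁⁻; ∈-inj₂⁻)


  lift-dot : ∀ {p} → IsCycle G p → Lifted (map (splitAt (suc n)) p)
  lift-dot {p} c with isCycle⇒cycle G c
  ... | u , v , w , r = lift (_ , _ , walk-map (splitAt (suc n)) (λ {i} {j} → down {i} {j}) w , down {v} {u} r)
          (Uniqueₚ.map⁺ (splitAt-injective (suc n)) (proj₁ c)) (subst (3 ≤_) (sym (length-map _ p)) (proj₁ (proj₂ c)))
    where
    down : ∀ {i j} → Adj G i j → DotAdj (splitAt (suc n) i) (splitAt (suc n) j)
    down {i} {j} q = to (subst₂ (Adj G) (sym (join-splitAt (suc n) m i)) (sym (join-splitAt (suc n) m j)) q)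

  unique-parts : ∀ {p} L {R} → IsCycle G p → map (splitAt (suc n)) p ↭ map inj₁ L ++ map inj₂ R → Unique L × Unique R
  unique-parts L c r = Uniqueₚ.map⁻ (Unique-++ˡ (map inj₁ L) u) , Uniqueₚ.map⁻ (Unique-++ʳ (map inj₁ L) u)
    where
    u = Unique-↭ r (Uniqueₚ.map⁺ (splitAt-injective (suc n)) (proj₁ c))

  unique-H' : ∀ {q R} → q ↭ hub true ∷ hub false ∷ map e R → Unique R → Unique q
  unique-H' {q} {R} r uR = Unique-↭ (↭-sym r)
    ((adj⇒≢ H' (hub-adj true) ∷ fresh true) ∷ fresh false ∷ Uniqueₚ.map⁺ e-inj uR)
    where
    fresh : ∀ s → All (hub s ≢_) (map e R)
    fresh s = Allₚ.map⁺ (All.universal (λ k q → e≢hub k s (sym q)) R)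

  in-p : ∀ {p} → (∀ i → i ∈ p) → ∀ v → v ∈ map (splitAt (suc n)) p
  in-p span v = subst (_∈ _) (splitAt-join (suc n) m v) (∈-map⁺ (splitAt (suc n)) (span (join (suc n) m v)))

  -- A spanning cycle contains all of `H` and of `J'`, so the vertices that `Lifted` keeps from
  -- either part span `H`, or `H'` together with the hubs.
  dot-nonhamiltonian : ¬ Hamiltonian H → ¬ Hamiltonian H' → ¬ Hamiltonian G
  dot-nonhamiltonian ¬ham ¬ham' (p , c , span) with lift-dot c
  ... | in-H L R r cyc len = ¬ham (L , cycle⇒isCycle H cyc (proj₁ (unique-parts L c r)) len
        , λ h → ∈-inj₁⁻ L (∈-resp-↭ r (in-p span (inj₁ h))))
  ... | in-H' L R q r cyc r' l l' = ¬ham' (q , cycle⇒isCycle H' cyc (unique-H' r' (proj₂ (unique-parts L c r)))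
          (subst (3 ≤_) (sym (↭-length r')) (s≤s (s≤s (subst (1 ≤_) (sym (length-map e R)) l'))))
        , λ v → ∈-resp-↭ (↭-sym r') (cover v))
    where
    cover : ∀ v → v ∈ hub true ∷ hub false ∷ map e R
    cover v with hub? v
    ... | inj₁ (true , q) = here q
    ... | inj₁ (false , q) = there (here q)
    ... | inj₂ f with e-onto f
    ... | k , refl = there (there (∈-map⁺ e (∈-inj₂⁻ L (∈-resp-↭ r (in-p span (inj₂ k))))))
  ... | in-J' R r cyc with ∈-map⁻ inj₂ (∈-resp-↭ r (in-p span (inj₁ (hv (true , true)))))
  ... | _ , _ , ()

  total : ∀ (p : List (Fin (suc n + m))) L R → map (splitAt (suc n)) p ↭ map inj₁ L ++ map inj₂ R → length p ≡ length L + length R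
  total p L R r = trans (sym (length-map (splitAt (suc n)) p)) (trans (↭-length r) (trans (length-++ (map inj₁ L))
    (cong₂ _+_ (length-map inj₁ L) (length-map inj₂ R))))

  dot-girth : ∀ {g g'} → (∀ q → IsCycle H q → g ≤ length q) → (∀ q → IsCycle H' q → g' ≤ length q)
    → ∀ p → IsCycle G p → g ⊓ g' ≤ length p
  dot-girth {g} {g'} minH minH' p c with lift-dot c
  ... | in-H L R r cyc len = ≤-trans (ℕₚ.m⊓n≤m g g') (≤-trans
          (minH L (cycle⇒isCycle H cyc (proj₁ (unique-parts L c r)) len))
          (subst (length L ≤_) (sym (total p L R r)) (ℕₚ.m≤m+n _ _)))
  ... | in-H' L R q r cyc r' l l' = ≤-trans (ℕₚ.m⊓n≤n g g') (≤-trans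
          (minH' q (cycle⇒isCycle H' cyc (unique-H' r' (proj₂ (unique-parts L c r)))
            (subst (3 ≤_) (sym lenq) (s≤s (s≤s l')))))
          (subst₂ _≤_ (sym lenq) (sym (total p L R r)) (ℕₚ.+-monoˡ-≤ (length R) l)))
    where
    lenq : length q ≡ 2 + length R
    lenq = trans (↭-length r') (cong (2 +_) (length-map e R))
  ... | in-J' R r cyc = ≤-trans (ℕₚ.m⊓n≤n g g') (subst (g' ≤_) len
          (minH' (map e R) (cycle⇒isCycle H' cyc
            (Uniqueₚ.map⁺ e-inj (proj₂ (unique-parts [] c r)))
            (subst (3 ≤_) (sym len) (proj₁ (proj₂ c))))))
    where
    len : length (map e R) ≡ length p
    len = trans (length-map e R) (trans (sym (length-map inj₂ R)) (trans (sym (↭-length r)) (length-map _ p)))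

-- The theorem's data as a setting

==⇒≡ : ∀ {n} {i j : Fin n} → T (i == j) → i ≡ j
==⇒≡ {i = i} {j} t with i ≟ j
... | yes e = e

≡⇒== : ∀ {n} {i j : Fin n} → i ≡ j → T (i == j)
≡⇒== {i = i} refl rewrite ==-refl i = _

pick : {A : Set} → A → A → A → A → Corner → A
pick a b c d (true , true) = a
pick a b c d (true , false) = b
pick a b c d (false , true) = c
pick a b c d (false , false) = d

T-∨⁻ : ∀ {x y} → T (x ∨ y) → T x ⊎ T y
T-∨⁻ = Equivalence.to T-∨

T-∨⁺ : ∀ {x y} → T x ⊎ T y → T (x ∨ y)
T-∨⁺ = Equivalence.from T-∨

pair⁻ : ∀ {n m} {i j : Fin n} {k l : Fin m} → T ((i == j) ∧ (k == l)) → i ≡ j × k ≡ l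
pair⁻ {i = i} {j} q = let (r , s) = T-∧⁻ {i == j} q in ==⇒≡ r , ==⇒≡ s

pair⁺ : ∀ {n m} {i j : Fin n} {k l : Fin m} → i ≡ j → k ≡ l → T ((i == j) ∧ (k == l))
pair⁺ p q = T-∧⁺ (≡⇒== p) (≡⇒== q)

cross⁻ : ∀ {n m} (a b c d : Fin n) (a' b' c' d' : Fin m) {h v}
  → T (cross a b c d a' b' c' d' h v) → ∃ λ t → h ≡ pick a b c d t × v ≡ pick a' b' c' d' t
cross⁻ a b c d a' b' c' d' {h} {v} p with T-∨⁻ {(h == a) ∧ (v == a')} p
... | inj₁ q = (true , true) , pair⁻ q
... | inj₂ p₁ with T-∨⁻ {(h == b) ∧ (v == b')} p₁
... | inj₁ q = (true , false) , pair⁻ q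
... | inj₂ p₂ with T-∨⁻ {(h == c) ∧ (v == c')} p₂
... | inj₁ q = (false , true) , pair⁻ q
... | inj₂ q = (false , false) , pair⁻ q

cross⁺ : ∀ {n m} (a b c d : Fin n) (a' b' c' d' : Fin m) {h v} t
  → h ≡ pick a b c d t → v ≡ pick a' b' c' d' t → T (cross a b c d a' b' c' d' h v)
cross⁺ a b c d a' b' c' d' {h} {v} t p q with t
... | true , true = T-∨⁺ {(h == a) ∧ (v == a')} (inj₁ (pair⁺ p q))
... | true , false = T-∨⁺ {(h == a) ∧ (v == a')} (inj₂ (T-∨⁺ {(h == b) ∧ (v == b')} (inj₁ (pair⁺ p q))))
... | false , true = T-∨⁺ {(h == a) ∧ (v == a')} (inj₂ (T-∨⁺ {(h == b) ∧ (v == b')} (inj₂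
                       (T-∨⁺ {(h == c) ∧ (v == c')} (inj₁ (pair⁺ p q))))))
... | false , false = T-∨⁺ {(h == a) ∧ (v == a')} (inj₂ (T-∨⁺ {(h == b) ∧ (v == b')} (inj₂
                       (T-∨⁺ {(h == c) ∧ (v == c')} (inj₂ (pair⁺ p q))))))

emb-injective : ∀ {m} (x y : Fin (suc (suc m))) (x≢y : x ≢ y) {k k'} → emb x y x≢y k ≡ emb x y x≢y k' → k ≡ k'
emb-injective x y x≢y p = punchIn-injective _ _ _ (punchIn-injective x _ _ p)

emb-≢ˡ : ∀ {m} (x y : Fin (suc (suc m))) (x≢y : x ≢ y) k → emb x y x≢y k ≢ x
emb-≢ˡ x y x≢y k = punchInᵢ≢i x _

emb-≢ʳ : ∀ {m} (x y : Fin (suc (suc m))) (x≢y : x ≢ y) k → emb x y x≢y k ≢ y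
emb-≢ʳ x y x≢y k p = punchInᵢ≢i (punchOut x≢y) k
  (punchIn-injective x _ _ (trans p (sym (punchIn-punchOut x≢y))))

emb-onto : ∀ {m} (x y : Fin (suc (suc m))) (x≢y : x ≢ y) {v} → v ≢ x → v ≢ y → ∃ λ k → emb x y x≢y k ≡ v
emb-onto x y x≢y {v} v≢x v≢y = punchOut {i = punchOut x≢y} {punchOut (v≢x ∘ sym)} ne
    , trans (cong (punchIn x) (punchIn-punchOut ne)) (punchIn-punchOut (v≢x ∘ sym))
  where
  ne : punchOut x≢y ≢ punchOut (v≢x ∘ sym)
  ne p = v≢y (sym (punchOut-injective x≢y (v≢x ∘ sym) p))

-- A rotation acts transitively on the neighbours. On three of them it has neither a fixed point nor
-- a closed pair, so it is a 3-cycle.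
cubic-rotation : ∀ {n} {G : Graph n} (R : RotationSystem G) → Cubic G → ∀ {x y} → Adj G x y
  → OtherNeighbours G x y (rot R x y) (rot R x (rot R x y)) × rot R x (rot R x (rot R x y)) ≡ y
cubic-rotation {G = G} R cubic {x} {y} xy = (xp , xq , p≢q , p≢y , q≢y) , back
  where
  p q : Fin _
  p = rot R x y
  q = rot R x p
  xp : Adj G x p
  xp = rot-adj R x y xy
  xq : Adj G x q
  xq = rot-adj R x p xp
  stuck : ∀ {P : Fin _ → Set} → P y → (∀ {v} → P v → P (rot R x v)) → ∀ {u} → Adj G x u → P u
  stuck {P} Py step xu with rot-cyc R x y _ xy xu
  ... | k , refl = go k
    where
    go : ∀ k → P (iter (rot R x) k y)
    go zero = Py
    go (suc k) = step (go k)
  p≢y : p ≢ y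
  p≢y e with cubic-third G (cubic x) y y
  ... | u , xu , u≢y , _ = u≢y (stuck {_≡ y} refl (λ { refl → e }) xu)
  q≢y : q ≢ y
  q≢y e with cubic-third G (cubic x) y p
  ... | u , xu , u≢y , u≢p with stuck {λ v → v ≡ y ⊎ v ≡ p} (inj₁ refl)
                                  (λ { (inj₁ refl) → inj₂ refl ; (inj₂ refl) → inj₁ e }) xu
  ... | inj₁ z = u≢y z
  ... | inj₂ z = u≢p z
  p≢q : p ≢ q
  p≢q e = p≢y (sym (rot-inj R x y p xy xp e))
  back : rot R x q ≡ y
  back with cubic-cover G (cubic x) xy xp xq (p≢y ∘ sym) (q≢y ∘ sym) p≢q (rot-adj R x q xq)
  ... | inj₁ z = z
  ... | inj₂ (inj₁ z) = ⊥-elim (q≢y (rot-inj R x q y xq xy z))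
  ... | inj₂ (inj₂ z) = ⊥-elim (p≢q (sym (rot-inj R x q p xq xp z)))

-- Exchanging the roles of a and b, or of c and d, makes the common face run
-- through both edges in the direction fixed by the labels.
module _ (φ : Bool → Bool) where

  relabelling : Corner → Corner
  relabelling (s , i) = s , φ s xor i

  private
    xor-involutive : ∀ b i → b xor (b xor i) ≡ i
    xor-involutive true i = not-involutive i
    xor-involutive false i = refl

    xor-not : ∀ b i → b xor not i ≡ not (b xor i)
    xor-not true i = refl
    xor-not false i = refl

    ρ = relabelling

    ρ-involutive : ∀ t → ρ (ρ t) ≡ t
    ρ-involutive (s , i) = cong (s ,_) (xor-involutive (φ s) i)

    ρ-mate : ∀ t → ρ (mate t) ≡ mate (ρ t)
    ρ-mate (s , i) = cong (s ,_) (xor-not (φ s) i)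

  module _ {n m : ℕ} {H : Graph n} {H' : Graph (suc (suc m))} (S : Setting H H') where

    open Setting S

    relabel : Setting H H'
    relabel = record
      { hv = hv ∘ ρ
      ; hv-inj = λ {s} {t} p → trans (sym (ρ-involutive s)) (trans (cong ρ (hv-inj p)) (ρ-involutive t))
      ; hv-adj = λ t → subst (λ s → Adj H (hv (ρ t)) (hv s)) (sym (ρ-mate t)) (hv-adj (ρ t))
      ; hub = hub
      ; hub-adj = hub-adj
      ; kv = kv ∘ ρ
      ; kv-adj = λ t → kv-adj (ρ t)
      ; kv≢hub = λ t → kv≢hub (ρ t)
      ; kv-mate = λ t p → kv-mate (ρ t) (trans (cong kv (sym (ρ-mate t))) p)
      ; hub-nbr = λ s p → relabel-nbr (hub-nbr s p)
      ; e = e ; e-inj = e-inj ; e≢hub = e≢hub ; e-onto = e-onto }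
      where
      relabel-nbr : ∀ {s v} → v ≡ hub (not s) ⊎ (∃ λ i → v ≡ kv (s , i)) → v ≡ hub (not s) ⊎ (∃ λ i → v ≡ kv (ρ (s , i)))
      relabel-nbr (inj₁ p) = inj₁ p
      relabel-nbr {s} (inj₂ (i , p)) = inj₂ (φ s xor i , trans p (cong kv (sym (ρ-involutive (s , i)))))

    private
      module A = Dot S
      module B = Dot relabel

      cut⁻ : ∀ {h h'} → B.Cut h h' → A.Cut h h'
      cut⁻ (t , p , q) = ρ t , p , trans q (cong hv (ρ-mate t))

      cut⁺ : ∀ {h h'} → A.Cut h h' → B.Cut h h'
      cut⁺ (t , p , q) = ρ t , trans p (cong hv (sym (ρ-involutive t)))
        , trans q (cong hv (trans (sym (ρ-involutive (mate t))) (cong ρ (ρ-mate t))))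

    relabel-AdjJ : ∀ {u v} → A.AdjJ u v → B.AdjJ u v
    relabel-AdjJ (p , c) = p , c ∘ cut⁻

    relabel-isDot : ∀ {G} → A.IsDot G → B.IsDot G
    relabel-isDot isDot = record { to = up ∘ A.IsDot.to isDot ; from = A.IsDot.from isDot ∘ down }
      where
      up : ∀ {u v} → A.DotAdj u v → B.DotAdj u v
      up (A.jj p) = B.jj (relabel-AdjJ p)
      up (A.jk t p q) = B.jk (ρ t) (trans p (cong hv (sym (ρ-involutive t)))) (trans q (cong kv (sym (ρ-involutive t))))
      up (A.kj t p q) = B.kj (ρ t) (trans p (cong hv (sym (ρ-involutive t)))) (trans q (cong kv (sym (ρ-involutive t))))
      up (A.kk p) = B.kk p
      down : ∀ {u v} → B.DotAdj u v → A.DotAdj u v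
      down (B.jj (p , c)) = A.jj (p , c ∘ cut⁺)
      down (B.jk t p q) = A.jk (ρ t) p q
      down (B.kj t p q) = A.kj (ρ t) p q
      down (B.kk p) = A.kk p

-- The given edges, labels and good pairs in terms of corners

module Theorem {n m : ℕ} (H : Graph (suc n)) (H' : Graph (suc (suc m)))
  (cubicH : Cubic H) (cubicH' : Cubic H') (nonham : ¬ Hamiltonian H) (hypo : Hypohamiltonian H')
  (a b c d : Fin (suc n)) (ab : Adj H a b) (cd : Adj H c d)
  (a≢c : a ≢ c) (a≢d : a ≢ d) (b≢c : b ≢ c) (b≢d : b ≢ d)
  (x y : Fin (suc (suc m))) (xy : Adj H' x y)
  (good-ac : GoodPair (delEdge (delEdge H a b) c d) a c)
  (good-ad : GoodPair (delEdge (delEdge H a b) c d) a d)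
  (good-bc : GoodPair (delEdge (delEdge H a b) c d) b c)
  (good-bd : GoodPair (delEdge (delEdge H a b) c d) b d)
  (good-two : GoodTwoPairs (delEdge (delEdge H a b) c d) a b c d)
  (good-del : ∀ t → GoodPairDel (delEdge (delEdge H a b) c d) t a b
                  ⊎ GoodPairDel (delEdge (delEdge H a b) c d) t c d) where

  Jᴳ : Graph (suc n)
  Jᴳ = delEdge (delEdge H a b) c d

  hubs : Bool → Fin (suc (suc m))
  hubs true = x
  hubs false = y

  h₀ : Corner → Fin (suc n)
  h₀ = pick a b c d

  h₀-inj : ∀ {s t} → h₀ s ≡ h₀ t → s ≡ t
  h₀-inj {true , true} {true , true} _ = refl
  h₀-inj {true , true} {true , false} p = ⊥-elim (adj⇒≢ H ab p)
  h₀-inj {true , true} {false , true} p = ⊥-elim (a≢c p)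
  h₀-inj {true , true} {false , false} p = ⊥-elim (a≢d p)
  h₀-inj {true , false} {true , true} p = ⊥-elim (adj⇒≢ H ab (sym p))
  h₀-inj {true , false} {true , false} _ = refl
  h₀-inj {true , false} {false , true} p = ⊥-elim (b≢c p)
  h₀-inj {true , false} {false , false} p = ⊥-elim (b≢d p)
  h₀-inj {false , true} {true , true} p = ⊥-elim (a≢c (sym p))
  h₀-inj {false , true} {true , false} p = ⊥-elim (b≢c (sym p))
  h₀-inj {false , true} {false , true} _ = refl
  h₀-inj {false , true} {false , false} p = ⊥-elim (adj⇒≢ H cd p)
  h₀-inj {false , false} {true , true} p = ⊥-elim (a≢d (sym p))
  h₀-inj {false , false} {true , false} p = ⊥-elim (b≢d (sym p))
  h₀-inj {false , false} {false , true} p = ⊥-elim (adj⇒≢ H cd (sym p))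
  h₀-inj {false , false} {false , false} _ = refl

  module Labelled (a' b' c' d' : Fin (suc (suc m)))
    (ox : OtherNeighbours H' x y a' b') (oy : OtherNeighbours H' y x c' d') where

    k₀ : Corner → Fin (suc (suc m))
    k₀ = pick a' b' c' d'

    setting : Setting H H'
    setting = record
      { hv = h₀
      ; hv-inj = h₀-inj
      ; hv-adj = λ { (true , true) → ab ; (true , false) → Adj-sym H ab
                   ; (false , true) → cd ; (false , false) → Adj-sym H cd }
      ; hub = hubs
      ; hub-adj = λ { true → xy ; false → Adj-sym H' xy }
      ; kv = k₀
      ; kv-adj = λ { (true , true) → proj₁ ox ; (true , false) → proj₁ (proj₂ ox)
                   ; (false , true) → proj₁ oy ; (false , false) → proj₁ (proj₂ oy) }
      ; kv≢hub = λ { (true , true) → proj₁ (proj₂ (proj₂ (proj₂ ox))) ; (true , false) → proj₂ (proj₂ (proj₂ (proj₂ ox)))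
                   ; (false , true) → proj₁ (proj₂ (proj₂ (proj₂ oy))) ; (false , false) → proj₂ (proj₂ (proj₂ (proj₂ oy))) }
      ; kv-mate = λ { (true , true) → proj₁ (proj₂ (proj₂ ox)) ∘ sym ; (true , false) → proj₁ (proj₂ (proj₂ ox))
                    ; (false , true) → proj₁ (proj₂ (proj₂ oy)) ∘ sym ; (false , false) → proj₁ (proj₂ (proj₂ oy)) }
      ; hub-nbr = λ { true r → corner true (nbr xy ox r) ; false r → corner false (nbr (Adj-sym H' xy) oy r) }
      ; e = emb x y (adj⇒≢ H' xy)
      ; e-inj = emb-injective x y _
      ; e≢hub = λ { k true → emb-≢ˡ x y _ k ; k false → emb-≢ʳ x y _ k }
      ; e-onto = λ f → emb-onto x y _ (f true) (f false)
      }
      where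
      nbr : ∀ {x y a' b' v} → Adj H' x y → OtherNeighbours H' x y a' b' → Adj H' x v
        → v ≡ y ⊎ v ≡ a' ⊎ v ≡ b'
      nbr xy (xa , xb , a≢b , a≢y , b≢y) =
        cubic-cover H' (cubicH' _) xy xa xb (a≢y ∘ sym) (b≢y ∘ sym) a≢b
      corner : ∀ s {v} → v ≡ hubs (not s) ⊎ v ≡ k₀ (s , true) ⊎ v ≡ k₀ (s , false)
        → v ≡ hubs (not s) ⊎ ∃ λ i → v ≡ k₀ (s , i)
      corner s (inj₁ p) = inj₁ p
      corner s (inj₂ (inj₁ p)) = inj₂ (true , p)
      corner s (inj₂ (inj₂ p)) = inj₂ (false , p)

    G : Graph (suc n + m)
    G = dot H H' a b c d x y xy a' b' c' d'

    open Dot setting using (AdjJ; Cut; DotAdj; IsDot; jj; jk; kj; kk; V)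

    Jᴳ⇒AdjJ : ∀ {u v} → Adj Jᴳ u v → AdjJ u v
    Jᴳ⇒AdjJ p = delEdge-⊆ H (delEdge-⊆ H₁ p) , λ
      { ((true , true) , refl , refl) → delEdge-∌ H (delEdge-⊆ H₁ p)
      ; ((true , false) , refl , refl) → delEdge-∌ H (Adj-sym H₁ (delEdge-⊆ H₁ p))
      ; ((false , true) , refl , refl) → delEdge-∌ H₁ p
      ; ((false , false) , refl , refl) → delEdge-∌ H₁ (Adj-sym Jᴳ p) }
      where
      H₁ : Graph (suc n)
      H₁ = delEdge H a b

    AdjJ⇒Jᴳ : ∀ {u v} → AdjJ u v → Adj Jᴳ u v
    AdjJ⇒Jᴳ (p , f) = delEdge⁺ (delEdge H a b)
      (delEdge⁺ H p (λ q → f ((true , true) , q)) (λ q → f ((true , false) , q)))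
      (λ q → f ((false , true) , q)) (λ q → f ((false , false) , q))

    isDot : IsDot G
    isDot = record { to = λ {u} {v} p → subst₂ DotAdj (splitAt-join (suc n) m u) (splitAt-join (suc n) m v)
                                        (to {join (suc n) m u} {join (suc n) m v} p)
                   ; from = λ {u} {v} p → from u v p }
      where
      to : ∀ {i j} → Adj G i j → DotAdj (splitAt (suc n) i) (splitAt (suc n) j)
      to {i} {j} p with splitAt (suc n) i | splitAt (suc n) j
      ... | inj₁ h | inj₁ h' = jj (Jᴳ⇒AdjJ p)
      ... | inj₂ k | inj₂ k' = kk p
      ... | inj₁ h | inj₂ k = let (t , q , r) = cross⁻ a b c d a' b' c' d' p in jk t q r
      ... | inj₂ k | inj₁ h = let (t , q , r) = cross⁻ a b c d a' b' c' d' p in kj t q r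
      from : ∀ u v → DotAdj u v → Adj G (join (suc n) m u) (join (suc n) m v)
      from u v p rewrite splitAt-join (suc n) m u | splitAt-join (suc n) m v with p
      ... | jj q = AdjJ⇒Jᴳ q
      ... | jk t q r = cross⁺ a b c d a' b' c' d' t q r
      ... | kj t q r = cross⁺ a b c d a' b' c' d' t q r
      ... | kk q = q

    walkJ : ∀ {u v p} → Walk (Adj Jᴳ) u v p → Walk AdjJ u v p
    walkJ w = subst (Walk AdjJ _ _) (map-id _) (walk-map id Jᴳ⇒AdjJ w)

    good : ∀ {u v} → GoodPair Jᴳ u v → ∃ λ p → Unique p × (∀ h → h ∈ p) × Walk AdjJ u v p
    good (p , up , all , lk , hd , ls) = p , up , all , walkJ (path⇒walk lk hd ls)

    goodJ : ∀ i j → ∃ λ p → Unique p × (∀ h → h ∈ p) × Walk AdjJ (h₀ (true , i)) (h₀ (false , j)) p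
    goodJ true true = good good-ac
    goodJ true false = good good-ad
    goodJ false true = good good-bc
    goodJ false false = good good-bd

    TwoJ : Bool → Bool → Set
    TwoJ i j = ∃₂ λ p q → Unique (p ++ q) × (∀ h → h ∈ p ++ q)
        × Walk AdjJ (h₀ (true , i)) (h₀ (true , not i)) p × Walk AdjJ (h₀ (false , j)) (h₀ (false , not j)) q

    twoJ : ∀ i j → TwoJ i j
    twoJ i j = let (p , q , u , all , (lk , hd , ls) , (lk' , hd' , ls')) = good-two in
      orient i j u all (walkJ (path⇒walk lk hd ls)) (walkJ (path⇒walk lk' hd' ls'))
      where
      open Dot setting using (AdjJ-sym)
      orient : ∀ i j {p q} → Unique (p ++ q) → (∀ h → h ∈ p ++ q) → Walk AdjJ a b p → Walk AdjJ c d q → TwoJ i j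
      orient true true u all v w = _ , _ , u , all , v , w
      orient true false {p} {q} u all v w = p , reverse q , Unique-↭ r u , (λ h → ∈-resp-↭ r (all h)) , v , walk-reverse AdjJ-sym w
        where
        r : p ++ q ↭ p ++ reverse q
        r = ++⁺ˡ p (↭-sym (↭-reverse q))
      orient false true {p} {q} u all v w = reverse p , q , Unique-↭ r u , (λ h → ∈-resp-↭ r (all h)) , walk-reverse AdjJ-sym v , w
        where
        r : p ++ q ↭ reverse p ++ q
        r = ++⁺ʳ q (↭-sym (↭-reverse p))
      orient false false {p} {q} u all v w = reverse p , reverse q , Unique-↭ r u , (λ h → ∈-resp-↭ r (all h))
          , walk-reverse AdjJ-sym v , walk-reverse AdjJ-sym w
        where
        r : p ++ q ↭ reverse p ++ reverse q
        r = ++⁺ (↭-sym (↭-reverse p)) (↭-sym (↭-reverse q))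

    lift-path : ∀ {h v₀ w₀ p} → Unique p → (∀ u → u ∈ p) → Walk (Adj (Jᴳ ─ h)) v₀ w₀ p
      → ∃ λ p → Unique p × SpansAllBut h p × Walk AdjJ (punchIn h v₀) (punchIn h w₀) p
    lift-path {h} {p = p} u all w = map (punchIn h) p , Uniqueₚ.map⁺ (punchIn-injective h _ _) u
        , (h∉ , λ v ne → subst (_∈ _) (punchIn-punchOut (ne ∘ sym)) (∈-map⁺ (punchIn h) (all (punchOut (ne ∘ sym)))))
        , walk-map (punchIn h) Jᴳ⇒AdjJ w
      where
      h∉ : ¬ h ∈ map (punchIn h) p
      h∉ h∈ with ∈-map⁻ (punchIn h) h∈
      ... | i , _ , q = punchInᵢ≢i h i (sym q)

    delJ : ∀ h → ∃ λ s → ∃ λ p → Unique p × SpansAllBut h p × Walk AdjJ (h₀ (s , true)) (h₀ (s , false)) p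
    delJ h with good-del h
    ... | inj₁ (v₀ , w₀ , refl , refl , p , u , all , lk , hd , ls) = true , lift-path u all (path⇒walk lk hd ls)
    ... | inj₂ (v₀ , w₀ , refl , refl , p , u , all , lk , hd , ls) = false , lift-path u all (path⇒walk lk hd ls)

    dot-minus-hamiltonian : ∀ i → Hamiltonian (G ─ i)
    dot-minus-hamiltonian = Gluing.ham-minus setting isDot goodJ twoJ delJ (λ v → hamiltonian-─⁻ H' v (proj₂ hypo v))

    open DotCycles setting isDot using (dot-nonhamiltonian; dot-girth) public

    dot-hypohamiltonian : Hypohamiltonian G
    dot-hypohamiltonian = dot-nonhamiltonian nonham (proj₁ hypo) , dot-minus-hamiltonian

    dot-is-cubic : Cubic G
    dot-is-cubic = Dot.Cubicity.dot-cubic setting cubicH cubicH' isDot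

    conn-J : ∀ u v → Star AdjJ u v
    conn-J = Gluing.conn-J setting isDot goodJ twoJ delJ (λ v → hamiltonian-─⁻ H' v (proj₂ hypo v))

    conn-J' : ∀ k l → Star (λ k l → Adj H' (Setting.e setting k) (Setting.e setting l)) k l
    conn-J' = Gluing.conn-J' setting isDot goodJ twoJ delJ (λ v → hamiltonian-─⁻ H' v (proj₂ hypo v))

    -- Renaming corners leaves the graph `G` itself unchanged, so planarity may be proved under
    -- whichever names suit the direction of the common face.
    planar-with : ∀ φ (R : RotationSystem H) (R' : RotationSystem H')
      → let open Setting (relabel φ setting) in
        (∀ s → rot R' (hub s) (hub (not s)) ≡ kv (s , true))
      → (∀ s → rot R' (hub s) (kv (s , true)) ≡ kv (s , false))
      → (∀ s → rot R' (hub s) (kv (s , false)) ≡ hub (not s))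
      → IsPlanarEmbedding R → IsPlanarEmbedding R'
      → SameFace R (hv (true , true) , hv (true , false)) (hv (false , true) , hv (false , false))
      → Planar G
    planar-with φ R R' r₁ r₂ r₃ plR plR' common = PlanarDot.dot-planar (relabel φ setting)
      (relabel-isDot φ setting isDot) cubicH cubicH' R R' r₁ r₂ r₃
      (λ u v → Star.map (relabel-AdjJ φ setting) (conn-J u v)) conn-J' plR plR' common

  swap-neighbours : ∀ {u v p q} → OtherNeighbours H' u v p q → OtherNeighbours H' u v q p
  swap-neighbours (up , uq , p≢q , p≢v , q≢v) = uq , up , p≢q ∘ sym , q≢v , p≢v

  dot-planar : Planar H' → PlanarWithCommonFace H a b c d
    → ∃₂ λ a' b' → ∃₂ λ c' d' → OtherNeighbours H' x y a' b' × OtherNeighbours H' y x c' d'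
    × Planar (dot H H' a b c d x y xy a' b' c' d')
  dot-planar (R' , plR') (R , plR@(_ , _ , faces , _) , dt , dt∈ , on-ab , on-cd) = choose on-ab on-cd
    where
    -- Up to such an exchange, a' and b' follow y in the rotation at x, and c' and
    -- d' follow x in the rotation at y.
    p = rot R' x y
    q = rot R' x p
    r = rot R' y x
    s = rot R' y r
    Nx : OtherNeighbours H' x y p q × rot R' x q ≡ y
    Nx = cubic-rotation R' cubicH' xy
    Ny : OtherNeighbours H' y x r s × rot R' y s ≡ x
    Ny = cubic-rotation R' cubicH' (Adj-sym H' xy)
    module O = Orbits {π = faceStep R} (Planarity.faceStep-closed R cubicH) faces
    meet : ∀ {d₁ d₂} → SameFace R dt d₁ → SameFace R dt d₂ → SameFace R d₁ d₂
    meet u v = ⇝-trans (O.⇝-sym dt∈ u) v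
    choose : EdgeOnFace R a b dt → EdgeOnFace R c d dt → _
    choose (inj₁ u) (inj₁ v) = p , q , r , s , proj₁ Nx , proj₁ Ny
      , Labelled.planar-with p q r s (proj₁ Nx) (proj₁ Ny) (λ { true → false ; false → false }) R R'
          (λ { true → refl ; false → refl }) (λ { true → refl ; false → refl })
          (λ { true → proj₂ Nx ; false → proj₂ Ny }) plR plR' (meet u v)
    -- The face runs through `(b , a)`. With `a'` and `b'` traded and `φ true` set, the corner
    -- `(true , true)` becomes `b` with partner `p`, again the successor of `y`.
    choose (inj₂ u) (inj₁ v) = q , p , r , s , swap-neighbours (proj₁ Nx) , proj₁ Ny
      , Labelled.planar-with q p r s (swap-neighbours (proj₁ Nx)) (proj₁ Ny) (λ { true → true ; false → false }) R R'
          (λ { true → refl ; false → refl }) (λ { true → refl ; false → refl })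
          (λ { true → proj₂ Nx ; false → proj₂ Ny }) plR plR' (meet u v)
    choose (inj₁ u) (inj₂ v) = p , q , s , r , proj₁ Nx , swap-neighbours (proj₁ Ny)
      , Labelled.planar-with p q s r (proj₁ Nx) (swap-neighbours (proj₁ Ny)) (λ { true → false ; false → true }) R R'
          (λ { true → refl ; false → refl }) (λ { true → refl ; false → refl })
          (λ { true → proj₂ Nx ; false → proj₂ Ny }) plR plR' (meet u v)
    choose (inj₂ u) (inj₂ v) = q , p , s , r , swap-neighbours (proj₁ Nx) , swap-neighbours (proj₁ Ny)
      , Labelled.planar-with q p s r (swap-neighbours (proj₁ Nx)) (swap-neighbours (proj₁ Ny))
          (λ { true → true ; false → true }) R R'
          (λ { true → refl ; false → refl }) (λ { true → refl ; false → refl })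
          (λ { true → proj₂ Nx ; false → proj₂ Ny }) plR plR' (meet u v)

theorem2p1 : ∀ {n m : ℕ} (H : Graph (suc n)) (H' : Graph (suc (suc m)))
    → 6 ≤ suc n → 6 ≤ suc (suc m)
    → Cubic H → Cubic H' → ¬ Hamiltonian H → Hypohamiltonian H'
    → (a b c d : Fin (suc n)) → Adj H a b → Adj H c d
    → a ≢ c → a ≢ d → b ≢ c → b ≢ d
    → (x y : Fin (suc (suc m))) → (xy : Adj H' x y)
    → GoodPair (delEdge (delEdge H a b) c d) a c
    → GoodPair (delEdge (delEdge H a b) c d) a d
    → GoodPair (delEdge (delEdge H a b) c d) b c
    → GoodPair (delEdge (delEdge H a b) c d) b d
    → GoodTwoPairs (delEdge (delEdge H a b) c d) a b c d
    → (∀ t → GoodPairDel (delEdge (delEdge H a b) c d) t a b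
    ⊎ GoodPairDel (delEdge (delEdge H a b) c d) t c d)
    → (∀ a' b' c' d' → OtherNeighbours H' x y a' b' → OtherNeighbours H' y x c' d'
    → Cubic (dot H H' a b c d x y xy a' b' c' d')
    × Hypohamiltonian (dot H H' a b c d x y xy a' b' c' d'))
    × (Planar H' → PlanarWithCommonFace H a b c d
    → ∃₂ λ a' b' → ∃₂ λ c' d' → OtherNeighbours H' x y a' b' × OtherNeighbours H' y x c' d'
    × Planar (dot H H' a b c d x y xy a' b' c' d'))
    × (∀ (g g' : ℕ) → IsGirth H g → IsGirth H' g'
    → ∀ a' b' c' d' → OtherNeighbours H' x y a' b' → OtherNeighbours H' y x c' d'
    → ∀ p → IsCycle (dot H H' a b c d x y xy a' b' c' d') p → g ⊓ g' ≤ length p)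
theorem2p1 H H' _ _ cubicH cubicH' nonham hypo a b c d ab cd a≢c a≢d b≢c b≢d x y xy
  good-ac good-ad good-bc good-bd good-two good-del =
    (λ a' b' c' d' ox oy → Labelled.dot-is-cubic a' b' c' d' ox oy , Labelled.dot-hypohamiltonian a' b' c' d' ox oy)
  , dot-planar
  , λ g g' girth girth' a' b' c' d' ox oy → Labelled.dot-girth a' b' c' d' ox oy (proj₂ girth) (proj₂ girth')
  where
  open Theorem H H' cubicH cubicH' nonham hypo a b c d ab cd a≢c a≢d b≢c b≢d x y xy
         good-ac good-ad good-bc good-bd good-two good-del
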